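{- Let $n\ge 6$ be an integer, $q=2^n$, $a_1\in\mathbb{F}_q^{*}$, $a_2,b\in\mathbb{F}_{q^2}^{*}$ with $a_1\ne a_2$. For $i=1,2$ let $f_i(x)={\rm Tr}_1^{2n}\!\left(\frac{a_i}{x^{q-1}+b}\right)$ for $x\in\mathbb{F}_{q^2}$, and let $h_2(x)=f_1(x)f_2(x)$. Then $h_2$ is bent if and only if one of the following conditions holds: (1) $b=1$, ${\rm Tr}_1^n(a_1)=1$ and $a_2\in\mathbb{F}_{q^2}^{*}\setminus\mathbb{F}_q^{*}$; (2) $b\in U\setminus\{1\}$, ${\rm Tr}_n^{2n}(a_2\overline{b})=0$, ${\rm Tr}_1^n(a_2\overline{a_2})=1$ and $h_2(0)=0$; (3) $b\in U\setminus\{1\}$, ${\rm Tr}_n^{2n}((a_1+a_2)\overline{b})=0$, ${\rm Tr}_1^n((a_1+a_2)(a_1+\overline{a_2}))=0$ and $h_2(0)=0$.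
   Context: For $k\mid m$, ${\rm Tr}_k^m(x)=x+x^{2^k}+\dots+x^{2^{(m/k-1)k}}$ is the trace from $\mathbb{F}_{2^m}$ to $\mathbb{F}_{2^k}$. For $x\in\mathbb{F}_{q^2}$, $\overline{x}=x^{q}$. $U=\{\eta\in\mathbb{F}_{q^2}:\eta^{q+1}=1\}$. Convention: $\frac{1}{0}=0$. Note $h_2(0)={\rm Tr}_1^{2n}(a_1/b)\,{\rm Tr}_1^{2n}(a_2/b)$. The Walsh transform of $f:\mathbb{F}_{2^{2n}}\to\mathbb{F}_2$ is $W_f(\omega)=\sum_{x}(-1)^{f(x)+{\rm Tr}_1^{2n}(\omega x)}$, and $f$ is bent if $W_f(\omega)^2=2^{2n}$ for all $\omega\in\mathbb{F}_{2^{2n}}$. -}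

module Defs where

open import Level using (0ℓ)
open import Data.Nat as ℕ using (ℕ; zero; suc)
open import Data.Integer as ℤ using (ℤ)
open import Data.List using (List; length; foldr)
open import Data.List.Membership.Propositional using (_∈_)
open import Data.List.Relation.Unary.Unique.Propositional using (Unique)
open import Relation.Binary.PropositionalEquality using (_≡_; _≢_)
open import Relation.Binary.Definitions using (DecidableEquality)
open import Relation.Nullary using (yes; no)
open import Algebra.Structures using (IsCommutativeRing)

-- A finite field of characteristic 2 with exactly 2^m elements
-- (i.e. a model of F_{2^m}; unique up to isomorphism).
-- Characteristic 2 is encoded by taking negation to be the identity.
-- inv is the total inverse with the convention 1/0 = 0.
record GF2 (m : ℕ) : Set₁ where
  field
    F       : Set
    _≟_     : DecidableEquality F
    _+_ _*_ : F → F → F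
    0# 1#   : F
    inv     : F → F
    isCommutativeRing : IsCommutativeRing _≡_ _+_ _*_ (λ x → x) 0# 1#
    0≢1     : 0# ≢ 1#
    inv-0   : inv 0# ≡ 0#
    inv-r   : ∀ x → x ≢ 0# → x * inv x ≡ 1#
    elems          : List F
    elems-complete : ∀ x → x ∈ elems
    elems-unique   : Unique elems
    elems-size     : length elems ≡ 2 ℕ.^ m

module GFOps {m : ℕ} (K : GF2 m) where
  open GF2 K public

  pow : F → ℕ → F
  pow x zero    = 1#
  pow x (suc k) = x * pow x k

  -- TrGen k t y = y + y^(2^k) + ... + y^(2^((t-1)k))
  -- so Tr_k^m = TrGen k (m/k).
  TrGen : ℕ → ℕ → F → F
  TrGen k zero    y = 0#
  TrGen k (suc t) y = pow y (2 ℕ.^ (t ℕ.* k)) + TrGen k t y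

  Σ : (F → ℤ) → ℤ
  Σ g = foldr (λ x acc → g x ℤ.+ acc) (ℤ.+ 0) elems

  -- (-1)^v for v ∈ F_2 = {0,1} ⊆ F
  sign : F → ℤ
  sign v with v ≟ 0#
  ... | yes _ = ℤ.+ 1
  ... | no  _ = ℤ.-[1+ 0 ]

module Bent (n : ℕ) (K : GF2 (2 ℕ.* n)) where
  open GFOps K public

  q : ℕ
  q = 2 ℕ.^ n

  conj : F → F
  conj x = pow x q

  Tr₁²ⁿ : F → F
  Tr₁²ⁿ = TrGen 1 (2 ℕ.* n)

  Trₙ²ⁿ : F → F
  Trₙ²ⁿ = TrGen n 2

  Tr₁ⁿ : F → F
  Tr₁ⁿ = TrGen 1 n

  -- Walsh transform of a Boolean function f (values in {0,1} ⊆ F)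
  W : (F → F) → F → ℤ
  W f ω = Σ (λ x → sign (f x + Tr₁²ⁿ (ω * x)))

  IsBent : (F → F) → Set
  IsBent f = ∀ ω → W f ω ℤ.* W f ω ≡ ℤ.+ (2 ℕ.^ (2 ℕ.* n))

  fᵢ : F → F → F → F
  fᵢ a b x = Tr₁²ⁿ (a * inv (pow x (q ℕ.∸ 1) + b))

  h₂ : F → F → F → F → F
  h₂ a₁ a₂ b x = fᵢ a₁ b x * fᵢ a₂ b x

{-# OPTIONS --safe #-}

-- The function h₂ depends on x ≠ 0 only through u = x^(q-1) ∈ U, and each fibre of x ↦ x^(q-1), completed by 0, is a
-- line over 𝔽q.  Summing over these lines shows that h₂ is bent iff Σ_{u ∈ U} (-1)^{h₂} = (-1)^{h₂(0)}.  By the identity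
-- 2(-1)^{vw} = 1 + (-1)^v + (-1)^w - (-1)^{v+w} this sum reduces to the sums S(a) = Σ_{u ∈ U} χ(a / (u + b)) for
-- a = a₁, a₂, a₁ + a₂.
--
-- If b ∈ U, then b / (u + b) runs over {w : w + w̄ = 1}, an affine line over 𝔽q, so S(a) = 1 + qε with ε ∈ {0, 1, -1}
-- explicit, and the three conditions are read off.
--
-- If b ∉ U, then S(a) = ± σ(a / (b b̄ + 1)) with σ(c) = Σ_{v ∈ U} χ(cv), a Kloosterman sum, and bentness would force
-- |S(a₁)| + |S(a₂)| + |S(a₁ + a₂)| ≥ q - 1.  The Weil bound is not needed: σ(c) depends only on the norm of c, so
-- the second and fourth moments give (σ(c)² - q)² ≤ q³ - q² - q - 1, and the same bound holds for the sum of two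
-- such terms with different norms.  The first bound suffices for n ≥ 7.  For n = 6 the second one suffices unless a₁, a₂ and
-- a₁ + a₂ all have the same norm; then a₂ / a₁ would be a primitive cube root of unity in U, and 3 ∤ 65.
module Submission where

open import Defs
open import Algebra.Bundles using (RawRing)
open import Algebra.Structures using (IsCommutativeMonoid; IsCommutativeRing)
open import Algebra.Solver.Ring.AlmostCommutativeRing using (AlmostCommutativeRing; fromCommutativeRing; _-Raw-AlmostCommutative⟶_)
import Algebra.Solver.Ring as RingSolver
open import Data.Bool using (Bool; true; false; if_then_else_; _∧_; _xor_)
import Data.Bool.Properties as Bool
open import Data.Empty using (⊥-elim)
open import Data.Integer as ℤ using (ℤ; +_; -[1+_])
  renaming (_+_ to _+ᶻ_; _*_ to _*ᶻ_; _-_ to _-ᶻ_; -_ to -ᶻ_; _≤_ to _≤ᶻ_; _<_ to _<ᶻ_)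
import Data.Integer.Properties as ℤ
open import Data.Integer.Tactic.RingSolver using (solve-∀)
open import Data.List using (List; []; _∷_; length; foldr; map)
open import Data.List.Membership.Propositional using (_∈_; lose)
open import Data.List.Membership.Propositional.Properties using (∈-map⁺)
open import Data.List.Membership.Propositional.Properties.WithK using (unique∧set⇒bag)
open import Data.List.Relation.Binary.BagAndSetEquality using (∼bag⇒↭)
open import Data.List.Relation.Binary.Permutation.Propositional using (_↭_; prep; swap) renaming (refl to ↭-refl; trans to ↭-trans)
open import Data.List.Relation.Unary.All using (All; []; _∷_; lookup; tabulate)
open import Data.List.Relation.Unary.AllPairs using ([]; _∷_)
open import Data.List.Relation.Unary.Any using (here; there; any?; satisfied)
open import Data.List.Relation.Unary.Unique.Propositional using (Unique)
open import Data.List.Relation.Unary.Unique.Propositional.Properties using (map⁺)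
open import Data.Maybe as Maybe using (Maybe)
import Data.Nat as ℕ
open import Data.Nat using (ℕ; zero; suc; _≤_; z≤n; s≤s)
open import Data.Nat.Divisibility using (divides; ∣⇒≤)
import Data.Nat.Properties as ℕ
open import Data.Nat.Tactic.RingSolver using () renaming (solve-∀ to ℕ-solve-∀)
open import Data.Product using (∃; _×_; _,_; proj₁; proj₂)
open import Data.Sum using (_⊎_; inj₁; inj₂; [_,_]′)
open import Data.Unit using (tt)
open import Function using (_∘_; id)
open import Function.Bundles using (_⇔_; mk⇔)
open import Level using (0ℓ)
open import Relation.Binary.PropositionalEquality using (_≡_; _≢_; refl; sym; trans; cong; cong₂; subst; subst₂; module ≡-Reasoning)
open import Relation.Nullary using (¬_; Dec; yes; no; ¬?)
open import Relation.Nullary.Decidable using (dec⇒maybe; decidable-stable; toWitness; _→-dec_)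

-- Why moments suffice. The terms (σ(c)² - q)² with c ≠ 0 are nonnegative, add up to less than q⁴,
-- and each value is repeated on the q + 1 elements of a norm class. A single term is therefore
-- below q³, which bounds |σ(c)| by roughly q^(3/4). This is weaker than the exponent 1/2 of Weil,
-- but three such sums still stay below q - 1 from q = 128 on. At q = 64 one sum is only bounded by
-- 23, and 3 · 23 = 69 exceeds the permitted 62. There the norm classes are used again: two of them
-- share the same total, so two sums with different norms cannot both be extreme. The centre q is
-- close to the mean of σ(c)² over c ≠ 0. The fourth moment is accessible because s ≠ 0 is a sum of
-- two elements of U in at most two ordered ways, the summands being roots of one quadratic. A model
-- of the field records only its own size. The sizes of 𝔽q and U are themselves obtained by
-- evaluating character sums in two ways.

-- Folds over finite lists in a commutative monoid.

module Folding {C : Set} {_∙_ : C → C → C} {ε : C} (isCM : IsCommutativeMonoid _≡_ _∙_ ε) where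
  open IsCommutativeMonoid isCM using (assoc; comm; identityˡ; identityʳ)
  open ≡-Reasoning

  interchange : ∀ a b c d → (a ∙ b) ∙ (c ∙ d) ≡ (a ∙ c) ∙ (b ∙ d)
  interchange a b c d = begin
    (a ∙ b) ∙ (c ∙ d) ≡⟨ assoc a b (c ∙ d) ⟩
    a ∙ (b ∙ (c ∙ d)) ≡⟨ cong (a ∙_) (assoc b c d) ⟨
    a ∙ ((b ∙ c) ∙ d) ≡⟨ cong (λ z → a ∙ (z ∙ d)) (comm b c) ⟩
    a ∙ ((c ∙ b) ∙ d) ≡⟨ cong (a ∙_) (assoc c b d) ⟩
    a ∙ (c ∙ (b ∙ d)) ≡⟨ assoc a c (b ∙ d) ⟨
    (a ∙ c) ∙ (b ∙ d) ∎

  module _ {A : Set} where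
    -- Serves two monoids: integer addition, where it agrees definitionally with `Σ`, and field
    -- multiplication, where it drives the proof of `fermat`.
    fold : (A → C) → List A → C
    fold g = foldr (λ x acc → g x ∙ acc) ε

    fold-cong : ∀ {g h : A → C} → (∀ x → g x ≡ h x) → ∀ xs → fold g xs ≡ fold h xs
    fold-cong e []       = refl
    fold-cong e (x ∷ xs) = cong₂ _∙_ (e x) (fold-cong e xs)

    fold-∙ : ∀ (g h : A → C) xs → fold (λ x → g x ∙ h x) xs ≡ fold g xs ∙ fold h xs
    fold-∙ g h []       = sym (identityˡ ε)
    fold-∙ g h (x ∷ xs) = trans (cong ((g x ∙ h x) ∙_) (fold-∙ g h xs)) (interchange _ _ _ _)

    fold-ε : ∀ (xs : List A) → fold (λ _ → ε) xs ≡ ε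
    fold-ε []       = refl
    fold-ε (x ∷ xs) = trans (identityˡ _) (fold-ε xs)

    fold-map : ∀ (g : A → C) (f : A → A) xs → fold g (map f xs) ≡ fold (g ∘ f) xs
    fold-map g f []       = refl
    fold-map g f (x ∷ xs) = cong (g (f x) ∙_) (fold-map g f xs)

    fold-↭ : ∀ (g : A → C) {xs ys} → xs ↭ ys → fold g xs ≡ fold g ys
    fold-↭ g ↭-refl        = refl
    fold-↭ g (prep x p)    = cong (g x ∙_) (fold-↭ g p)
    fold-↭ g (swap x y p)  = begin
      g x ∙ (g y ∙ _) ≡⟨ assoc _ _ _ ⟨
      (g x ∙ g y) ∙ _ ≡⟨ cong₂ _∙_ (comm _ _) (fold-↭ g p) ⟩
      (g y ∙ g x) ∙ _ ≡⟨ assoc _ _ _ ⟩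
      g y ∙ (g x ∙ _) ∎
    fold-↭ g (↭-trans p₁ p₂) = trans (fold-↭ g p₁) (fold-↭ g p₂)

    fold-null : ∀ (g : A → C) {xs} → All (λ x → g x ≡ ε) xs → fold g xs ≡ ε
    fold-null g []       = refl
    fold-null g (e ∷ es) = trans (cong₂ _∙_ e (fold-null g es)) (identityˡ ε)

    fold-single : ∀ (g : A → C) {y xs} → Unique xs → y ∈ xs →
                  (∀ x → x ≢ y → g x ≡ ε) → fold g xs ≡ g y
    fold-single g (px ∷ _) (here refl) off =
      trans (cong (_ ∙_) (fold-null g (tabulate λ m → off _ λ e → lookup px m (sym e)))) (identityʳ _)
    fold-single g (px ∷ u) (there m) off =
      trans (cong₂ _∙_ (off _ (lookup px m)) (fold-single g u m off)) (identityˡ _)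

  fold-swap : ∀ {A B : Set} (g : A → B → C) xs ys →
              fold (λ x → fold (g x) ys) xs ≡ fold (λ y → fold (λ x → g x y) xs) ys
  fold-swap g []       ys = sym (fold-ε ys)
  fold-swap g (x ∷ xs) ys = trans (cong (_ ∙_) (fold-swap g xs ys)) (sym (fold-∙ _ _ ys))

-- Both lists are free of duplicates and contain every element of `A`; between duplicate-free lists,
-- equal membership already yields a permutation.
bijection-↭ : ∀ {A : Set} {xs : List A} → Unique xs → (∀ x → x ∈ xs) →
              (f g : A → A) → (∀ x → f (g x) ≡ x) → (∀ x → g (f x) ≡ x) → map f xs ↭ xs
bijection-↭ u all f g fg gf = ∼bag⇒↭ (unique∧set⇒bag
  (map⁺ (λ {x} {y} e → trans (sym (gf x)) (trans (cong g e) (gf y))) u) u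
  (λ {x} → mk⇔ (λ _ → all x) (λ _ → subst (_∈ _) (fg x) (∈-map⁺ f (all (g x))))))

-- Arithmetic, polynomials and traces in a finite field of characteristic 2.

module Field {m : ℕ} (K : GF2 m) where
  open GFOps K renaming (_+_ to infixl 6 _+_; _*_ to infixl 7 _*_; _≟_ to infix 4 _≟_) public
  open IsCommutativeRing isCommutativeRing public
    using (+-assoc; +-comm; *-assoc; *-comm; *-identityˡ; *-identityʳ; +-identityˡ; +-identityʳ;
           zeroˡ; zeroʳ; distribˡ; distribʳ; *-isCommutativeMonoid)
    renaming (-‿inverseʳ to x+x≡0)
  open ≡-Reasoning

  F-ring : AlmostCommutativeRing 0ℓ 0ℓ
  F-ring = fromCommutativeRing (record { isCommutativeRing = isCommutativeRing })

  𝔽₂ : RawRing 0ℓ 0ℓ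
  𝔽₂ = record { Carrier = Bool ; _≈_ = _≡_ ; _+_ = _xor_ ; _*_ = _∧_ ; -_ = λ x → x ; 0# = false ; 1# = true }

  𝔽₂→F : 𝔽₂ -Raw-AlmostCommutative⟶ F-ring
  𝔽₂→F = record
    { ⟦_⟧    = λ b → if b then 1# else 0#
    ; +-homo = λ { false y → sym (+-identityˡ _) ; true false → sym (+-identityʳ _) ; true true → sym (x+x≡0 1#) }
    ; *-homo = λ { false y → sym (zeroˡ _) ; true y → sym (*-identityˡ _) }
    ; -‿homo = λ _ → refl
    ; 0-homo = refl
    ; 1-homo = refl
    }

  _𝔽₂≟_ : ∀ x y → Maybe ((if x then 1# else 0#) ≡ (if y then 1# else 0#))
  x 𝔽₂≟ y = Maybe.map (cong (if_then 1# else 0#)) (dec⇒maybe (x Bool.≟ y))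

  -- Coefficients in 𝔽₂, so that x + x normalises to 0.
  open RingSolver 𝔽₂ F-ring 𝔽₂→F _𝔽₂≟_ public
    using (solve; _:+_; _:*_; _:=_; con)


  module _ {C : Set} {_∙_ : C → C → C} {ε : C} (isCM : IsCommutativeMonoid _≡_ _∙_ ε) where
    open Folding isCM

    fold-reindex : (g : F → C) (f f⁻¹ : F → F) → (∀ x → f (f⁻¹ x) ≡ x) → (∀ x → f⁻¹ (f x) ≡ x) →
                   fold g elems ≡ fold (g ∘ f) elems
    fold-reindex g f f⁻¹ ff⁻¹ f⁻¹f =
      trans (sym (fold-↭ g (bijection-↭ elems-unique elems-complete f f⁻¹ ff⁻¹ f⁻¹f))) (fold-map g f elems)

  inv-l : ∀ {x} → x ≢ 0# → inv x * x ≡ 1#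
  inv-l {x} x≢0 = trans (*-comm _ _) (inv-r x x≢0)

  *-cancelˡ-0 : ∀ {x y} → x ≢ 0# → x * y ≡ 0# → y ≡ 0#
  *-cancelˡ-0 {x} {y} x≢0 e = begin
    y               ≡⟨ *-identityˡ y ⟨
    1# * y          ≡⟨ cong (_* y) (inv-l x≢0) ⟨
    inv x * x * y   ≡⟨ *-assoc _ _ _ ⟩
    inv x * (x * y) ≡⟨ cong (inv x *_) e ⟩
    inv x * 0#      ≡⟨ zeroʳ _ ⟩
    0#              ∎

  +≡0⇒≡ : ∀ {x y} → x + y ≡ 0# → x ≡ y
  +≡0⇒≡ {x} {y} e = begin
    x           ≡⟨ solve 2 (λ x y → x := x :+ y :+ y) refl x y ⟩
    x + y + y   ≡⟨ cong (_+ y) e ⟩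
    0# + y      ≡⟨ +-identityˡ y ⟩
    y           ∎

  ≡⇒+≡0 : ∀ {x y} → x ≡ y → x + y ≡ 0#
  ≡⇒+≡0 {x} refl = x+x≡0 x

  *-cancelˡ : ∀ {x y z} → x ≢ 0# → x * y ≡ x * z → y ≡ z
  *-cancelˡ {x} {y} {z} x≢0 e = +≡0⇒≡ (*-cancelˡ-0 x≢0 (trans (distribˡ x y z) (≡⇒+≡0 e)))

  *-≢0 : ∀ {x y} → x ≢ 0# → y ≢ 0# → x * y ≢ 0#
  *-≢0 x≢0 y≢0 e = y≢0 (*-cancelˡ-0 x≢0 e)

  *≡1⇒≢0 : ∀ {x y} → x * y ≡ 1# → x ≢ 0#
  *≡1⇒≢0 {y = y} e refl = 0≢1 (trans (sym (zeroˡ y)) e)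

  inv-unique : ∀ {x y} → x * y ≡ 1# → y ≡ inv x
  inv-unique {x} e = *-cancelˡ (*≡1⇒≢0 e) (trans e (sym (inv-r x (*≡1⇒≢0 e))))

  inv-≢0 : ∀ {x} → x ≢ 0# → inv x ≢ 0#
  inv-≢0 x≢0 = *≡1⇒≢0 (inv-l x≢0)

  inv-involutive : ∀ x → inv (inv x) ≡ x
  inv-involutive x with x ≟ 0#
  ... | yes refl = trans (cong inv inv-0) inv-0
  ... | no x≢0   = sym (inv-unique (inv-l x≢0))

  pow-1# : ∀ k → pow 1# k ≡ 1#
  pow-1# zero    = refl
  pow-1# (suc k) = trans (*-identityˡ _) (pow-1# k)

  pow-0# : ∀ {k} → 1 ≤ k → pow 0# k ≡ 0#
  pow-0# (s≤s _) = zeroˡ _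

  pow-+ : ∀ x j k → pow x (j ℕ.+ k) ≡ pow x j * pow x k
  pow-+ x zero    k = sym (*-identityˡ _)
  pow-+ x (suc j) k = trans (cong (x *_) (pow-+ x j k)) (sym (*-assoc _ _ _))

  pow-*-distrib : ∀ x y k → pow (x * y) k ≡ pow x k * pow y k
  pow-*-distrib x y zero    = sym (*-identityˡ 1#)
  pow-*-distrib x y (suc k) = trans (cong (x * y *_) (pow-*-distrib x y k))
    (solve 4 (λ x y a b → x :* y :* (a :* b) := x :* a :* (y :* b)) refl x y (pow x k) (pow y k))

  pow-* : ∀ x j k → pow x (j ℕ.* k) ≡ pow (pow x j) k
  pow-* x zero    k = sym (pow-1# k)
  pow-* x (suc j) k = begin
    pow x (k ℕ.+ j ℕ.* k)       ≡⟨ pow-+ x k (j ℕ.* k) ⟩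
    pow x k * pow x (j ℕ.* k)   ≡⟨ cong (pow x k *_) (pow-* x j k) ⟩
    pow x k * pow (pow x j) k   ≡⟨ pow-*-distrib x (pow x j) k ⟨
    pow (x * pow x j) k         ∎

  pow-2^suc : ∀ x k → pow x (2 ℕ.^ suc k) ≡ pow (x * x) (2 ℕ.^ k)
  pow-2^suc x k = trans (pow-* x 2 (2 ℕ.^ k)) (cong (λ z → pow (x * z) (2 ℕ.^ k)) (*-identityʳ x))

  pow-2^+ : ∀ x j k → pow x (2 ℕ.^ (j ℕ.+ k)) ≡ pow (pow x (2 ℕ.^ k)) (2 ℕ.^ j)
  pow-2^+ x j k = trans (cong (pow x) (trans (ℕ.^-distribˡ-+-* 2 j k) (ℕ.*-comm (2 ℕ.^ j) _))) (pow-* x (2 ℕ.^ k) (2 ℕ.^ j))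

  frobenius : ∀ x y k → pow (x + y) (2 ℕ.^ k) ≡ pow x (2 ℕ.^ k) + pow y (2 ℕ.^ k)
  frobenius x y zero    = solve 2 (λ x y → (x :+ y) :* con true := x :* con true :+ y :* con true) refl x y
  frobenius x y (suc k) = begin
    pow (x + y) (2 ℕ.^ suc k)                     ≡⟨ pow-2^suc (x + y) k ⟩
    pow ((x + y) * (x + y)) (2 ℕ.^ k)             ≡⟨ cong (λ z → pow z (2 ℕ.^ k)) (solve 2 (λ x y → (x :+ y) :* (x :+ y) := x :* x :+ y :* y) refl x y) ⟩
    pow (x * x + y * y) (2 ℕ.^ k)                 ≡⟨ frobenius (x * x) (y * y) k ⟩
    pow (x * x) (2 ℕ.^ k) + pow (y * y) (2 ℕ.^ k) ≡⟨ cong₂ _+_ (pow-2^suc x k) (pow-2^suc y k) ⟨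
    pow x (2 ℕ.^ suc k) + pow y (2 ℕ.^ suc k)     ∎

  x*x≡0⇒x≡0 : ∀ {x} → x * x ≡ 0# → x ≡ 0#
  x*x≡0⇒x≡0 {x} e with x ≟ 0#
  ... | yes p = p
  ... | no ¬p = *-cancelˡ-0 ¬p e

  idempotent⇒0⊎1 : ∀ {x} → x * x ≡ x → x ≡ 0# ⊎ x ≡ 1#
  idempotent⇒0⊎1 {x} e with x ≟ 0#
  ... | yes p = inj₁ p
  ... | no ¬p = inj₂ (*-cancelˡ ¬p (trans e (sym (*-identityʳ x))))

  module _ where
    open Folding *-isCommutativeMonoid

    fold-const : ∀ (a : F) (xs : List F) → fold (λ _ → a) xs ≡ pow a (length xs)
    fold-const a []       = refl
    fold-const a (x ∷ xs) = cong (a *_) (fold-const a xs)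

    fold-≢0 : ∀ {g : F → F} → (∀ x → g x ≢ 0#) → ∀ xs → fold g xs ≢ 0#
    fold-≢0 g≢0 []       e = 0≢1 (sym e)
    fold-≢0 g≢0 (x ∷ xs) = *-≢0 (g≢0 x) (fold-≢0 g≢0 xs)

    if-0 : F → F → F → F
    if-0 x u v with x ≟ 0#
    ... | yes _ = u
    ... | no _  = v

    -- Multiplication by a ≢ 0 permutes the nonzero elements, so their product absorbs a^(2^m ∸ 1).
    fermat : ∀ a → pow a (2 ℕ.^ m) ≡ a
    fermat a with a ≟ 0#
    ... | yes refl = pow-0# (ℕ.m^n>0 2 m)
    ... | no a≢0   = begin
      pow a (2 ℕ.^ m)                                       ≡⟨ cong (pow a) elems-size ⟨
      pow a (length elems)                                  ≡⟨ fold-const a elems ⟨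
      -- The 2^m factors are divided into those indexed by x ≠ 0, whose product is 1, and the one
      -- indexed by x = 0, which is the `a` that remains.
      fold (λ _ → a) elems                                  ≡⟨ fold-cong split elems ⟩
      fold (λ x → if-0 x 1# a * if-0 x a 1#) elems          ≡⟨ fold-∙ _ _ elems ⟩
      fold (λ x → if-0 x 1# a) elems * fold (λ x → if-0 x a 1#) elems ≡⟨ cong₂ _*_ ones single ⟩
      1# * a                                                ≡⟨ *-identityˡ a ⟩
      a                                                     ∎
      where
      split : ∀ x → a ≡ if-0 x 1# a * if-0 x a 1#
      split x with x ≟ 0#
      ... | yes _ = sym (*-identityˡ a)
      ... | no _  = sym (*-identityʳ a)

      single : fold (λ x → if-0 x a 1#) elems ≡ a
      single = trans (fold-single _ elems-unique (elems-complete 0#) off) at-0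
        where
        off : ∀ x → x ≢ 0# → if-0 x a 1# ≡ 1#
        off x x≢0 with x ≟ 0#
        ... | yes p = ⊥-elim (x≢0 p)
        ... | no _  = refl
        at-0 : if-0 0# a 1# ≡ a
        at-0 with 0# ≟ 0#
        ... | yes _ = refl
        ... | no ¬p = ⊥-elim (¬p refl)

      nonzero : ∀ x → if-0 x 1# x ≢ 0#
      nonzero x with x ≟ 0#
      ... | yes _ = λ e → 0≢1 (sym e)
      ... | no ¬p = ¬p

      scale : ∀ x → if-0 (a * x) 1# (a * x) ≡ if-0 x 1# x * if-0 x 1# a
      scale x with x ≟ 0# | a * x ≟ 0#
      ... | yes _    | yes _ = sym (*-identityˡ 1#)
      ... | yes refl | no ¬q = ⊥-elim (¬q (zeroʳ a))
      ... | no ¬p    | yes q = ⊥-elim (*-≢0 a≢0 ¬p q)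
      ... | no _     | no _  = *-comm a x

      ones : fold (λ x → if-0 x 1# a) elems ≡ 1#
      ones = *-cancelˡ (fold-≢0 nonzero elems) (begin
        fold (λ x → if-0 x 1# x) elems * fold (λ x → if-0 x 1# a) elems ≡⟨ fold-∙ _ _ elems ⟨
        fold (λ x → if-0 x 1# x * if-0 x 1# a) elems       ≡⟨ fold-cong scale elems ⟨
        fold (λ x → if-0 (a * x) 1# (a * x)) elems         ≡⟨ fold-reindex *-isCommutativeMonoid (λ x → if-0 x 1# x) (a *_) (inv a *_)
                                                               (λ x → trans (sym (*-assoc _ _ _)) (trans (cong (_* x) (inv-r a a≢0)) (*-identityˡ x)))
                                                               (λ x → trans (sym (*-assoc _ _ _)) (trans (cong (_* x) (inv-l a≢0)) (*-identityˡ x))) ⟨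
        fold (λ x → if-0 x 1# x) elems                      ≡⟨ *-identityʳ _ ⟨
        fold (λ x → if-0 x 1# x) elems * 1#                 ∎)

  -- monic cs is the polynomial with coefficient list cs (constant term first) followed by the leading coefficient 1.
  monic : List F → F → F
  monic []       x = 1#
  monic (c ∷ cs) x = c + x * monic cs x

  quotient : F → List F → List F
  quotient r []       = []
  quotient r (c ∷ cs) = monic (c ∷ cs) r ∷ quotient r cs

  length-quotient : ∀ r cs → length (quotient r cs) ≡ length cs
  length-quotient r []       = refl
  length-quotient r (c ∷ cs) = cong suc (length-quotient r cs)

  division : ∀ r c cs x → monic (c ∷ cs) x ≡ monic (c ∷ cs) r + (x + r) * monic (quotient r cs) x
  division r c [] x =
    solve 3 (λ r c x → c :+ x :* con true := c :+ r :* con true :+ (x :+ r) :* con true) refl r c x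
  division r c (c′ ∷ cs) x = trans (cong (λ z → c + x * z) (division r c′ cs x))
    (solve 5 (λ r c x e f → c :+ x :* (e :+ (x :+ r) :* f) := c :+ r :* e :+ (x :+ r) :* (e :+ x :* f))
      refl r c x (monic (c′ ∷ cs) r) (monic (quotient r cs) x))

  roots≤degree : ∀ cs rs → Unique rs → All (λ r → monic cs r ≡ 0#) rs → length rs ≤ length cs
  roots≤degree cs       []       _        _        = z≤n
  roots≤degree []       (r ∷ rs) _        (e ∷ _)  = ⊥-elim (0≢1 (sym e))
  roots≤degree (c ∷ cs) (r ∷ rs) (r∉ ∷ u) (e ∷ es) =
    s≤s (subst (length rs ≤_) (length-quotient r cs) (roots≤degree (quotient r cs) rs u (tabulate root)))
    where
    root : ∀ {x} → x ∈ rs → monic (quotient r cs) x ≡ 0#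
    root {x} x∈ = *-cancelˡ-0 (λ x+r≡0 → lookup r∉ x∈ (sym (+≡0⇒≡ x+r≡0))) (begin
      (x + r) * monic (quotient r cs) x                       ≡⟨ +-identityˡ _ ⟨
      0# + (x + r) * monic (quotient r cs) x                  ≡⟨ cong (_+ (x + r) * monic (quotient r cs) x) e ⟨
      monic (c ∷ cs) r + (x + r) * monic (quotient r cs) x    ≡⟨ division r c cs x ⟨
      monic (c ∷ cs) x                                        ≡⟨ lookup es x∈ ⟩
      0#                                                      ∎)

  IsMonic : ℕ → (F → F) → Set
  IsMonic d f = ∃ λ cs → length cs ≡ d × (∀ x → monic cs x ≡ f x)

  pow-isMonic : ∀ d → IsMonic d (λ x → pow x d)
  pow-isMonic zero    = [] , refl , λ _ → refl
  pow-isMonic (suc d) with pow-isMonic d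
  ... | cs , len , ev = 0# ∷ cs , cong suc len , λ x → trans (+-identityˡ _) (cong (x *_) (ev x))

  +pow-isMonic : ∀ {d f} j → suc j ≤ d → IsMonic d f → IsMonic d (λ x → f x + pow x j)
  +pow-isMonic j j<d (cs , refl , ev) =
    let cs′ , len , ev′ = go cs j j<d in cs′ , len , λ x → trans (ev′ x) (cong (_+ pow x j) (ev x))
    where
    go : ∀ cs j → suc j ≤ length cs → IsMonic (length cs) (λ x → monic cs x + pow x j)
    go (c ∷ cs) zero    _       = (c + 1#) ∷ cs , refl , λ x →
      solve 2 (λ c y → c :+ con true :+ y := c :+ y :+ con true) refl c (x * monic cs x)
    go (c ∷ cs) (suc j) (s≤s l) with go cs j l
    ... | cs′ , len , ev = c ∷ cs′ , cong suc len , λ x → trans (cong (λ z → c + x * z) (ev x))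
      (solve 4 (λ c x y z → c :+ x :* (y :+ z) := c :+ x :* y :+ x :* z) refl c x (monic cs x) (pow x j))

  -- Absolute traces.

  TrGen-suc : ∀ t x → TrGen 1 (suc t) x ≡ pow x (2 ℕ.^ t) + TrGen 1 t x
  TrGen-suc t x = cong (λ k → pow x (2 ℕ.^ k) + TrGen 1 t x) (ℕ.*-identityʳ t)

  -- Bounds the number of zeros of the trace by half the size of the field, which is what
  -- `Tr-surjective` exploits.
  TrGen-isMonic : ∀ t → IsMonic (2 ℕ.^ t) (TrGen 1 (suc t))
  TrGen-isMonic t =
    let cs , len , ev = go t ℕ.≤-refl in cs , len , λ x → trans (ev x) (sym (TrGen-suc t x))
    where
    -- The leading power 2^t is kept in front while the lower powers 2^s are added one at a time,
    -- each of them below the degree.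
    go : ∀ s → s ≤ t → IsMonic (2 ℕ.^ t) (λ x → pow x (2 ℕ.^ t) + TrGen 1 s x)
    go zero    _   = let cs , len , ev = pow-isMonic (2 ℕ.^ t) in cs , len , λ x → trans (ev x) (sym (+-identityʳ _))
    go (suc s) s<t =
      let cs , len , ev = +pow-isMonic (2 ℕ.^ s) (ℕ.^-monoʳ-< 2 (s≤s (s≤s z≤n)) s<t) (go s (ℕ.<⇒≤ s<t))
      in cs , len , λ x → trans (ev x)
        (trans (solve 3 (λ p t s → p :+ t :+ s := p :+ (s :+ t)) refl (pow x (2 ℕ.^ t)) (TrGen 1 s x) (pow x (2 ℕ.^ s)))
               (cong (λ z → pow x (2 ℕ.^ t) + z) (sym (TrGen-suc s x))))

  TrGen-+ : ∀ t x y → TrGen 1 t (x + y) ≡ TrGen 1 t x + TrGen 1 t y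
  TrGen-+ zero    x y = sym (+-identityˡ 0#)
  TrGen-+ (suc t) x y = trans (cong₂ _+_ (frobenius x y (t ℕ.* 1)) (TrGen-+ t x y))
    (solve 4 (λ a b c d → a :+ b :+ (c :+ d) := a :+ c :+ (b :+ d)) refl
      (pow x (2 ℕ.^ (t ℕ.* 1))) (pow y (2 ℕ.^ (t ℕ.* 1))) (TrGen 1 t x) (TrGen 1 t y))

  TrGen-0# : ∀ t → TrGen 1 t 0# ≡ 0#
  TrGen-0# zero    = refl
  TrGen-0# (suc t) = trans (cong₂ _+_ (pow-0# (ℕ.m^n>0 2 (t ℕ.* 1))) (TrGen-0# t)) (+-identityˡ 0#)

  TrGen-split : ∀ s t x → TrGen 1 (s ℕ.+ t) x ≡ TrGen 1 s (pow x (2 ℕ.^ t)) + TrGen 1 t x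
  TrGen-split zero    t x = sym (+-identityˡ _)
  TrGen-split (suc s) t x = begin
    TrGen 1 (suc s ℕ.+ t) x                              ≡⟨ TrGen-suc (s ℕ.+ t) x ⟩
    pow x (2 ℕ.^ (s ℕ.+ t)) + TrGen 1 (s ℕ.+ t) x        ≡⟨ cong₂ _+_ (pow-2^+ x s t) (TrGen-split s t x) ⟩
    pow y (2 ℕ.^ s) + (TrGen 1 s y + TrGen 1 t x)        ≡⟨ +-assoc _ _ _ ⟨
    pow y (2 ℕ.^ s) + TrGen 1 s y + TrGen 1 t x          ≡⟨ cong (_+ TrGen 1 t x) (TrGen-suc s y) ⟨
    TrGen 1 (suc s) y + TrGen 1 t x                      ∎
    where y = pow x (2 ℕ.^ t)

  -- Squaring sends each summand to the next one, so the two traces differ only in the end terms x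
  -- and x^(2^t).
  TrGen-telescope : ∀ t x → TrGen 1 t (x * x) + x ≡ TrGen 1 t x + pow x (2 ℕ.^ t)
  TrGen-telescope zero    x = cong (λ z → 0# + z) (sym (*-identityʳ x))
  TrGen-telescope (suc t) x = begin
    TrGen 1 (suc t) (x * x) + x                               ≡⟨ cong (_+ x) (TrGen-suc t (x * x)) ⟩
    pow (x * x) (2 ℕ.^ t) + TrGen 1 t (x * x) + x             ≡⟨ +-assoc _ _ _ ⟩
    pow (x * x) (2 ℕ.^ t) + (TrGen 1 t (x * x) + x)           ≡⟨ cong₂ _+_ (sym (pow-2^suc x t)) (TrGen-telescope t x) ⟩
    pow x (2 ℕ.^ suc t) + (TrGen 1 t x + pow x (2 ℕ.^ t))     ≡⟨ solve 3 (λ a b c → a :+ (b :+ c) := c :+ b :+ a) refl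
                                                                   (pow x (2 ℕ.^ suc t)) (TrGen 1 t x) (pow x (2 ℕ.^ t)) ⟩
    pow x (2 ℕ.^ t) + TrGen 1 t x + pow x (2 ℕ.^ suc t)       ≡⟨ cong (_+ pow x (2 ℕ.^ suc t)) (TrGen-suc t x) ⟨
    TrGen 1 (suc t) x + pow x (2 ℕ.^ suc t)                   ∎

  TrGen-square : ∀ t x → TrGen 1 t (x * x) ≡ TrGen 1 t x * TrGen 1 t x
  TrGen-square zero    x = sym (zeroˡ 0#)
  TrGen-square (suc t) x = trans (cong₂ _+_ (pow-*-distrib x x (2 ℕ.^ (t ℕ.* 1))) (TrGen-square t x))
    (solve 2 (λ a b → a :* a :+ b :* b := (a :+ b) :* (a :+ b)) refl (pow x (2 ℕ.^ (t ℕ.* 1))) (TrGen 1 t x))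

  TrGen-Frobenius-invariant : ∀ t {x} → pow x (2 ℕ.^ t) ≡ x → TrGen 1 t (x * x) ≡ TrGen 1 t x
  TrGen-Frobenius-invariant t {x} fix = +≡0⇒≡ (begin
    TrGen 1 t (x * x) + TrGen 1 t x           ≡⟨ solve 3 (λ a b x → a :+ b := a :+ x :+ b :+ x) refl (TrGen 1 t (x * x)) (TrGen 1 t x) x ⟩
    TrGen 1 t (x * x) + x + TrGen 1 t x + x   ≡⟨ cong (λ z → z + TrGen 1 t x + x) (trans (TrGen-telescope t x) (cong (λ z → TrGen 1 t x + z) fix)) ⟩
    TrGen 1 t x + x + TrGen 1 t x + x         ≡⟨ solve 2 (λ b x → b :+ x :+ b :+ x := con false) refl (TrGen 1 t x) x ⟩
    0#                                        ∎)

  TrGen-0⊎1 : ∀ t {x} → pow x (2 ℕ.^ t) ≡ x → TrGen 1 t x ≡ 0# ⊎ TrGen 1 t x ≡ 1#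
  TrGen-0⊎1 t {x} fix = idempotent⇒0⊎1 (trans (sym (TrGen-square t x)) (TrGen-Frobenius-invariant t fix))

  search : (f : F → F) → (∃ λ x → f x ≢ 0#) ⊎ (∀ x → f x ≡ 0#)
  search f with any? (λ x → ¬? (f x ≟ 0#)) elems
  ... | yes p = inj₁ (satisfied p)
  ... | no ¬p = inj₂ λ x → decidable-stable (f x ≟ 0#) λ fx≢0 → ¬p (lose (elems-complete x) fx≢0)

  -- The absolute trace has degree 2^(m ∸ 1), so it cannot vanish on all 2^m elements.
  Tr-surjective : 1 ≤ m → ∃ λ x → TrGen 1 m x ≡ 1#
  Tr-surjective 1≤m with search (TrGen 1 m)
  ... | inj₂ vanish = ⊥-elim (ℕ.<-irrefl refl (ℕ.<-≤-trans (ℕ.^-monoʳ-< 2 (s≤s (s≤s z≤n)) (ℕ.n<1+n m′)) bound))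
    where
    m′ = ℕ.pred m
    m≡ : suc m′ ≡ m
    m≡ = ℕ.suc-pred m {{ℕ.>-nonZero 1≤m}}
    bound : 2 ℕ.^ suc m′ ≤ 2 ℕ.^ m′
    bound with TrGen-isMonic m′
    ... | cs , len , ev = subst₂ _≤_ (trans elems-size (cong (2 ℕ.^_) (sym m≡))) len
      (roots≤degree cs elems elems-unique
        (tabulate λ {x} _ → trans (ev x) (trans (cong (λ k → TrGen 1 k x) m≡) (vanish x))))
  ... | inj₁ (x , Tx≢0) with TrGen-0⊎1 m (fermat x)
  ...   | inj₁ p = ⊥-elim (Tx≢0 p)
  ...   | inj₂ p = x , p

-- Indicator brackets and two facts on integers.

variable
  P Q : Set

⟦_⟧ : Dec P → ℤ
⟦ yes _ ⟧ = + 1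
⟦ no _ ⟧  = + 0

⟦⟧-yes : (d : Dec P) → P → ⟦ d ⟧ ≡ + 1
⟦⟧-yes (yes _) _ = refl
⟦⟧-yes (no ¬p) p = ⊥-elim (¬p p)

⟦⟧-no : (d : Dec P) → ¬ P → ⟦ d ⟧ ≡ + 0
⟦⟧-no (yes p) ¬p = ⊥-elim (¬p p)
⟦⟧-no (no _)  _  = refl

⟦⟧-cong : (d : Dec P) (e : Dec Q) → (P → Q) → (Q → P) → ⟦ d ⟧ ≡ ⟦ e ⟧
⟦⟧-cong (yes p) e f g = sym (⟦⟧-yes e (f p))
⟦⟧-cong (no ¬p) e f g = sym (⟦⟧-no e (¬p ∘ g))

⟦⟧-guard : (d : Dec P) {x y : ℤ} → (P → x ≡ y) → ⟦ d ⟧ *ᶻ x ≡ ⟦ d ⟧ *ᶻ y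
⟦⟧-guard (yes p) e = cong (+ 1 *ᶻ_) (e p)
⟦⟧-guard (no _)  e = refl

⟦⟧-idem : (d : Dec P) → ⟦ d ⟧ *ᶻ ⟦ d ⟧ ≡ ⟦ d ⟧
⟦⟧-idem (yes _) = refl
⟦⟧-idem (no _)  = refl

⟦⟧-≥0 : (d : Dec P) → + 0 ≤ᶻ ⟦ d ⟧
⟦⟧-≥0 (yes _) = ℤ.+≤+ z≤n
⟦⟧-≥0 (no _)  = ℤ.+≤+ z≤n

x≡-x⇒x≡0 : ∀ {x} → x ≡ -ᶻ x → x ≡ + 0
x≡-x⇒x≡0 {+ zero}    _  = refl
x≡-x⇒x≡0 {+ suc _}   ()
x≡-x⇒x≡0 { -[1+ _ ]} ()

x*x≡y*y⇒x≡y : ∀ {x y} → + 0 ≤ᶻ x → + 0 <ᶻ y → x *ᶻ x ≡ y *ᶻ y → x ≡ y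
x*x≡y*y⇒x≡y {x} {y} 0≤x 0<y e = ℤ.i-j≡0⇒i≡j x y ([ id , (λ s → ⊥-elim (ℤ.<-irrefl (sym s) (ℤ.+-mono-≤-< 0≤x 0<y))) ]′
  (ℤ.i*j≡0⇒i≡0∨j≡0 (x -ᶻ y) (trans (ring x y) (ℤ.i≡j⇒i-j≡0 e))))
  where
  ring : ∀ x y → (x -ᶻ y) *ᶻ (x +ᶻ y) ≡ x *ᶻ x -ᶻ y *ᶻ y
  ring = solve-∀

-- Integer sums over the field, and signs.

module Sums {m : ℕ} (K : GF2 m) where
  open Field K public
  open Folding ℤ.+-0-isCommutativeMonoid public
  open ≡-Reasoning

  opaque
    -- Opaque, so that outside this block a sum is handled only through the laws proved here; `Σ≡∑`
    -- is the one link back to the `Σ` of the Walsh transform.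
    ∑ : (F → ℤ) → ℤ
    ∑ = Σ

    Σ≡∑ : ∀ g → Σ g ≡ ∑ g
    Σ≡∑ g = refl

    ∑-cong : ∀ {g h : F → ℤ} → (∀ x → g x ≡ h x) → ∑ g ≡ ∑ h
    ∑-cong e = fold-cong e elems

    ∑-+ : ∀ (g h : F → ℤ) → ∑ (λ x → g x +ᶻ h x) ≡ ∑ g +ᶻ ∑ h
    ∑-+ g h = fold-∙ g h elems

    ∑-* : ∀ c (g : F → ℤ) → ∑ (λ x → c *ᶻ g x) ≡ c *ᶻ ∑ g
    ∑-* c g = go elems
      where
      go : ∀ xs → fold (λ x → c *ᶻ g x) xs ≡ c *ᶻ fold g xs
      go []       = sym (ℤ.*-zeroʳ c)
      go (x ∷ xs) = trans (cong (c *ᶻ g x +ᶻ_) (go xs)) (sym (ℤ.*-distribˡ-+ c (g x) (fold g xs)))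

    ∑-swap : ∀ (g : F → F → ℤ) → ∑ (λ x → ∑ (g x)) ≡ ∑ (λ y → ∑ (λ x → g x y))
    ∑-swap g = fold-swap g elems elems

    ∑-reindex : ∀ (g : F → ℤ) (f f⁻¹ : F → F) → (∀ x → f (f⁻¹ x) ≡ x) → (∀ x → f⁻¹ (f x) ≡ x) → ∑ g ≡ ∑ (g ∘ f)
    ∑-reindex = fold-reindex ℤ.+-0-isCommutativeMonoid

    ∑-single : ∀ (g : F → ℤ) y → (∀ x → x ≢ y → g x ≡ + 0) → ∑ g ≡ g y
    ∑-single g y = fold-single g elems-unique (elems-complete y)

    ∑-1 : ∑ (λ _ → + 1) ≡ + (2 ℕ.^ m)
    ∑-1 = trans (go elems) (cong +_ elems-size)
      where
      go : ∀ (xs : List F) → fold (λ _ → + 1) xs ≡ + length xs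
      go []       = refl
      go (x ∷ xs) = cong (+ 1 +ᶻ_) (go xs)

    ∑-0 : ∑ (λ _ → + 0) ≡ + 0
    ∑-0 = fold-ε elems

    ∑-mono : ∀ {g h : F → ℤ} → (∀ x → g x ≤ᶻ h x) → ∑ g ≤ᶻ ∑ h
    ∑-mono {g} {h} le = go elems
      where
      go : ∀ xs → fold g xs ≤ᶻ fold h xs
      go []       = ℤ.≤-refl
      go (x ∷ xs) = ℤ.+-mono-≤ (le x) (go xs)

  ∑-*ʳ : ∀ c (g : F → ℤ) → ∑ (λ x → g x *ᶻ c) ≡ ∑ g *ᶻ c
  ∑-*ʳ c g = trans (∑-cong λ x → ℤ.*-comm (g x) c) (trans (∑-* c g) (ℤ.*-comm c _))

  ∑-neg : ∀ (g : F → ℤ) → ∑ (λ x → -ᶻ g x) ≡ -ᶻ ∑ g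
  ∑-neg g = trans (∑-cong λ x → sym (ℤ.-1*i≡-i (g x))) (trans (∑-* -[1+ 0 ] g) (ℤ.-1*i≡-i _))

  ∑-- : ∀ (g h : F → ℤ) → ∑ (λ x → g x -ᶻ h x) ≡ ∑ g -ᶻ ∑ h
  ∑-- g h = trans (∑-+ g (-ᶻ_ ∘ h)) (cong (∑ g +ᶻ_) (∑-neg h))

  ∑-translate : ∀ (g : F → ℤ) a → ∑ g ≡ ∑ (λ x → g (x + a))
  ∑-translate g a = ∑-reindex g (_+ a) (_+ a) cancel cancel
    where
    cancel : ∀ x → x + a + a ≡ x
    cancel x = solve 2 (λ x a → x :+ a :+ a := x) refl x a

  *-inverseˡ : ∀ {a} → a ≢ 0# → ∀ x → a * (inv a * x) ≡ x
  *-inverseˡ a≢0 x = trans (sym (*-assoc _ _ _)) (trans (cong (_* x) (inv-r _ a≢0)) (*-identityˡ x))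

  *-inverseʳ : ∀ {a} → a ≢ 0# → ∀ x → inv a * (a * x) ≡ x
  *-inverseʳ a≢0 x = trans (sym (*-assoc _ _ _)) (trans (cong (_* x) (inv-l a≢0)) (*-identityˡ x))

  ∑-scale : ∀ (g : F → ℤ) {a} → a ≢ 0# → ∑ g ≡ ∑ (λ x → g (a * x))
  ∑-scale g {a} a≢0 = ∑-reindex g (a *_) (inv a *_) (*-inverseˡ a≢0) (*-inverseʳ a≢0)

  ∑-δ : ∀ (g : F → ℤ) y → ∑ (λ x → ⟦ x ≟ y ⟧ *ᶻ g x) ≡ g y
  ∑-δ g y = trans (∑-single (λ x → ⟦ x ≟ y ⟧ *ᶻ g x) y λ x x≢y → cong (_*ᶻ g x) (⟦⟧-no (x ≟ y) x≢y))
                  (trans (cong (_*ᶻ g y) (⟦⟧-yes (y ≟ y) refl)) (ℤ.*-identityˡ (g y)))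

  ∑-product : ∀ (g h : F → ℤ) → ∑ g *ᶻ ∑ h ≡ ∑ (λ x → ∑ (λ y → g x *ᶻ h y))
  ∑-product g h = trans (sym (∑-*ʳ (∑ h) g)) (∑-cong λ x → sym (∑-* (g x) h))

  Bit : F → Set
  Bit v = v ≡ 0# ⊎ v ≡ 1#

  sign-0# : sign 0# ≡ + 1
  sign-0# with 0# ≟ 0#
  ... | yes _ = refl
  ... | no ¬p = ⊥-elim (¬p refl)

  sign-1# : sign 1# ≡ -[1+ 0 ]
  sign-1# with 1# ≟ 0#
  ... | yes p = ⊥-elim (0≢1 (sym p))
  ... | no _  = refl

  sign-+ : ∀ {v w} → Bit v → Bit w → sign (v + w) ≡ sign v *ᶻ sign w
  sign-+ {w = w} (inj₁ refl) _ = trans (cong sign (+-identityˡ w)) (sym (trans (cong (_*ᶻ sign w) sign-0#) (ℤ.*-identityˡ _)))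
  sign-+ (inj₂ refl) (inj₁ refl) = trans (cong sign (+-identityʳ 1#)) (sym (trans (cong (sign 1# *ᶻ_) sign-0#) (ℤ.*-identityʳ _)))
  sign-+ (inj₂ refl) (inj₂ refl) = trans (cong sign (x+x≡0 1#)) (trans sign-0# (sym (cong₂ _*ᶻ_ sign-1# sign-1#)))

  sign-* : ∀ {v w} → Bit v → Bit w → + 2 *ᶻ sign (v * w) ≡ + 1 +ᶻ sign v +ᶻ sign w -ᶻ sign (v + w)
  sign-* {w = w} (inj₁ refl) _ rewrite zeroˡ w | +-identityˡ w | sign-0# = ring (sign w)
    where
    ring : ∀ x → + 2 *ᶻ + 1 ≡ + 1 +ᶻ + 1 +ᶻ x -ᶻ x
    ring = solve-∀
  sign-* (inj₂ refl) (inj₁ refl) rewrite zeroʳ 1# | +-identityʳ 1# | sign-0# | sign-1# = refl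
  sign-* (inj₂ refl) (inj₂ refl) rewrite *-identityʳ 1# | x+x≡0 1# | sign-0# | sign-1# = refl

  Bit-* : ∀ {v w} → Bit v → Bit w → Bit (v * w)
  Bit-* {w = w} (inj₁ refl) _  = inj₁ (zeroˡ w)
  Bit-* {w = w} (inj₂ refl) bw = subst Bit (sym (*-identityˡ w)) bw

  sign-±1 : ∀ v → sign v ≡ + 1 ⊎ sign v ≡ -[1+ 0 ]
  sign-±1 v with v ≟ 0#
  ... | yes _ = inj₁ refl
  ... | no _  = inj₂ refl

-- Conjugation, and orthogonality of the additive characters on the field and on 𝔽q.

module Characters (n : ℕ) (1≤n : 1 ≤ n) (K : GF2 (2 ℕ.* n)) where
  open Sums K public
  open Bent n K using (q; conj; Tr₁²ⁿ; Trₙ²ⁿ; Tr₁ⁿ; W; IsBent; h₂) public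
  open ≡-Reasoning

  conj-+ : ∀ x y → conj (x + y) ≡ conj x + conj y
  conj-+ x y = frobenius x y n

  conj-* : ∀ x y → conj (x * y) ≡ conj x * conj y
  conj-* x y = pow-*-distrib x y q

  conj-0# : conj 0# ≡ 0#
  conj-0# = pow-0# (ℕ.m^n>0 2 n)

  conj-1# : conj 1# ≡ 1#
  conj-1# = pow-1# q

  2n≡n+n : 2 ℕ.* n ≡ n ℕ.+ n
  2n≡n+n = cong (n ℕ.+_) (ℕ.+-identityʳ n)

  conj-involutive : ∀ x → conj (conj x) ≡ x
  conj-involutive x = begin
    pow (pow x (2 ℕ.^ n)) (2 ℕ.^ n) ≡⟨ pow-2^+ x n n ⟨
    pow x (2 ℕ.^ (n ℕ.+ n))         ≡⟨ cong (λ k → pow x (2 ℕ.^ k)) 2n≡n+n ⟨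
    pow x (2 ℕ.^ (2 ℕ.* n))         ≡⟨ fermat x ⟩
    x                               ∎

  conj-≢0 : ∀ {x} → x ≢ 0# → conj x ≢ 0#
  conj-≢0 {x} x≢0 e = x≢0 (trans (sym (conj-involutive x)) (trans (cong conj e) conj-0#))

  conj-inv : ∀ x → conj (inv x) ≡ inv (conj x)
  conj-inv x with x ≟ 0#
  ... | yes refl = trans (cong conj inv-0) (trans conj-0# (sym (trans (cong inv conj-0#) inv-0)))
  ... | no x≢0   = inv-unique (trans (sym (conj-* x (inv x))) (trans (cong conj (inv-r x x≢0)) conj-1#))

  conj-trace : ∀ x → conj (x + conj x) ≡ x + conj x
  conj-trace x = trans (conj-+ x (conj x)) (trans (cong (λ z → conj x + z) (conj-involutive x)) (+-comm _ _))

  Trₙ²ⁿ-def : ∀ x → Trₙ²ⁿ x ≡ x + conj x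
  Trₙ²ⁿ-def x = begin
    pow x (2 ℕ.^ (n ℕ.+ 0)) + (x * 1# + 0#) ≡⟨ cong (λ k → pow x (2 ℕ.^ k) + (x * 1# + 0#)) (ℕ.+-identityʳ n) ⟩
    conj x + (x * 1# + 0#)                  ≡⟨ solve 2 (λ x y → y :+ (x :* con true :+ con false) := x :+ y) refl x (conj x) ⟩
    x + conj x                              ∎

  Tr₁²ⁿ-tower : ∀ x → Tr₁²ⁿ x ≡ Tr₁ⁿ (x + conj x)
  Tr₁²ⁿ-tower x = begin
    TrGen 1 (2 ℕ.* n) x               ≡⟨ cong (λ k → TrGen 1 k x) 2n≡n+n ⟩
    TrGen 1 (n ℕ.+ n) x               ≡⟨ TrGen-split n n x ⟩
    TrGen 1 n (conj x) + TrGen 1 n x  ≡⟨ +-comm _ _ ⟩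
    TrGen 1 n x + TrGen 1 n (conj x)  ≡⟨ TrGen-+ n x (conj x) ⟨
    TrGen 1 n (x + conj x)            ∎

  Tr₁²ⁿ-subfield : ∀ {x} → conj x ≡ x → Tr₁²ⁿ x ≡ 0#
  Tr₁²ⁿ-subfield {x} e = trans (Tr₁²ⁿ-tower x) (trans (cong Tr₁ⁿ (≡⇒+≡0 (sym e))) (TrGen-0# n))

  Tr₁²ⁿ-Bit : ∀ x → Bit (Tr₁²ⁿ x)
  Tr₁²ⁿ-Bit x = TrGen-0⊎1 (2 ℕ.* n) (fermat x)

  χ : F → ℤ
  χ x = sign (Tr₁²ⁿ x)

  χ-+ : ∀ x y → χ (x + y) ≡ χ x *ᶻ χ y
  χ-+ x y = trans (cong sign (TrGen-+ (2 ℕ.* n) x y)) (sign-+ (Tr₁²ⁿ-Bit x) (Tr₁²ⁿ-Bit y))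

  χ-subfield : ∀ {x} → conj x ≡ x → χ x ≡ + 1
  χ-subfield e = trans (cong sign (Tr₁²ⁿ-subfield e)) sign-0#

  χ-0# : χ 0# ≡ + 1
  χ-0# = χ-subfield conj-0#

  -- An element of absolute trace 1. Every vanishing character sum below comes from a translation
  -- built out of it.
  θ : F
  θ = proj₁ (Tr-surjective (ℕ.*-mono-≤ (s≤s (z≤n {1})) 1≤n))

  Tr₁²ⁿ-θ : Tr₁²ⁿ θ ≡ 1#
  Tr₁²ⁿ-θ = proj₂ (Tr-surjective (ℕ.*-mono-≤ (s≤s (z≤n {1})) 1≤n))

  -- Translation by `a` preserves the weight and reverses every sign, so the sum equals its own
  -- negative. The weights in use are the constant 1 and the indicator of 𝔽q.
  χ-∑-vanish : ∀ (w : F → ℤ) c a → (∀ x → w (x + a) ≡ w x) → Tr₁²ⁿ (c * a) ≡ 1# → ∑ (λ x → w x *ᶻ χ (c * x)) ≡ + 0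
  χ-∑-vanish w c a inv-w e = x≡-x⇒x≡0 (begin
    ∑ (λ x → w x *ᶻ χ (c * x))              ≡⟨ ∑-translate _ a ⟩
    ∑ (λ x → w (x + a) *ᶻ χ (c * (x + a)))  ≡⟨ ∑-cong flip ⟩
    ∑ (λ x → -ᶻ (w x *ᶻ χ (c * x)))         ≡⟨ ∑-neg _ ⟩
    -ᶻ ∑ (λ x → w x *ᶻ χ (c * x))           ∎)
    where
    ring : ∀ u v → u *ᶻ (v *ᶻ -[1+ 0 ]) ≡ -ᶻ (u *ᶻ v)
    ring = solve-∀
    flip : ∀ x → w (x + a) *ᶻ χ (c * (x + a)) ≡ -ᶻ (w x *ᶻ χ (c * x))
    flip x = begin
      w (x + a) *ᶻ χ (c * (x + a))          ≡⟨ cong₂ _*ᶻ_ (inv-w x) (trans (cong χ (distribˡ c x a)) (χ-+ _ _)) ⟩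
      w x *ᶻ (χ (c * x) *ᶻ χ (c * a))       ≡⟨ cong (λ z → w x *ᶻ (χ (c * x) *ᶻ z)) (trans (cong sign e) sign-1#) ⟩
      w x *ᶻ (χ (c * x) *ᶻ -[1+ 0 ])        ≡⟨ ring (w x) (χ (c * x)) ⟩
      -ᶻ (w x *ᶻ χ (c * x))                 ∎

  𝐪 : ℤ
  𝐪 = + q

  𝐪² : + (2 ℕ.^ (2 ℕ.* n)) ≡ 𝐪 *ᶻ 𝐪
  𝐪² = trans (cong +_ (trans (cong (2 ℕ.^_) 2n≡n+n) (ℕ.^-distribˡ-+-* 2 n n))) (ℤ.pos-* q q)

  0<𝐪 : + 0 <ᶻ 𝐪
  0<𝐪 = ℤ.+<+ (ℕ.m^n>0 2 n)

  orthogonality : ∀ c → ∑ (λ x → χ (c * x)) ≡ 𝐪 *ᶻ 𝐪 *ᶻ ⟦ c ≟ 0# ⟧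
  orthogonality c with c ≟ 0#
  ... | yes refl = trans (∑-cong λ x → trans (cong χ (zeroˡ x)) χ-0#) (trans ∑-1 (trans 𝐪² (sym (ℤ.*-identityʳ _))))
  ... | no c≢0   = begin
    ∑ (λ x → χ (c * x))         ≡⟨ ∑-cong (λ x → sym (ℤ.*-identityˡ _)) ⟩
    ∑ (λ x → + 1 *ᶻ χ (c * x))  ≡⟨ χ-∑-vanish (λ _ → + 1) c (inv c * θ) (λ _ → refl) (trans (cong Tr₁²ⁿ (*-inverseˡ c≢0 θ)) Tr₁²ⁿ-θ) ⟩
    + 0                         ≡⟨ ℤ.*-zeroʳ (𝐪 *ᶻ 𝐪) ⟨
    𝐪 *ᶻ 𝐪 *ᶻ + 0               ∎

  card-𝔽q : ℤ
  card-𝔽q = ∑ (λ x → ⟦ conj x ≟ x ⟧)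

  conj-fixed-+ : ∀ {a} → conj a ≡ a → ∀ x → ⟦ conj (x + a) ≟ x + a ⟧ ≡ ⟦ conj x ≟ x ⟧
  conj-fixed-+ {a} fix x = ⟦⟧-cong (conj (x + a) ≟ x + a) (conj x ≟ x)
    (λ e → +≡0⇒≡ (begin
      conj x + x                  ≡⟨ solve 3 (λ x y a → y :+ x := y :+ a :+ (x :+ a)) refl x (conj x) a ⟩
      conj x + a + (x + a)        ≡⟨ cong (λ z → conj x + z + (x + a)) fix ⟨
      conj x + conj a + (x + a)   ≡⟨ cong (_+ (x + a)) (conj-+ x a) ⟨
      conj (x + a) + (x + a)      ≡⟨ ≡⇒+≡0 e ⟩
      0#                          ∎))
    (λ e → trans (conj-+ x a) (cong₂ _+_ e fix))

  -- 𝔽q is its own orthogonal complement for the form Tr(xy). The factor stays `card-𝔽q` at this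
  -- point because the size of 𝔽q is deduced from this very formula.
  subfield-sum′ : ∀ c → ∑ (λ x → ⟦ conj x ≟ x ⟧ *ᶻ χ (c * x)) ≡ card-𝔽q *ᶻ ⟦ conj c ≟ c ⟧
  subfield-sum′ c with conj c ≟ c
  ... | yes e = trans (∑-cong λ x → trans
          (⟦⟧-guard (conj x ≟ x) λ f → χ-subfield (trans (conj-* c x) (cong₂ _*_ e f))) (ℤ.*-identityʳ _))
        (sym (ℤ.*-identityʳ card-𝔽q))
  ... | no c̄≢c = trans (χ-∑-vanish _ c a (conj-fixed-+ a-fixed) Tr-ca) (sym (ℤ.*-zeroʳ card-𝔽q))
    where
    d = c + conj c
    d≢0 : d ≢ 0#
    d≢0 e = c̄≢c (sym (+≡0⇒≡ e))
    -- Chosen in 𝔽q so that ca + (its conjugate) = da = θ + θ̄, which forces Tr(ca) = Tr(θ) = 1.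
    a = inv d * (θ + conj θ)
    a-fixed : conj a ≡ a
    a-fixed = trans (conj-* _ _) (cong₂ _*_ (trans (conj-inv d) (cong inv (conj-trace c))) (conj-trace θ))
    Tr-ca : Tr₁²ⁿ (c * a) ≡ 1#
    Tr-ca = begin
      Tr₁²ⁿ (c * a)                   ≡⟨ Tr₁²ⁿ-tower (c * a) ⟩
      Tr₁ⁿ (c * a + conj (c * a))     ≡⟨ cong (λ z → Tr₁ⁿ (c * a + z)) (trans (conj-* c a) (cong (conj c *_) a-fixed)) ⟩
      Tr₁ⁿ (c * a + conj c * a)       ≡⟨ cong Tr₁ⁿ (distribʳ a c (conj c)) ⟨
      Tr₁ⁿ (d * a)                    ≡⟨ cong Tr₁ⁿ (*-inverseˡ d≢0 _) ⟩
      Tr₁ⁿ (θ + conj θ)               ≡⟨ Tr₁²ⁿ-tower θ ⟨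
      Tr₁²ⁿ θ                         ≡⟨ Tr₁²ⁿ-θ ⟩
      1#                              ∎

  -- Evaluating ∑_c ∑_{x ∈ 𝔽q} χ(cx) in both orders gives |𝔽q|² = q².
  card-𝔽q≡𝐪 : card-𝔽q ≡ 𝐪
  card-𝔽q≡𝐪 = x*x≡y*y⇒x≡y (subst (_≤ᶻ card-𝔽q) ∑-0 (∑-mono λ x → ⟦⟧-≥0 (conj x ≟ x))) 0<𝐪 (begin
    card-𝔽q *ᶻ card-𝔽q                                     ≡⟨ ∑-* card-𝔽q _ ⟨
    ∑ (λ c → card-𝔽q *ᶻ ⟦ conj c ≟ c ⟧)                     ≡⟨ ∑-cong (λ c → sym (subfield-sum′ c)) ⟩
    ∑ (λ c → ∑ (λ x → ⟦ conj x ≟ x ⟧ *ᶻ χ (c * x)))         ≡⟨ ∑-swap _ ⟩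
    ∑ (λ x → ∑ (λ c → ⟦ conj x ≟ x ⟧ *ᶻ χ (c * x)))         ≡⟨ ∑-cong inner ⟩
    ∑ (λ x → ⟦ x ≟ 0# ⟧ *ᶻ (⟦ conj x ≟ x ⟧ *ᶻ (𝐪 *ᶻ 𝐪)))    ≡⟨ ∑-δ _ 0# ⟩
    ⟦ conj 0# ≟ 0# ⟧ *ᶻ (𝐪 *ᶻ 𝐪)                            ≡⟨ cong (_*ᶻ (𝐪 *ᶻ 𝐪)) (⟦⟧-yes (conj 0# ≟ 0#) conj-0#) ⟩
    + 1 *ᶻ (𝐪 *ᶻ 𝐪)                                         ≡⟨ ℤ.*-identityˡ _ ⟩
    𝐪 *ᶻ 𝐪                                                  ∎)
    where
    ring : ∀ a b c → a *ᶻ (b *ᶻ c) ≡ c *ᶻ (a *ᶻ b)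
    ring = solve-∀
    inner : ∀ x → ∑ (λ c → ⟦ conj x ≟ x ⟧ *ᶻ χ (c * x)) ≡ ⟦ x ≟ 0# ⟧ *ᶻ (⟦ conj x ≟ x ⟧ *ᶻ (𝐪 *ᶻ 𝐪))
    inner x = begin
      ∑ (λ c → ⟦ conj x ≟ x ⟧ *ᶻ χ (c * x))                ≡⟨ ∑-* ⟦ conj x ≟ x ⟧ (λ c → χ (c * x)) ⟩
      ⟦ conj x ≟ x ⟧ *ᶻ ∑ (λ c → χ (c * x))                ≡⟨ cong (⟦ conj x ≟ x ⟧ *ᶻ_) (trans (∑-cong λ c → cong χ (*-comm c x)) (orthogonality x)) ⟩
      ⟦ conj x ≟ x ⟧ *ᶻ (𝐪 *ᶻ 𝐪 *ᶻ ⟦ x ≟ 0# ⟧)             ≡⟨ ring ⟦ conj x ≟ x ⟧ (𝐪 *ᶻ 𝐪) ⟦ x ≟ 0# ⟧ ⟩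
      ⟦ x ≟ 0# ⟧ *ᶻ (⟦ conj x ≟ x ⟧ *ᶻ (𝐪 *ᶻ 𝐪))           ∎

  subfield-sum : ∀ c → ∑ (λ x → ⟦ conj x ≟ x ⟧ *ᶻ χ (c * x)) ≡ 𝐪 *ᶻ ⟦ conj c ≟ c ⟧
  subfield-sum c = trans (subfield-sum′ c) (cong (_*ᶻ ⟦ conj c ≟ c ⟧) card-𝔽q≡𝐪)

-- The unit circle U and the decomposition of the field into lines over 𝔽q.

module Circle (n : ℕ) (2≤n : 2 ≤ n) (K : GF2 (2 ℕ.* n)) where
  open Characters n (ℕ.≤-trans (s≤s z≤n) 2≤n) K public
  open ≡-Reasoning

  -- Definitionally a statement about `pow u (suc q)`, so it differs from u^(q+1) = 1 only by
  -- commuting the exponent `q + 1`.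
  InU : F → Set
  InU u = u * conj u ≡ 1#

  inU? : ∀ u → Dec (InU u)
  inU? u = u * conj u ≟ 1#

  InU-1# : InU 1#
  InU-1# = trans (*-identityˡ _) conj-1#

  InU-conj : ∀ {u} → InU u → InU (conj u)
  InU-conj {u} i = trans (cong (conj u *_) (conj-involutive u)) (trans (*-comm _ _) i)

  InU-* : ∀ {u v} → InU u → InU v → InU (u * v)
  InU-* {u} {v} i j = begin
    u * v * conj (u * v)          ≡⟨ cong (u * v *_) (conj-* u v) ⟩
    u * v * (conj u * conj v)     ≡⟨ solve 4 (λ u v a b → u :* v :* (a :* b) := u :* a :* (v :* b)) refl u v (conj u) (conj v) ⟩
    u * conj u * (v * conj v)     ≡⟨ cong₂ _*_ i j ⟩
    1# * 1#                       ≡⟨ *-identityˡ 1# ⟩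
    1#                            ∎

  conj-norm : ∀ x → conj (x * conj x) ≡ x * conj x
  conj-norm x = trans (conj-* x (conj x)) (trans (cong (conj x *_) (conj-involutive x)) (*-comm _ _))

  1≤q∸1 : 1 ≤ q ℕ.∸ 1
  1≤q∸1 = ℕ.≤-trans (s≤s z≤n) (ℕ.∸-monoˡ-≤ 1 (ℕ.^-monoʳ-≤ 2 2≤n))

  suc[q∸1]≡q : suc (q ℕ.∸ 1) ≡ q
  suc[q∸1]≡q = ℕ.m+[n∸m]≡n (ℕ.m^n>0 2 n)

  x*pow : ∀ x → x * pow x (q ℕ.∸ 1) ≡ conj x
  x*pow x = cong (pow x) suc[q∸1]≡q

  pow-InU : ∀ {x} → x ≢ 0# → InU (pow x (q ℕ.∸ 1))
  pow-InU {x} x≢0 = *-cancelˡ (*-≢0 x≢0 (conj-≢0 x≢0)) (begin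
    x * conj x * (u * conj u)       ≡⟨ solve 4 (λ x y u v → x :* y :* (u :* v) := x :* u :* (y :* v)) refl x (conj x) u (conj u) ⟩
    x * u * (conj x * conj u)       ≡⟨ cong₂ _*_ (x*pow x) (trans (sym (conj-* x u)) (trans (cong conj (x*pow x)) (conj-involutive x))) ⟩
    conj x * x                      ≡⟨ solve 2 (λ x y → y :* x := x :* y :* con true) refl x (conj x) ⟩
    x * conj x * 1#                 ∎)
    where u = pow x (q ℕ.∸ 1)

  -- For u ≠ 1 the witness is 1 + ū, because u(1 + ū) = u + 1. At u = 1 that element vanishes and 1
  -- takes its place.
  hilbert90 : ∀ {u} → InU u → ∃ λ x → x ≢ 0# × conj x ≡ u * x
  hilbert90 {u} i with u ≟ 1#
  ... | yes refl = 1# , (λ e → 0≢1 (sym e)) , trans conj-1# (sym (*-identityˡ 1#))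
  ... | no u≢1   = 1# + conj u , nonzero , (begin
    conj (1# + conj u)        ≡⟨ conj-+ 1# (conj u) ⟩
    conj 1# + conj (conj u)   ≡⟨ cong₂ _+_ conj-1# (conj-involutive u) ⟩
    1# + u                    ≡⟨ cong (_+ u) i ⟨
    u * conj u + u            ≡⟨ solve 2 (λ u v → u :* v :+ u := u :* (con true :+ v)) refl u (conj u) ⟩
    u * (1# + conj u)         ∎)
    where
    nonzero : 1# + conj u ≢ 0#
    nonzero e = u≢1 (trans (sym (conj-involutive u)) (trans (cong conj (sym (+≡0⇒≡ e))) conj-1#))

  -- With z from `hilbert90`, the solutions of x̄ = ux are exactly z𝔽q; scaling by z leaves
  -- `subfield-sum` at ωz.
  line-sum : ∀ {u} ω → InU u → ∑ (λ x → ⟦ conj x ≟ u * x ⟧ *ᶻ χ (ω * x)) ≡ 𝐪 *ᶻ ⟦ conj ω * u ≟ ω ⟧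
  line-sum {u} ω i with hilbert90 i
  ... | z , z≢0 , z̄≡uz = begin
    ∑ (λ x → ⟦ conj x ≟ u * x ⟧ *ᶻ χ (ω * x))                   ≡⟨ ∑-scale _ z≢0 ⟩
    ∑ (λ y → ⟦ conj (z * y) ≟ u * (z * y) ⟧ *ᶻ χ (ω * (z * y)))  ≡⟨ ∑-cong (λ y → cong₂ _*ᶻ_ (on-line y) (cong χ (sym (*-assoc ω z y)))) ⟩
    ∑ (λ y → ⟦ conj y ≟ y ⟧ *ᶻ χ (ω * z * y))                   ≡⟨ subfield-sum (ω * z) ⟩
    𝐪 *ᶻ ⟦ conj (ω * z) ≟ ω * z ⟧                               ≡⟨ cong (𝐪 *ᶻ_) (⟦⟧-cong (conj (ω * z) ≟ ω * z) (conj ω * u ≟ ω) to from) ⟩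
    𝐪 *ᶻ ⟦ conj ω * u ≟ ω ⟧                                     ∎
    where
    conj-zy : ∀ y → conj (z * y) ≡ u * z * conj y
    conj-zy y = trans (conj-* z y) (cong (_* conj y) z̄≡uz)
    u≢0 : u ≢ 0#
    u≢0 = *≡1⇒≢0 i
    on-line : ∀ y → ⟦ conj (z * y) ≟ u * (z * y) ⟧ ≡ ⟦ conj y ≟ y ⟧
    on-line y = ⟦⟧-cong (conj (z * y) ≟ u * (z * y)) (conj y ≟ y)
      (λ e → *-cancelˡ (*-≢0 u≢0 z≢0) (trans (sym (conj-zy y)) (trans e (sym (*-assoc u z y)))))
      (λ e → trans (conj-zy y) (trans (cong (u * z *_) e) (*-assoc u z y)))
    conj-ωz : conj (ω * z) ≡ z * (conj ω * u)
    conj-ωz = trans (conj-* ω z) (trans (cong (conj ω *_) z̄≡uz)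
      (solve 3 (λ a u z → a :* (u :* z) := z :* (a :* u)) refl (conj ω) u z))
    to : conj (ω * z) ≡ ω * z → conj ω * u ≡ ω
    to e = *-cancelˡ z≢0 (trans (sym conj-ωz) (trans e (*-comm ω z)))
    from : conj ω * u ≡ ω → conj (ω * z) ≡ ω * z
    from e = trans conj-ωz (trans (cong (z *_) e) (*-comm z ω))

  -- Each x ≠ 0 lies on exactly one line x̄ = ux with u ∈ U, namely for u = x^(q-1), while 0 lies on
  -- all of them. The -1 removes the term at 0 from each line sum.
  polar-sum : ∀ (G : F → ℤ) ω →
    ∑ (λ x → ⟦ ¬? (x ≟ 0#) ⟧ *ᶻ (G (pow x (q ℕ.∸ 1)) *ᶻ χ (ω * x)))
      ≡ ∑ (λ u → ⟦ inU? u ⟧ *ᶻ (G u *ᶻ (𝐪 *ᶻ ⟦ conj ω * u ≟ ω ⟧ -ᶻ + 1)))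
  polar-sum G ω = begin
    ∑ (λ x → ⟦ ¬? (x ≟ 0#) ⟧ *ᶻ (G (pow x (q ℕ.∸ 1)) *ᶻ χ (ω * x)))   ≡⟨ ∑-cong fibre ⟩
    ∑ (λ x → ∑ (λ u → term x u))                                       ≡⟨ ∑-swap _ ⟩
    ∑ (λ u → ∑ (λ x → term x u))                                       ≡⟨ ∑-cong line ⟩
    ∑ (λ u → ⟦ inU? u ⟧ *ᶻ (G u *ᶻ (𝐪 *ᶻ ⟦ conj ω * u ≟ ω ⟧ -ᶻ + 1)))  ∎
    where
    weight : F → F → ℤ
    weight u x = ⟦ conj x ≟ u * x ⟧ *ᶻ χ (ω * x) -ᶻ ⟦ x ≟ 0# ⟧ *ᶻ χ (ω * x)

    term : F → F → ℤ
    term x u = ⟦ inU? u ⟧ *ᶻ (G u *ᶻ weight u x)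

    line : ∀ u → ∑ (λ x → term x u) ≡ ⟦ inU? u ⟧ *ᶻ (G u *ᶻ (𝐪 *ᶻ ⟦ conj ω * u ≟ ω ⟧ -ᶻ + 1))
    line u = trans (∑-* ⟦ inU? u ⟧ (λ x → G u *ᶻ weight u x)) (⟦⟧-guard (inU? u) λ i →
      trans (∑-* (G u) (weight u)) (cong (G u *ᶻ_)
        (trans (∑-- (λ x → ⟦ conj x ≟ u * x ⟧ *ᶻ χ (ω * x)) (λ x → ⟦ x ≟ 0# ⟧ *ᶻ χ (ω * x)))
          (cong₂ _-ᶻ_ (line-sum ω i) (trans (∑-δ (λ x → χ (ω * x)) 0#) (trans (cong χ (zeroʳ ω)) χ-0#))))))

    term-0 : ∀ u {x} → weight u x ≡ + 0 → term x u ≡ + 0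
    term-0 u e = trans (cong (λ w → ⟦ inU? u ⟧ *ᶻ (G u *ᶻ w)) e) (ring ⟦ inU? u ⟧ (G u))
      where
      ring : ∀ a b → a *ᶻ (b *ᶻ + 0) ≡ + 0
      ring = solve-∀

    fibre : ∀ x → ⟦ ¬? (x ≟ 0#) ⟧ *ᶻ (G (pow x (q ℕ.∸ 1)) *ᶻ χ (ω * x)) ≡ ∑ (λ u → term x u)
    fibre x = by-cases (x ≟ 0#)
      where
      by-cases : Dec (x ≡ 0#) → ⟦ ¬? (x ≟ 0#) ⟧ *ᶻ (G (pow x (q ℕ.∸ 1)) *ᶻ χ (ω * x)) ≡ ∑ (λ u → term x u)
      by-cases (yes refl) = trans (cong (_*ᶻ (G (pow 0# (q ℕ.∸ 1)) *ᶻ χ (ω * 0#))) (⟦⟧-no (¬? (0# ≟ 0#)) (λ f → f refl)))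
        (sym (trans (∑-cong λ u → term-0 u (trans (cong₂ (λ a b → a *ᶻ χ (ω * 0#) -ᶻ b *ᶻ χ (ω * 0#))
                (⟦⟧-yes (conj 0# ≟ u * 0#) (trans conj-0# (sym (zeroʳ u)))) (⟦⟧-yes (0# ≟ 0#) refl))
              (ring (χ (ω * 0#))))) ∑-0))
        where
        ring : ∀ a → + 1 *ᶻ a -ᶻ + 1 *ᶻ a ≡ + 0
        ring = solve-∀
      by-cases (no x≢0) = sym (trans (∑-single (term x) u₀ off) on)
        where
        u₀ = pow x (q ℕ.∸ 1)
        ring : ∀ a → + 0 *ᶻ a -ᶻ + 0 *ᶻ a ≡ + 0
        ring = solve-∀
        ring₁ : ∀ a b → + 1 *ᶻ (a *ᶻ (+ 1 *ᶻ b -ᶻ + 0 *ᶻ b)) ≡ + 1 *ᶻ (a *ᶻ b)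
        ring₁ = solve-∀
        off : ∀ u → u ≢ u₀ → term x u ≡ + 0
        off u u≢u₀ = term-0 u (trans (cong₂ (λ a b → a *ᶻ χ (ω * x) -ᶻ b *ᶻ χ (ω * x))
          (⟦⟧-no (conj x ≟ u * x) (λ e → u≢u₀ (*-cancelˡ x≢0 (trans (*-comm x u) (trans (sym e) (sym (x*pow x)))))))
          (⟦⟧-no (x ≟ 0#) x≢0)) (ring (χ (ω * x))))
        on : term x u₀ ≡ ⟦ ¬? (x ≟ 0#) ⟧ *ᶻ (G u₀ *ᶻ χ (ω * x))
        on = begin
          ⟦ inU? u₀ ⟧ *ᶻ (G u₀ *ᶻ (⟦ conj x ≟ u₀ * x ⟧ *ᶻ χ (ω * x) -ᶻ ⟦ x ≟ 0# ⟧ *ᶻ χ (ω * x)))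
            ≡⟨ cong₂ (λ a b → a *ᶻ (G u₀ *ᶻ (b *ᶻ χ (ω * x) -ᶻ ⟦ x ≟ 0# ⟧ *ᶻ χ (ω * x)))) (⟦⟧-yes (inU? u₀) (pow-InU x≢0))
                 (⟦⟧-yes (conj x ≟ u₀ * x) (trans (sym (x*pow x)) (*-comm x u₀))) ⟩
          + 1 *ᶻ (G u₀ *ᶻ (+ 1 *ᶻ χ (ω * x) -ᶻ ⟦ x ≟ 0# ⟧ *ᶻ χ (ω * x)))
            ≡⟨ cong (λ a → + 1 *ᶻ (G u₀ *ᶻ (+ 1 *ᶻ χ (ω * x) -ᶻ a *ᶻ χ (ω * x)))) (⟦⟧-no (x ≟ 0#) x≢0) ⟩
          + 1 *ᶻ (G u₀ *ᶻ (+ 1 *ᶻ χ (ω * x) -ᶻ + 0 *ᶻ χ (ω * x)))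
            ≡⟨ ring₁ (G u₀) (χ (ω * x)) ⟩
          + 1 *ᶻ (G u₀ *ᶻ χ (ω * x))
            ≡⟨ cong (_*ᶻ (G u₀ *ᶻ χ (ω * x))) (⟦⟧-yes (¬? (x ≟ 0#)) x≢0) ⟨
          ⟦ ¬? (x ≟ 0#) ⟧ *ᶻ (G u₀ *ᶻ χ (ω * x)) ∎

  ∑U : (F → ℤ) → ℤ
  ∑U G = ∑ (λ u → ⟦ inU? u ⟧ *ᶻ G u)

  ∑U-cong : ∀ {g h : F → ℤ} → (∀ u → InU u → g u ≡ h u) → ∑U g ≡ ∑U h
  ∑U-cong e = ∑-cong λ u → ⟦⟧-guard (inU? u) (e u)

  ∑U-* : ∀ c (g : F → ℤ) → ∑U (λ u → c *ᶻ g u) ≡ c *ᶻ ∑U g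
  ∑U-* c g = trans (∑-cong λ u → ring ⟦ inU? u ⟧ c (g u)) (∑-* c (λ u → ⟦ inU? u ⟧ *ᶻ g u))
    where
    ring : ∀ a b c → a *ᶻ (b *ᶻ c) ≡ b *ᶻ (a *ᶻ c)
    ring = solve-∀

  ∑U-+ : ∀ (g h : F → ℤ) → ∑U (λ u → g u +ᶻ h u) ≡ ∑U g +ᶻ ∑U h
  ∑U-+ g h = trans (∑-cong λ u → ℤ.*-distribˡ-+ ⟦ inU? u ⟧ (g u) (h u)) (∑-+ (λ u → ⟦ inU? u ⟧ *ᶻ g u) (λ u → ⟦ inU? u ⟧ *ᶻ h u))

  ∑U-- : ∀ (g h : F → ℤ) → ∑U (λ u → g u -ᶻ h u) ≡ ∑U g -ᶻ ∑U h
  ∑U-- g h = trans (∑-cong λ u → ring ⟦ inU? u ⟧ (g u) (h u)) (∑-- (λ u → ⟦ inU? u ⟧ *ᶻ g u) (λ u → ⟦ inU? u ⟧ *ᶻ h u))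
    where
    ring : ∀ a b c → a *ᶻ (b -ᶻ c) ≡ a *ᶻ b -ᶻ a *ᶻ c
    ring = solve-∀

  split-0 : ∀ (g : F → ℤ) → ∑ g ≡ g 0# +ᶻ ∑ (λ x → ⟦ ¬? (x ≟ 0#) ⟧ *ᶻ g x)
  split-0 g = begin
    ∑ g                                                                   ≡⟨ ∑-cong (λ x → parts (x ≟ 0#) (g x)) ⟩
    ∑ (λ x → ⟦ x ≟ 0# ⟧ *ᶻ g x +ᶻ ⟦ ¬? (x ≟ 0#) ⟧ *ᶻ g x)                 ≡⟨ ∑-+ (λ x → ⟦ x ≟ 0# ⟧ *ᶻ g x) (λ x → ⟦ ¬? (x ≟ 0#) ⟧ *ᶻ g x) ⟩
    ∑ (λ x → ⟦ x ≟ 0# ⟧ *ᶻ g x) +ᶻ ∑ (λ x → ⟦ ¬? (x ≟ 0#) ⟧ *ᶻ g x)       ≡⟨ cong (_+ᶻ ∑ (λ x → ⟦ ¬? (x ≟ 0#) ⟧ *ᶻ g x)) (∑-δ g 0#) ⟩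
    g 0# +ᶻ ∑ (λ x → ⟦ ¬? (x ≟ 0#) ⟧ *ᶻ g x)                              ∎
    where
    ring₁ : ∀ a → a ≡ + 1 *ᶻ a +ᶻ + 0 *ᶻ a
    ring₁ = solve-∀
    ring₂ : ∀ a → a ≡ + 0 *ᶻ a +ᶻ + 1 *ᶻ a
    ring₂ = solve-∀
    parts : ∀ {P : Set} (d : Dec P) a → a ≡ ⟦ d ⟧ *ᶻ a +ᶻ ⟦ ¬? d ⟧ *ᶻ a
    parts (yes _) = ring₁
    parts (no _)  = ring₂

  1<𝐪 : + 1 <ᶻ 𝐪
  1<𝐪 = ℤ.+<+ (ℕ.≤-trans (s≤s (s≤s z≤n)) (ℕ.^-monoʳ-≤ 2 2≤n))

  cancel-𝐪-1 : ∀ {x y} → x *ᶻ (𝐪 -ᶻ + 1) ≡ y *ᶻ (𝐪 -ᶻ + 1) → x ≡ y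
  cancel-𝐪-1 {x} {y} = ℤ.*-cancelʳ-≡ x y (𝐪 -ᶻ + 1) {{ℤ.≢-nonZero λ e → ℤ.<-irrefl (sym (ℤ.i-j≡0⇒i≡j 𝐪 (+ 1) e)) 1<𝐪}}

  -- `polar-sum` with G = 1 and ω = 0 counts the nonzero elements as q² - 1 = |U|(q - 1).
  card-U : ∑U (λ _ → + 1) ≡ 𝐪 +ᶻ + 1
  card-U = cancel-𝐪-1 (begin
    ∑U (λ _ → + 1) *ᶻ (𝐪 -ᶻ + 1)                                          ≡⟨ trans (ℤ.*-comm (∑U (λ _ → + 1)) (𝐪 -ᶻ + 1)) (sym (∑U-* (𝐪 -ᶻ + 1) (λ _ → + 1))) ⟩
    ∑U (λ _ → (𝐪 -ᶻ + 1) *ᶻ + 1)                                          ≡⟨ ∑U-cong (λ u _ → trans (ring₁ 𝐪) (cong (λ z → + 1 *ᶻ (𝐪 *ᶻ z -ᶻ + 1)) (sym (⟦⟧-yes (conj 0# * u ≟ 0#) (trans (cong (_* u) conj-0#) (zeroˡ u)))))) ⟩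
    ∑U (λ u → + 1 *ᶻ (𝐪 *ᶻ ⟦ conj 0# * u ≟ 0# ⟧ -ᶻ + 1))                  ≡⟨ polar-sum (λ _ → + 1) 0# ⟨
    ∑ (λ x → ⟦ ¬? (x ≟ 0#) ⟧ *ᶻ (+ 1 *ᶻ χ (0# * x)))                      ≡⟨ ring₂ (χ (0# * 0#)) _ ⟩
    (+ 1 *ᶻ χ (0# * 0#) +ᶻ ∑ (λ x → ⟦ ¬? (x ≟ 0#) ⟧ *ᶻ (+ 1 *ᶻ χ (0# * x)))) -ᶻ χ (0# * 0#) ≡⟨ cong₂ _-ᶻ_ (sym (split-0 (λ x → + 1 *ᶻ χ (0# * x)))) (χ0 0#) ⟩
    ∑ (λ x → + 1 *ᶻ χ (0# * x)) -ᶻ + 1                                    ≡⟨ cong (_-ᶻ + 1) (trans (∑-cong (λ x → cong (+ 1 *ᶻ_) (χ0 x))) (trans ∑-1 𝐪²)) ⟩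
    𝐪 *ᶻ 𝐪 -ᶻ + 1                                                         ≡⟨ ring₃ 𝐪 ⟩
    (𝐪 +ᶻ + 1) *ᶻ (𝐪 -ᶻ + 1)                                              ∎)
    where
    χ0 : ∀ x → χ (0# * x) ≡ + 1
    χ0 x = trans (cong χ (zeroˡ x)) χ-0#
    ring₁ : ∀ a → (a -ᶻ + 1) *ᶻ + 1 ≡ + 1 *ᶻ (a *ᶻ + 1 -ᶻ + 1)
    ring₁ = solve-∀
    ring₂ : ∀ a b → b ≡ (+ 1 *ᶻ a +ᶻ b) -ᶻ a
    ring₂ = solve-∀
    ring₃ : ∀ a → a *ᶻ a -ᶻ + 1 ≡ (a +ᶻ + 1) *ᶻ (a -ᶻ + 1)
    ring₃ = solve-∀

-- Bentness as a condition on one sum over U.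

module Walsh (n : ℕ) (2≤n : 2 ≤ n) (K : GF2 (2 ℕ.* n)) where
  open Circle n 2≤n K public
  open ≡-Reasoning

  i*i≡j*j⇒i≡±j : ∀ i j → i *ᶻ i ≡ j *ᶻ j → i ≡ j ⊎ i ≡ -ᶻ j
  i*i≡j*j⇒i≡±j i j e with ℤ.i*j≡0⇒i≡0∨j≡0 (i -ᶻ j) (trans (ring₁ i j) (ℤ.i≡j⇒i-j≡0 e))
    where
    ring₁ : ∀ i j → (i -ᶻ j) *ᶻ (i +ᶻ j) ≡ i *ᶻ i -ᶻ j *ᶻ j
    ring₁ = solve-∀
  ... | inj₁ p = inj₁ (ℤ.i-j≡0⇒i≡j i j p)
  ... | inj₂ p = inj₂ (trans (ring₂ i j) (trans (cong (_-ᶻ j) p) (ℤ.+-identityˡ (-ᶻ j))))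
    where
    ring₂ : ∀ i j → i ≡ (i +ᶻ j) -ᶻ j
    ring₂ = solve-∀

  -- Here q - 1 ≥ 3. This excludes the case that W(0) = ±q and the sign of f(0) disagree.
  [𝐪-1]*k≢2 : ∀ k → k *ᶻ (𝐪 -ᶻ + 1) ≢ + 2
  [𝐪-1]*k≢2 k e = ℕ.<-irrefl refl (ℕ.≤-trans (ℕ.∸-monoˡ-≤ 1 (ℕ.^-monoʳ-≤ 2 2≤n)) (∣⇒≤ (divides ℤ.∣ k ∣ (begin
    2                                 ≡⟨ cong ℤ.∣_∣ e ⟨
    ℤ.∣ k *ᶻ (𝐪 -ᶻ + 1) ∣             ≡⟨ ℤ.abs-* k (𝐪 -ᶻ + 1) ⟩
    ℤ.∣ k ∣ ℕ.* ℤ.∣ 𝐪 -ᶻ + 1 ∣        ≡⟨ cong (λ z → ℤ.∣ k ∣ ℕ.* ℤ.∣ z ∣) (trans (ℤ.m-n≡m⊖n q 1) (ℤ.⊖-≥ (ℕ.m^n>0 2 n))) ⟩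
    ℤ.∣ k ∣ ℕ.* (q ℕ.∸ 1)             ∎))))

  module _ (g : F → F) (g-Bit : ∀ u → Bit (g u)) where

    circleSum : ℤ
    circleSum = ∑U (λ u → sign (g u))

    f : F → F
    f x = g (pow x (q ℕ.∸ 1))

    W-formula : ∀ ω → W f ω ≡ sign (f 0#) -ᶻ circleSum +ᶻ 𝐪 *ᶻ ∑U (λ u → ⟦ conj ω * u ≟ ω ⟧ *ᶻ sign (g u))
    W-formula ω = begin
      W f ω                                                                   ≡⟨ Σ≡∑ (λ x → sign (f x + Tr₁²ⁿ (ω * x))) ⟩
      ∑ (λ x → sign (f x + Tr₁²ⁿ (ω * x)))                                    ≡⟨ ∑-cong (λ x → sign-+ (g-Bit _) (Tr₁²ⁿ-Bit (ω * x))) ⟩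
      ∑ (λ x → sign (f x) *ᶻ χ (ω * x))                                       ≡⟨ split-0 (λ x → sign (f x) *ᶻ χ (ω * x)) ⟩
      sign (f 0#) *ᶻ χ (ω * 0#) +ᶻ ∑ (λ x → ⟦ ¬? (x ≟ 0#) ⟧ *ᶻ (sign (f x) *ᶻ χ (ω * x)))
        ≡⟨ cong₂ _+ᶻ_ (trans (cong (sign (f 0#) *ᶻ_) (trans (cong χ (zeroʳ ω)) χ-0#)) (ℤ.*-identityʳ (sign (f 0#)))) (polar-sum (λ u → sign (g u)) ω) ⟩
      sign (f 0#) +ᶻ ∑U (λ u → sign (g u) *ᶻ (𝐪 *ᶻ ⟦ conj ω * u ≟ ω ⟧ -ᶻ + 1))
        ≡⟨ cong (sign (f 0#) +ᶻ_) (trans (∑U-cong (λ u _ → ring₁ (sign (g u)) 𝐪 ⟦ conj ω * u ≟ ω ⟧))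
             (trans (∑U-- (λ u → 𝐪 *ᶻ (⟦ conj ω * u ≟ ω ⟧ *ᶻ sign (g u))) (λ u → sign (g u)))
                    (cong (_-ᶻ circleSum) (∑U-* 𝐪 (λ u → ⟦ conj ω * u ≟ ω ⟧ *ᶻ sign (g u)))))) ⟩
      sign (f 0#) +ᶻ (𝐪 *ᶻ ∑U (λ u → ⟦ conj ω * u ≟ ω ⟧ *ᶻ sign (g u)) -ᶻ circleSum)
        ≡⟨ ring₂ (sign (f 0#)) (𝐪 *ᶻ ∑U (λ u → ⟦ conj ω * u ≟ ω ⟧ *ᶻ sign (g u))) circleSum ⟩
      sign (f 0#) -ᶻ circleSum +ᶻ 𝐪 *ᶻ ∑U (λ u → ⟦ conj ω * u ≟ ω ⟧ *ᶻ sign (g u)) ∎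
      where
      ring₁ : ∀ s q d → s *ᶻ (q *ᶻ d -ᶻ + 1) ≡ q *ᶻ (d *ᶻ s) -ᶻ s
      ring₁ = solve-∀
      ring₂ : ∀ a b c → a +ᶻ (b -ᶻ c) ≡ a -ᶻ c +ᶻ b
      ring₂ = solve-∀

    ∑U-at-0 : ∑U (λ u → ⟦ conj 0# * u ≟ 0# ⟧ *ᶻ sign (g u)) ≡ circleSum
    ∑U-at-0 = ∑U-cong λ u _ → trans (cong (_*ᶻ sign (g u))
      (⟦⟧-yes (conj 0# * u ≟ 0#) (trans (cong (_* u) conj-0#) (zeroˡ u)))) (ℤ.*-identityˡ (sign (g u)))

    -- For ω ≠ 0 the equation ω̄u = ω has the single solution u = ω/ω̄, and this quotient lies in U.
    ∑U-at-≢0 : ∀ {ω} → ω ≢ 0# → ∃ λ u → ∑U (λ u → ⟦ conj ω * u ≟ ω ⟧ *ᶻ sign (g u)) ≡ sign (g u)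
    ∑U-at-≢0 {ω} ω≢0 = u₀ , trans (∑-single (λ u → ⟦ inU? u ⟧ *ᶻ (⟦ conj ω * u ≟ ω ⟧ *ᶻ sign (g u))) u₀ off)
      (trans (cong₂ (λ a b → a *ᶻ (b *ᶻ sign (g u₀))) (⟦⟧-yes (inU? u₀) u₀-InU) (⟦⟧-yes (conj ω * u₀ ≟ ω) ω̄u₀≡ω)) (ring₁ (sign (g u₀))))
      where
      ring₁ : ∀ a → + 1 *ᶻ (+ 1 *ᶻ a) ≡ a
      ring₁ = solve-∀
      ω̄≢0 = conj-≢0 ω≢0
      u₀ = inv (conj ω) * ω
      ω̄u₀≡ω : conj ω * u₀ ≡ ω
      ω̄u₀≡ω = *-inverseˡ ω̄≢0 ω
      u₀-InU : InU u₀
      u₀-InU = *-cancelˡ (*-≢0 ω̄≢0 ω≢0) (begin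
        conj ω * ω * (u₀ * conj u₀)       ≡⟨ solve 4 (λ a b u v → a :* b :* (u :* v) := a :* u :* (b :* v)) refl (conj ω) ω u₀ (conj u₀) ⟩
        conj ω * u₀ * (ω * conj u₀)       ≡⟨ cong₂ _*_ ω̄u₀≡ω (trans (cong (_* conj u₀) (sym (conj-involutive ω))) (trans (sym (conj-* (conj ω) u₀)) (cong conj ω̄u₀≡ω))) ⟩
        ω * conj ω                        ≡⟨ solve 2 (λ a b → b :* a := a :* b :* con true) refl (conj ω) ω ⟩
        conj ω * ω * 1#                   ∎)
      off : ∀ u → u ≢ u₀ → ⟦ inU? u ⟧ *ᶻ (⟦ conj ω * u ≟ ω ⟧ *ᶻ sign (g u)) ≡ + 0
      off u u≢u₀ = trans (cong (λ z → ⟦ inU? u ⟧ *ᶻ (z *ᶻ sign (g u)))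
        (⟦⟧-no (conj ω * u ≟ ω) λ e → u≢u₀ (*-cancelˡ ω̄≢0 (trans e (sym ω̄u₀≡ω))))) (ℤ.*-zeroʳ ⟦ inU? u ⟧)

    -- Only ω = 0 is needed: s + C(q - 1) = ±q with s = ±1 the sign of f(0) and C the circle sum.
    -- Equal signs give C = s; opposite signs would make q - 1 divide 2.
    bent⇒circleSum : IsBent f → circleSum ≡ sign (f 0#)
    bent⇒circleSum bent = by-cases (sign-±1 (f 0#)) (i*i≡j*j⇒i≡±j (W f 0#) 𝐪 (trans (bent 0#) 𝐪²))
      where
      s = sign (f 0#)
      W₀ : W f 0# ≡ s +ᶻ circleSum *ᶻ (𝐪 -ᶻ + 1)
      W₀ = trans (W-formula 0#) (trans (cong (λ z → s -ᶻ circleSum +ᶻ 𝐪 *ᶻ z) ∑U-at-0) (ring s circleSum 𝐪))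
        where
        ring : ∀ s c q → s -ᶻ c +ᶻ q *ᶻ c ≡ s +ᶻ c *ᶻ (q -ᶻ + 1)
        ring = solve-∀
      eqn : ∀ {σ w} → s ≡ σ → W f 0# ≡ w → circleSum *ᶻ (𝐪 -ᶻ + 1) ≡ w -ᶻ σ
      eqn refl refl = trans (ring s (circleSum *ᶻ (𝐪 -ᶻ + 1))) (cong (_-ᶻ s) (sym W₀))
        where
        ring : ∀ s c → c ≡ (s +ᶻ c) -ᶻ s
        ring = solve-∀
      by-cases : s ≡ + 1 ⊎ s ≡ -[1+ 0 ] → W f 0# ≡ 𝐪 ⊎ W f 0# ≡ -ᶻ 𝐪 → circleSum ≡ s
      by-cases (inj₁ s≡) (inj₁ w≡) = trans (cancel-𝐪-1 (trans (eqn s≡ w≡) (sym (ℤ.*-identityˡ (𝐪 -ᶻ + 1))))) (sym s≡)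
      by-cases (inj₂ s≡) (inj₂ w≡) = trans (cancel-𝐪-1 (trans (eqn s≡ w≡) (ring 𝐪))) (sym s≡)
        where
        ring : ∀ q → -ᶻ q -ᶻ -[1+ 0 ] ≡ -[1+ 0 ] *ᶻ (q -ᶻ + 1)
        ring = solve-∀
      by-cases (inj₁ s≡) (inj₂ w≡) = ⊥-elim ([𝐪-1]*k≢2 (-ᶻ circleSum -ᶻ + 1)
        (trans (ring₁ circleSum 𝐪) (trans (cong (λ z → -ᶻ z -ᶻ (𝐪 -ᶻ + 1)) (eqn s≡ w≡)) (ring₂ 𝐪))))
        where
        ring₁ : ∀ c q → (-ᶻ c -ᶻ + 1) *ᶻ (q -ᶻ + 1) ≡ -ᶻ (c *ᶻ (q -ᶻ + 1)) -ᶻ (q -ᶻ + 1)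
        ring₁ = solve-∀
        ring₂ : ∀ q → -ᶻ (-ᶻ q -ᶻ + 1) -ᶻ (q -ᶻ + 1) ≡ + 2
        ring₂ = solve-∀
      by-cases (inj₂ s≡) (inj₁ w≡) = ⊥-elim ([𝐪-1]*k≢2 (circleSum -ᶻ + 1)
        (trans (ring₁ circleSum 𝐪) (trans (cong (λ z → z -ᶻ (𝐪 -ᶻ + 1)) (eqn s≡ w≡)) (ring₂ 𝐪))))
        where
        ring₁ : ∀ c q → (c -ᶻ + 1) *ᶻ (q -ᶻ + 1) ≡ c *ᶻ (q -ᶻ + 1) -ᶻ (q -ᶻ + 1)
        ring₁ = solve-∀
        ring₂ : ∀ q → (q -ᶻ -[1+ 0 ]) -ᶻ (q -ᶻ + 1) ≡ + 2
        ring₂ = solve-∀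

    -- The first two terms of `W-formula` cancel, leaving q times a single sign: that of f(0) when ω
    -- = 0, and that of g at ω/ω̄ otherwise.
    circleSum⇒bent : circleSum ≡ sign (f 0#) → IsBent f
    circleSum⇒bent e ω = let v , Wω≡ = value (ω ≟ 0#) in begin
      W f ω *ᶻ W f ω                        ≡⟨ cong₂ _*ᶻ_ Wω≡ Wω≡ ⟩
      𝐪 *ᶻ sign v *ᶻ (𝐪 *ᶻ sign v)          ≡⟨ ring₁ 𝐪 (sign v) ⟩
      𝐪 *ᶻ 𝐪 *ᶻ (sign v *ᶻ sign v)          ≡⟨ cong (𝐪 *ᶻ 𝐪 *ᶻ_) (sign² v) ⟩
      𝐪 *ᶻ 𝐪 *ᶻ + 1                         ≡⟨ ℤ.*-identityʳ (𝐪 *ᶻ 𝐪) ⟩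
      𝐪 *ᶻ 𝐪                                ≡⟨ 𝐪² ⟨
      + (2 ℕ.^ (2 ℕ.* n))                   ∎
      where
      ring₁ : ∀ a b → a *ᶻ b *ᶻ (a *ᶻ b) ≡ a *ᶻ a *ᶻ (b *ᶻ b)
      ring₁ = solve-∀
      ring₂ : ∀ a b → a -ᶻ a +ᶻ b ≡ b
      ring₂ = solve-∀
      sign² : ∀ v → sign v *ᶻ sign v ≡ + 1
      sign² v = [ (λ p → cong₂ _*ᶻ_ p p) , (λ p → cong₂ _*ᶻ_ p p) ]′ (sign-±1 v)
      reduce : ∀ {z} → ∑U (λ u → ⟦ conj ω * u ≟ ω ⟧ *ᶻ sign (g u)) ≡ z → W f ω ≡ 𝐪 *ᶻ z
      reduce {z} p = trans (W-formula ω) (trans (cong₂ (λ a b → sign (f 0#) -ᶻ a +ᶻ 𝐪 *ᶻ b) e p) (ring₂ (sign (f 0#)) (𝐪 *ᶻ z)))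
      value : Dec (ω ≡ 0#) → ∃ λ v → W f ω ≡ 𝐪 *ᶻ sign v
      value (yes refl) = f 0# , reduce (trans ∑U-at-0 e)
      value (no ω≢0)   = let u , p = ∑U-at-≢0 ω≢0 in g u , reduce p

-- The sums S(a), and their evaluation for b on the circle.

module OnCircle (n : ℕ) (2≤n : 2 ≤ n) (K : GF2 (2 ℕ.* n)) where
  open Walsh n 2≤n K public
  open ≡-Reasoning

  S : F → F → ℤ
  S a b = ∑U (λ u → χ (a * inv (u + b)))

  product-sum : ∀ a₁ a₂ b → + 2 *ᶻ ∑U (λ u → sign (Tr₁²ⁿ (a₁ * inv (u + b)) * Tr₁²ⁿ (a₂ * inv (u + b))))
                ≡ 𝐪 +ᶻ + 1 +ᶻ S a₁ b +ᶻ S a₂ b -ᶻ S (a₁ + a₂) b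
  product-sum a₁ a₂ b = begin
    + 2 *ᶻ ∑U (λ u → sign (t₁ u * t₂ u))                                              ≡⟨ ∑U-* (+ 2) (λ u → sign (t₁ u * t₂ u)) ⟨
    ∑U (λ u → + 2 *ᶻ sign (t₁ u * t₂ u))                                              ≡⟨ ∑U-cong (λ u _ → sign-* (Tr₁²ⁿ-Bit _) (Tr₁²ⁿ-Bit _)) ⟩
    ∑U (λ u → + 1 +ᶻ sign (t₁ u) +ᶻ sign (t₂ u) -ᶻ sign (t₁ u + t₂ u))                ≡⟨ ∑U-- (λ u → + 1 +ᶻ sign (t₁ u) +ᶻ sign (t₂ u)) (λ u → sign (t₁ u + t₂ u)) ⟩
    ∑U (λ u → + 1 +ᶻ sign (t₁ u) +ᶻ sign (t₂ u)) -ᶻ ∑U (λ u → sign (t₁ u + t₂ u))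
      ≡⟨ cong₂ _-ᶻ_ (trans (∑U-+ (λ u → + 1 +ᶻ sign (t₁ u)) (λ u → sign (t₂ u))) (cong (_+ᶻ S a₂ b) (trans (∑U-+ (λ _ → + 1) (λ u → sign (t₁ u))) (cong (_+ᶻ S a₁ b) card-U))))
           (∑U-cong (λ u _ → cong sign (trans (sym (TrGen-+ (2 ℕ.* n) _ _)) (cong Tr₁²ⁿ (sym (distribʳ (inv (u + b)) a₁ a₂)))))) ⟩
    𝐪 +ᶻ + 1 +ᶻ S a₁ b +ᶻ S a₂ b -ᶻ S (a₁ + a₂) b                                     ∎
    where
    t₁ t₂ : F → F
    t₁ u = Tr₁²ⁿ (a₁ * inv (u + b))
    t₂ u = Tr₁²ⁿ (a₂ * inv (u + b))

  -- The substitution y = 1/(u + b) with 1/0 = 0 permutes the whole field, so the pole u = b is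
  -- carried along as y = 0.
  S-reindex : ∀ a b → S a b ≡ ∑ (λ y → ⟦ inU? (inv y + b) ⟧ *ᶻ χ (a * y))
  S-reindex a b = begin
    ∑ (λ u → ⟦ inU? u ⟧ *ᶻ χ (a * inv (u + b)))                     ≡⟨ ∑-translate _ b ⟩
    ∑ (λ x → ⟦ inU? (x + b) ⟧ *ᶻ χ (a * inv (x + b + b)))           ≡⟨ ∑-reindex _ inv inv inv-involutive inv-involutive ⟩
    ∑ (λ y → ⟦ inU? (inv y + b) ⟧ *ᶻ χ (a * inv (inv y + b + b)))   ≡⟨ ∑-cong (λ y → cong (λ z → ⟦ inU? (inv y + b) ⟧ *ᶻ χ (a * z))
                                                                        (trans (cong inv (solve 2 (λ x b → x :+ b :+ b := x) refl (inv y) b)) (inv-involutive y))) ⟩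
    ∑ (λ y → ⟦ inU? (inv y + b) ⟧ *ᶻ χ (a * y))                     ∎

  norm : F → F
  norm x = x * conj x

  norm-* : ∀ x y → norm (x * y) ≡ norm x * norm y
  norm-* x y = trans (cong (x * y *_) (conj-* x y))
    (solve 4 (λ u v a b → u :* v :* (a :* b) := u :* a :* (v :* b)) refl x y (conj x) (conj y))

  norm-≢0 : ∀ {x} → x ≢ 0# → norm x ≢ 0#
  norm-≢0 x≢0 = *-≢0 x≢0 (conj-≢0 x≢0)

  module _ {b y : F} (y≢0 : y ≢ 0#) where
    -- Clearing the denominator, y(1/y + b) = 1 + by, turns membership of 1/y + b in U into a
    -- polynomial condition on y.
    norm-clear : norm y * norm (inv y + b) ≡ norm (1# + b * y)
    norm-clear = trans (sym (norm-* y (inv y + b))) (cong norm (trans (distribˡ y (inv y) b) (cong₂ _+_ (inv-r y y≢0) (*-comm y b))))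

    inv+b-InU⇒ : InU (inv y + b) → norm (1# + b * y) ≡ norm y
    inv+b-InU⇒ i = trans (sym norm-clear) (trans (cong (norm y *_) i) (*-identityʳ _))

    inv+b-InU⇐ : norm (1# + b * y) ≡ norm y → InU (inv y + b)
    inv+b-InU⇐ e = *-cancelˡ (norm-≢0 y≢0) (trans norm-clear (trans e (sym (*-identityʳ _))))

  norm-1+ : ∀ x → norm (1# + x) ≡ 1# + x + conj x + norm x
  norm-1+ x = trans (cong ((1# + x) *_) (trans (conj-+ 1# x) (cong (_+ conj x) conj-1#)))
    (solve 2 (λ x y → (con true :+ x) :* (con true :+ y) := con true :+ x :+ y :+ x :* y) refl x (conj x))

  d : F
  d = θ + conj θ

  d≢0 : d ≢ 0#
  d≢0 e = 0≢1 (trans (sym (trans (cong Tr₁ⁿ e) (TrGen-0# n))) (trans (sym (Tr₁²ⁿ-tower θ)) Tr₁²ⁿ-θ))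

  -- Base point of the affine line w + w̄ = 1, which is τ + 𝔽q.
  τ : F
  τ = inv d * θ

  τ+τ̄≡1 : τ + conj τ ≡ 1#
  τ+τ̄≡1 = begin
    inv d * θ + conj (inv d * θ)    ≡⟨ cong (λ z → inv d * θ + z) (trans (conj-* (inv d) θ) (cong (_* conj θ) (trans (conj-inv d) (cong inv (conj-trace θ))))) ⟩
    inv d * θ + inv d * conj θ      ≡⟨ distribˡ (inv d) θ (conj θ) ⟨
    inv d * d                       ≡⟨ inv-l d≢0 ⟩
    1#                              ∎

  -- The sum of χ(cw) over the line w + w̄ = 1, divided by q. It vanishes unless c ∈ 𝔽q, in which
  -- case χ(cw) is constant on the line and Tr(cτ) descends to the trace of c from 𝔽q.
  ε : F → ℤ
  ε c = ⟦ conj c ≟ c ⟧ *ᶻ sign (Tr₁ⁿ c)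

  trace-1-sum : ∀ c → ∑ (λ w → ⟦ w + conj w ≟ 1# ⟧ *ᶻ χ (c * w)) ≡ 𝐪 *ᶻ ε c
  trace-1-sum c = begin
    ∑ (λ w → ⟦ w + conj w ≟ 1# ⟧ *ᶻ χ (c * w))                          ≡⟨ ∑-translate _ τ ⟩
    ∑ (λ y → ⟦ (y + τ) + conj (y + τ) ≟ 1# ⟧ *ᶻ χ (c * (y + τ)))        ≡⟨ ∑-cong shift ⟩
    ∑ (λ y → χ (c * τ) *ᶻ (⟦ conj y ≟ y ⟧ *ᶻ χ (c * y)))                ≡⟨ ∑-* (χ (c * τ)) (λ y → ⟦ conj y ≟ y ⟧ *ᶻ χ (c * y)) ⟩
    χ (c * τ) *ᶻ ∑ (λ y → ⟦ conj y ≟ y ⟧ *ᶻ χ (c * y))                  ≡⟨ cong (χ (c * τ) *ᶻ_) (subfield-sum c) ⟩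
    χ (c * τ) *ᶻ (𝐪 *ᶻ ⟦ conj c ≟ c ⟧)                                  ≡⟨ ring₁ (χ (c * τ)) 𝐪 ⟦ conj c ≟ c ⟧ ⟩
    𝐪 *ᶻ (⟦ conj c ≟ c ⟧ *ᶻ χ (c * τ))                                  ≡⟨ cong (𝐪 *ᶻ_) (⟦⟧-guard (conj c ≟ c) (λ e → cong sign (Tr-cτ e))) ⟩
    𝐪 *ᶻ ε c                                                            ∎
    where
    ring₁ : ∀ a b c → a *ᶻ (b *ᶻ c) ≡ b *ᶻ (c *ᶻ a)
    ring₁ = solve-∀
    ring₂ : ∀ a b c → a *ᶻ (b *ᶻ c) ≡ c *ᶻ (a *ᶻ b)
    ring₂ = solve-∀
    Tr-cτ : conj c ≡ c → Tr₁²ⁿ (c * τ) ≡ Tr₁ⁿ c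
    Tr-cτ e = trans (Tr₁²ⁿ-tower (c * τ)) (cong Tr₁ⁿ (begin
      c * τ + conj (c * τ)   ≡⟨ cong (λ z → c * τ + z) (trans (conj-* c τ) (cong (_* conj τ) e)) ⟩
      c * τ + c * conj τ     ≡⟨ distribˡ c τ (conj τ) ⟨
      c * (τ + conj τ)       ≡⟨ cong (c *_) τ+τ̄≡1 ⟩
      c * 1#                 ≡⟨ *-identityʳ c ⟩
      c                      ∎))
    trace-shift : ∀ y → (y + τ) + conj (y + τ) ≡ y + conj y + 1#
    trace-shift y = begin
      (y + τ) + conj (y + τ)           ≡⟨ cong (λ z → (y + τ) + z) (conj-+ y τ) ⟩
      (y + τ) + (conj y + conj τ)      ≡⟨ solve 4 (λ a b c e → (a :+ b) :+ (c :+ e) := a :+ c :+ (b :+ e)) refl y τ (conj y) (conj τ) ⟩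
      y + conj y + (τ + conj τ)        ≡⟨ cong (λ z → y + conj y + z) τ+τ̄≡1 ⟩
      y + conj y + 1#                  ∎
    shift : ∀ y → ⟦ (y + τ) + conj (y + τ) ≟ 1# ⟧ *ᶻ χ (c * (y + τ)) ≡ χ (c * τ) *ᶻ (⟦ conj y ≟ y ⟧ *ᶻ χ (c * y))
    shift y = trans (cong₂ _*ᶻ_
      (⟦⟧-cong ((y + τ) + conj (y + τ) ≟ 1#) (conj y ≟ y)
        (λ e → sym (+≡0⇒≡ (trans (solve 1 (λ a → a := a :+ con true :+ con true) refl (y + conj y))
                     (≡⇒+≡0 (trans (sym (trace-shift y)) e)))))
        (λ e → trans (trace-shift y) (trans (cong (_+ 1#) (≡⇒+≡0 (sym e))) (+-identityˡ 1#))))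
      (trans (cong χ (distribˡ c y τ)) (χ-+ (c * y) (c * τ))))
      (ring₂ ⟦ conj y ≟ y ⟧ (χ (c * y)) (χ (c * τ)))

  module _ {b : F} (b∈U : InU b) where

    -- u = b contributes 1, and u ↦ b / (u + b) maps U ∖ {b} onto {w : w + w̄ = 1}.
    S-on-circle : ∀ a → S a b ≡ + 1 +ᶻ 𝐪 *ᶻ ε (a * conj b)
    S-on-circle a = begin
      S a b                                                                          ≡⟨ S-reindex a b ⟩
      ∑ (λ y → ⟦ inU? (inv y + b) ⟧ *ᶻ χ (a * y))                                    ≡⟨ ∑-cong (λ y → trans (cong (_*ᶻ χ (a * y)) (split y (y ≟ 0#))) (ℤ.*-distribʳ-+ (χ (a * y)) ⟦ y ≟ 0# ⟧ ⟦ b * y + conj (b * y) ≟ 1# ⟧)) ⟩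
      ∑ (λ y → ⟦ y ≟ 0# ⟧ *ᶻ χ (a * y) +ᶻ ⟦ b * y + conj (b * y) ≟ 1# ⟧ *ᶻ χ (a * y)) ≡⟨ ∑-+ (λ y → ⟦ y ≟ 0# ⟧ *ᶻ χ (a * y)) (λ y → ⟦ b * y + conj (b * y) ≟ 1# ⟧ *ᶻ χ (a * y)) ⟩
      ∑ (λ y → ⟦ y ≟ 0# ⟧ *ᶻ χ (a * y)) +ᶻ ∑ (λ y → ⟦ b * y + conj (b * y) ≟ 1# ⟧ *ᶻ χ (a * y))
        ≡⟨ cong₂ _+ᶻ_ (trans (∑-δ (λ y → χ (a * y)) 0#) (trans (cong χ (zeroʳ a)) χ-0#)) (begin
        ∑ (λ y → ⟦ b * y + conj (b * y) ≟ 1# ⟧ *ᶻ χ (a * y))                                                  ≡⟨ ∑-scale _ (conj-≢0 (*≡1⇒≢0 b∈U)) ⟩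
        ∑ (λ w → ⟦ b * (conj b * w) + conj (b * (conj b * w)) ≟ 1# ⟧ *ᶻ χ (a * (conj b * w)))                 ≡⟨ ∑-cong (λ w → cong₂ (λ s t → ⟦ s + conj s ≟ 1# ⟧ *ᶻ χ t)
                                                                                                                (trans (sym (*-assoc b (conj b) w)) (trans (cong (_* w) b∈U) (*-identityˡ w))) (sym (*-assoc a (conj b) w))) ⟩
        ∑ (λ w → ⟦ w + conj w ≟ 1# ⟧ *ᶻ χ (a * conj b * w))                                                   ≡⟨ trace-1-sum (a * conj b) ⟩
        𝐪 *ᶻ ε (a * conj b)                                                                                   ∎) ⟩
      + 1 +ᶻ 𝐪 *ᶻ ε (a * conj b)                                                     ∎
      where
      split : ∀ y → Dec (y ≡ 0#) → ⟦ inU? (inv y + b) ⟧ ≡ ⟦ y ≟ 0# ⟧ +ᶻ ⟦ b * y + conj (b * y) ≟ 1# ⟧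
      split y (yes refl) = trans (⟦⟧-yes (inU? (inv 0# + b)) (subst InU (sym (trans (cong (_+ b) inv-0) (+-identityˡ b))) b∈U))
        (sym (cong₂ _+ᶻ_ (⟦⟧-yes (0# ≟ 0#) refl) (⟦⟧-no (b * 0# + conj (b * 0#) ≟ 1#) λ e → 0≢1 (begin
          0#                          ≡⟨ +-identityˡ 0# ⟨
          0# + 0#                     ≡⟨ cong₂ _+_ (zeroʳ b) (trans (cong conj (zeroʳ b)) conj-0#) ⟨
          b * 0# + conj (b * 0#)      ≡⟨ e ⟩
          1#                          ∎))))
      split y (no y≢0) = trans (⟦⟧-cong (inU? (inv y + b)) (b * y + conj (b * y) ≟ 1#)
          (λ i → sym (+≡0⇒≡ (begin
            1# + (b * y + conj (b * y))                    ≡⟨ solve 3 (λ p r m → con true :+ (p :+ r) := con true :+ p :+ r :+ m :+ m) refl (b * y) (conj (b * y)) (norm y) ⟩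
            1# + b * y + conj (b * y) + norm y + norm y    ≡⟨ cong (_+ norm y) (trans (sym norm-by) (inv+b-InU⇒ y≢0 i)) ⟩
            norm y + norm y                                ≡⟨ x+x≡0 (norm y) ⟩
            0#                                             ∎)))
          (λ e → inv+b-InU⇐ y≢0 (trans norm-by (begin
            1# + b * y + conj (b * y) + norm y             ≡⟨ solve 3 (λ p r m → con true :+ p :+ r :+ m := con true :+ (p :+ r) :+ m) refl (b * y) (conj (b * y)) (norm y) ⟩
            1# + (b * y + conj (b * y)) + norm y           ≡⟨ cong (λ z → 1# + z + norm y) e ⟩
            1# + 1# + norm y                               ≡⟨ solve 1 (λ m → con true :+ con true :+ m := m) refl (norm y) ⟩
            norm y                                         ∎))))
        (trans (sym (ℤ.+-identityˡ ⟦ b * y + conj (b * y) ≟ 1# ⟧)) (cong (_+ᶻ ⟦ b * y + conj (b * y) ≟ 1# ⟧) (sym (⟦⟧-no (y ≟ 0#) y≢0))))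
        where
        norm-by : norm (1# + b * y) ≡ 1# + b * y + conj (b * y) + norm y
        norm-by = trans (norm-1+ (b * y)) (cong (λ z → 1# + b * y + conj (b * y) + z) (trans (norm-* b y) (trans (cong (_* norm y) b∈U) (*-identityˡ _))))

    -- Twice the circle sum is 2 + qE, so on the circle bentness amounts to E = 0 together with
    -- h₂(0) = 0.
    E : F → F → ℤ
    E a₁ a₂ = + 1 +ᶻ ε (a₁ * conj b) +ᶻ ε (a₂ * conj b) -ᶻ ε ((a₁ + a₂) * conj b)

    product-sum-on-circle : ∀ a₁ a₂ →
      + 2 *ᶻ ∑U (λ u → sign (Tr₁²ⁿ (a₁ * inv (u + b)) * Tr₁²ⁿ (a₂ * inv (u + b)))) ≡ + 2 +ᶻ 𝐪 *ᶻ E a₁ a₂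
    product-sum-on-circle a₁ a₂ = trans (product-sum a₁ a₂ b)
      (trans (cong₂ _-ᶻ_ (cong₂ _+ᶻ_ (cong (𝐪 +ᶻ + 1 +ᶻ_) (S-on-circle a₁)) (S-on-circle a₂)) (S-on-circle (a₁ + a₂)))
        (ring 𝐪 (ε (a₁ * conj b)) (ε (a₂ * conj b)) (ε ((a₁ + a₂) * conj b))))
      where
      ring : ∀ q x y z → q +ᶻ + 1 +ᶻ (+ 1 +ᶻ q *ᶻ x) +ᶻ (+ 1 +ᶻ q *ᶻ y) -ᶻ (+ 1 +ᶻ q *ᶻ z) ≡ + 2 +ᶻ q *ᶻ (+ 1 +ᶻ x +ᶻ y -ᶻ z)
      ring = solve-∀

-- The sums σ(c) for b off the circle, with their second and fourth moments.

module Kloosterman (n : ℕ) (2≤n : 2 ≤ n) (K : GF2 (2 ℕ.* n)) where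
  open OnCircle n 2≤n K public
  open ≡-Reasoning

  σ : F → ℤ
  σ c = ∑U (λ v → χ (c * v))

  module _ {b : F} (b∉U : ¬ InU b) where

    N : F
    N = norm b + 1#

    N≢0 : N ≢ 0#
    N≢0 e = b∉U (+≡0⇒≡ e)

    -- The Möbius map u ↦ 1 / (u + b) sends U to the circle {(v + b̄) / N : v ∈ U}.
    S-off-circle : ∀ a → S a b ≡ χ (a * (inv N * conj b)) *ᶻ σ (a * inv N)
    S-off-circle a = begin
      S a b                                                                               ≡⟨ S-reindex a b ⟩
      ∑ (λ y → ⟦ inU? (inv y + b) ⟧ *ᶻ χ (a * y))                                         ≡⟨ ∑-cong (λ y → cong (_*ᶻ χ (a * y)) (möbius y (y ≟ 0#))) ⟩
      ∑ (λ y → ⟦ inU? (N * y + conj b) ⟧ *ᶻ χ (a * y))                                    ≡⟨ ∑-scale _ (inv-≢0 N≢0) ⟩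
      ∑ (λ x → ⟦ inU? (N * (inv N * x) + conj b) ⟧ *ᶻ χ (a * (inv N * x)))                ≡⟨ ∑-cong (λ x → cong (λ z → ⟦ inU? (z + conj b) ⟧ *ᶻ χ (a * (inv N * x))) (*-inverseˡ N≢0 x)) ⟩
      ∑ (λ x → ⟦ inU? (x + conj b) ⟧ *ᶻ χ (a * (inv N * x)))                              ≡⟨ ∑-translate _ (conj b) ⟩
      ∑ (λ v → ⟦ inU? (v + conj b + conj b) ⟧ *ᶻ χ (a * (inv N * (v + conj b))))          ≡⟨ ∑-cong shift ⟩
      ∑ (λ v → χ (a * (inv N * conj b)) *ᶻ (⟦ inU? v ⟧ *ᶻ χ (a * inv N * v)))             ≡⟨ ∑-* (χ (a * (inv N * conj b))) (λ v → ⟦ inU? v ⟧ *ᶻ χ (a * inv N * v)) ⟩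
      χ (a * (inv N * conj b)) *ᶻ σ (a * inv N)                                           ∎
      where
      ring : ∀ x y z → x *ᶻ (y *ᶻ z) ≡ z *ᶻ (x *ᶻ y)
      ring = solve-∀
      shift : ∀ v → ⟦ inU? (v + conj b + conj b) ⟧ *ᶻ χ (a * (inv N * (v + conj b))) ≡ χ (a * (inv N * conj b)) *ᶻ (⟦ inU? v ⟧ *ᶻ χ (a * inv N * v))
      shift v = begin
        ⟦ inU? (v + conj b + conj b) ⟧ *ᶻ χ (a * (inv N * (v + conj b)))
          ≡⟨ cong₂ (λ s t → ⟦ inU? s ⟧ *ᶻ χ t) (solve 2 (λ v c → v :+ c :+ c := v) refl v (conj b))
                   (solve 4 (λ a i v c → a :* (i :* (v :+ c)) := a :* i :* v :+ a :* (i :* c)) refl a (inv N) v (conj b)) ⟩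
        ⟦ inU? v ⟧ *ᶻ χ (a * inv N * v + a * (inv N * conj b))
          ≡⟨ cong (⟦ inU? v ⟧ *ᶻ_) (χ-+ _ _) ⟩
        ⟦ inU? v ⟧ *ᶻ (χ (a * inv N * v) *ᶻ χ (a * (inv N * conj b)))
          ≡⟨ ring ⟦ inU? v ⟧ (χ (a * inv N * v)) (χ (a * (inv N * conj b))) ⟩
        χ (a * (inv N * conj b)) *ᶻ (⟦ inU? v ⟧ *ᶻ χ (a * inv N * v)) ∎

      conj-N : conj N ≡ N
      conj-N = trans (conj-+ (norm b) 1#) (cong₂ _+_ (conj-norm b) conj-1#)

      -- An expansion in b, b̄, y, ȳ. Since N ≠ 0, one side vanishes exactly when the other does,
      -- which matches Ny + b̄ ∈ U with 1/y + b ∈ U.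
      identity : ∀ y → norm (N * y + conj b) + 1# ≡ N * (norm (1# + b * y) + norm y)
      identity y = begin
        norm (N * y + conj b) + 1#
          ≡⟨ cong (λ z → (N * y + conj b) * z + 1#) (trans (conj-+ (N * y) (conj b)) (cong₂ _+_ (trans (conj-* N y) (cong (_* conj y) conj-N)) (conj-involutive b))) ⟩
        (N * y + conj b) * (N * conj y + b) + 1#
          ≡⟨ solve 4 (λ b b̄ y ȳ → ((b :* b̄ :+ con true) :* y :+ b̄) :* ((b :* b̄ :+ con true) :* ȳ :+ b) :+ con true
                               := (b :* b̄ :+ con true) :* ((con true :+ b :* y) :* (con true :+ b̄ :* ȳ) :+ y :* ȳ)) refl b (conj b) y (conj y) ⟩
        N * ((1# + b * y) * (1# + conj b * conj y) + norm y)
          ≡⟨ cong (λ z → N * ((1# + b * y) * z + norm y)) (trans (conj-+ 1# (b * y)) (cong₂ _+_ conj-1# (conj-* b y))) ⟨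
        N * (norm (1# + b * y) + norm y) ∎

      möbius : ∀ y → Dec (y ≡ 0#) → ⟦ inU? (inv y + b) ⟧ ≡ ⟦ inU? (N * y + conj b) ⟧
      -- At y = 0 the two points are b and b̄ by the convention 1/0 = 0, and neither of them lies in
      -- U.
      möbius y (yes refl) = trans (⟦⟧-no (inU? (inv 0# + b)) (λ i → b∉U (subst InU (trans (cong (_+ b) inv-0) (+-identityˡ b)) i)))
        (sym (⟦⟧-no (inU? (N * 0# + conj b)) λ i → b∉U (subst InU (conj-involutive b)
          (InU-conj (subst InU (trans (cong (_+ conj b) (zeroʳ N)) (+-identityˡ (conj b))) i)))))
      möbius y (no y≢0) = ⟦⟧-cong (inU? (inv y + b)) (inU? (N * y + conj b))
        (λ i → +≡0⇒≡ (trans (identity y) (trans (cong (N *_) (≡⇒+≡0 (inv+b-InU⇒ y≢0 i))) (zeroʳ N))))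
        (λ i → inv+b-InU⇐ y≢0 (+≡0⇒≡ (*-cancelˡ-0 N≢0 (trans (sym (identity y)) (≡⇒+≡0 i)))))

  InU-*⇔ : ∀ {u} → InU u → ∀ v → ⟦ inU? (u * v) ⟧ ≡ ⟦ inU? v ⟧
  InU-*⇔ {u} i v = ⟦⟧-cong (inU? (u * v)) (inU? v)
    (λ j → trans (sym (*-identityˡ _)) (trans (cong (_* norm v) (sym i)) (trans (sym (norm-* u v)) j))) (InU-* i)

  σ-U-invariant : ∀ c {u} → InU u → σ (c * u) ≡ σ c
  σ-U-invariant c {u} i = sym (trans (∑-scale (λ v → ⟦ inU? v ⟧ *ᶻ χ (c * v)) (*≡1⇒≢0 i))
    (∑-cong λ v → cong₂ (λ s t → s *ᶻ χ t) (InU-*⇔ i v) (sym (*-assoc c u v))))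

  σ-0# : σ 0# ≡ 𝐪 +ᶻ + 1
  σ-0# = trans (∑U-cong λ v _ → trans (cong χ (zeroˡ v)) χ-0#) card-U

  -- After expanding the square and summing over c first, orthogonality keeps only the diagonal. It
  -- is applied to the indicator of U for the second moment and to `reps` for the fourth.
  parseval : ∀ (r : F → ℤ) → ∑ (λ c → ∑ (λ s → r s *ᶻ χ (c * s)) *ᶻ ∑ (λ s → r s *ᶻ χ (c * s))) ≡ 𝐪 *ᶻ 𝐪 *ᶻ ∑ (λ s → r s *ᶻ r s)
  parseval r = begin
    ∑ (λ c → ∑ (λ s → r s *ᶻ χ (c * s)) *ᶻ ∑ (λ s → r s *ᶻ χ (c * s)))          ≡⟨ ∑-cong (λ c → ∑-product (λ s → r s *ᶻ χ (c * s)) (λ s → r s *ᶻ χ (c * s))) ⟩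
    ∑ (λ c → ∑ (λ s → ∑ (λ t → r s *ᶻ χ (c * s) *ᶻ (r t *ᶻ χ (c * t)))))        ≡⟨ ∑-swap _ ⟩
    ∑ (λ s → ∑ (λ c → ∑ (λ t → r s *ᶻ χ (c * s) *ᶻ (r t *ᶻ χ (c * t)))))        ≡⟨ ∑-cong (λ s → ∑-swap _) ⟩
    ∑ (λ s → ∑ (λ t → ∑ (λ c → r s *ᶻ χ (c * s) *ᶻ (r t *ᶻ χ (c * t)))))        ≡⟨ ∑-cong (λ s → ∑-cong (inner s)) ⟩
    ∑ (λ s → ∑ (λ t → ⟦ t ≟ s ⟧ *ᶻ (𝐪 *ᶻ 𝐪 *ᶻ (r s *ᶻ r t))))                   ≡⟨ ∑-cong (λ s → ∑-δ (λ t → 𝐪 *ᶻ 𝐪 *ᶻ (r s *ᶻ r t)) s) ⟩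
    ∑ (λ s → 𝐪 *ᶻ 𝐪 *ᶻ (r s *ᶻ r s))                                            ≡⟨ ∑-* (𝐪 *ᶻ 𝐪) (λ s → r s *ᶻ r s) ⟩
    𝐪 *ᶻ 𝐪 *ᶻ ∑ (λ s → r s *ᶻ r s)                                              ∎
    where
    ring₁ : ∀ a b c d → a *ᶻ b *ᶻ (c *ᶻ d) ≡ a *ᶻ c *ᶻ (b *ᶻ d)
    ring₁ = solve-∀
    ring₂ : ∀ a b c → a *ᶻ (b *ᶻ c) ≡ c *ᶻ (b *ᶻ a)
    ring₂ = solve-∀
    inner : ∀ s t → ∑ (λ c → r s *ᶻ χ (c * s) *ᶻ (r t *ᶻ χ (c * t))) ≡ ⟦ t ≟ s ⟧ *ᶻ (𝐪 *ᶻ 𝐪 *ᶻ (r s *ᶻ r t))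
    inner s t = begin
      ∑ (λ c → r s *ᶻ χ (c * s) *ᶻ (r t *ᶻ χ (c * t)))
        ≡⟨ ∑-cong (λ c → trans (ring₁ (r s) (χ (c * s)) (r t) (χ (c * t)))
             (cong (r s *ᶻ r t *ᶻ_) (trans (sym (χ-+ (c * s) (c * t))) (cong χ (solve 3 (λ c s t → c :* s :+ c :* t := (s :+ t) :* c) refl c s t))))) ⟩
      ∑ (λ c → r s *ᶻ r t *ᶻ χ ((s + t) * c))
        ≡⟨ ∑-* (r s *ᶻ r t) (λ c → χ ((s + t) * c)) ⟩
      r s *ᶻ r t *ᶻ ∑ (λ c → χ ((s + t) * c))
        ≡⟨ cong (r s *ᶻ r t *ᶻ_) (trans (orthogonality (s + t)) (cong (𝐪 *ᶻ 𝐪 *ᶻ_)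
             (⟦⟧-cong (s + t ≟ 0#) (t ≟ s) (λ e → sym (+≡0⇒≡ e)) (λ e → ≡⇒+≡0 (sym e))))) ⟩
      r s *ᶻ r t *ᶻ (𝐪 *ᶻ 𝐪 *ᶻ ⟦ t ≟ s ⟧)
        ≡⟨ ring₂ (r s *ᶻ r t) (𝐪 *ᶻ 𝐪) ⟦ t ≟ s ⟧ ⟩
      ⟦ t ≟ s ⟧ *ᶻ (𝐪 *ᶻ 𝐪 *ᶻ (r s *ᶻ r t)) ∎

  pair : F → F → ℤ
  pair s v = ⟦ inU? v ⟧ *ᶻ ⟦ inU? (s + v) ⟧

  -- The number of ordered ways to write s as a sum of two elements of U, hence the coefficients in
  -- the character expansion `σ²`.
  reps : F → ℤ
  reps s = ∑ (pair s)

  σ² : ∀ c → σ c *ᶻ σ c ≡ ∑ (λ s → reps s *ᶻ χ (c * s))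
  σ² c = begin
    σ c *ᶻ σ c                                                                          ≡⟨ ∑-product (λ v → ⟦ inU? v ⟧ *ᶻ χ (c * v)) (λ v → ⟦ inU? v ⟧ *ᶻ χ (c * v)) ⟩
    ∑ (λ v → ∑ (λ w → ⟦ inU? v ⟧ *ᶻ χ (c * v) *ᶻ (⟦ inU? w ⟧ *ᶻ χ (c * w))))            ≡⟨ ∑-cong (λ v → ∑-translate _ v) ⟩
    ∑ (λ v → ∑ (λ s → ⟦ inU? v ⟧ *ᶻ χ (c * v) *ᶻ (⟦ inU? (s + v) ⟧ *ᶻ χ (c * (s + v))))) ≡⟨ ∑-cong (λ v → ∑-cong (λ s → combine s v)) ⟩
    ∑ (λ v → ∑ (λ s → pair s v *ᶻ χ (c * s)))                                           ≡⟨ ∑-swap _ ⟩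
    ∑ (λ s → ∑ (λ v → pair s v *ᶻ χ (c * s)))                                           ≡⟨ ∑-cong (λ s → ∑-*ʳ (χ (c * s)) (pair s)) ⟩
    ∑ (λ s → reps s *ᶻ χ (c * s))                                                       ∎
    where
    ring : ∀ a b c d → a *ᶻ b *ᶻ (c *ᶻ d) ≡ a *ᶻ c *ᶻ (b *ᶻ d)
    ring = solve-∀
    combine : ∀ s v → ⟦ inU? v ⟧ *ᶻ χ (c * v) *ᶻ (⟦ inU? (s + v) ⟧ *ᶻ χ (c * (s + v))) ≡ pair s v *ᶻ χ (c * s)
    combine s v = trans (ring ⟦ inU? v ⟧ (χ (c * v)) ⟦ inU? (s + v) ⟧ (χ (c * (s + v))))
      (cong (pair s v *ᶻ_) (trans (sym (χ-+ (c * v) (c * (s + v)))) (cong χ (solve 3 (λ c s v → c :* v :+ c :* (s :+ v) := c :* s) refl c s v))))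

  ∑σ² : ∑ (λ c → σ c *ᶻ σ c) ≡ 𝐪 *ᶻ 𝐪 *ᶻ (𝐪 +ᶻ + 1)
  ∑σ² = trans (parseval (λ v → ⟦ inU? v ⟧)) (cong (𝐪 *ᶻ 𝐪 *ᶻ_)
    (trans (∑-cong λ v → trans (⟦⟧-idem (inU? v)) (sym (ℤ.*-identityʳ ⟦ inU? v ⟧))) card-U))

  ∑σ⁴ : ∑ (λ c → σ c *ᶻ σ c *ᶻ (σ c *ᶻ σ c)) ≡ 𝐪 *ᶻ 𝐪 *ᶻ ∑ (λ s → reps s *ᶻ reps s)
  ∑σ⁴ = trans (∑-cong λ c → cong₂ _*ᶻ_ (σ² c) (σ² c)) (parseval reps)

  reps-0# : reps 0# ≡ 𝐪 +ᶻ + 1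
  reps-0# = trans (∑-cong λ v → trans (cong (λ z → ⟦ inU? v ⟧ *ᶻ ⟦ inU? z ⟧) (+-identityˡ v))
    (trans (⟦⟧-idem (inU? v)) (sym (ℤ.*-identityʳ ⟦ inU? v ⟧)))) card-U

  ∑reps : ∑ reps ≡ (𝐪 +ᶻ + 1) *ᶻ (𝐪 +ᶻ + 1)
  ∑reps = begin
    ∑ (λ s → ∑ (λ v → pair s v))                      ≡⟨ ∑-swap _ ⟩
    ∑ (λ v → ∑ (λ s → pair s v))                      ≡⟨ ∑-cong (λ v → ∑-* ⟦ inU? v ⟧ (λ s → ⟦ inU? (s + v) ⟧)) ⟩
    ∑U (λ v → ∑ (λ s → ⟦ inU? (s + v) ⟧))             ≡⟨ ∑U-cong (λ v _ → trans (sym (∑-translate (λ s → ⟦ inU? s ⟧) v))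
                                                            (trans (∑-cong λ s → sym (ℤ.*-identityʳ ⟦ inU? s ⟧)) (trans card-U (sym (ℤ.*-identityʳ (𝐪 +ᶻ + 1)))))) ⟩
    ∑U (λ _ → (𝐪 +ᶻ + 1) *ᶻ + 1)                      ≡⟨ ∑U-* (𝐪 +ᶻ + 1) (λ _ → + 1) ⟩
    (𝐪 +ᶻ + 1) *ᶻ ∑U (λ _ → + 1)                      ≡⟨ cong ((𝐪 +ᶻ + 1) *ᶻ_) card-U ⟩
    (𝐪 +ᶻ + 1) *ᶻ (𝐪 +ᶻ + 1)                          ∎

  -- If v and s + v are in U then v is a root of X² + sX + s / s̄, so w = v or w = v + s for any other such w.
  pair-unique : ∀ {s v w} → s ≢ 0# → InU v → InU (s + v) → InU w → InU (s + w) → w ≡ v ⊎ w ≡ v + s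
  pair-unique {s} {v} {w} s≢0 v∈ sv∈ w∈ sw∈ with w ≟ v
  ... | yes p = inj₁ p
  ... | no w≢v = inj₂ (+≡0⇒≡ (*-cancelˡ-0 (λ e → w≢v (+≡0⇒≡ e)) (*-cancelˡ-0 (conj-≢0 s≢0) (begin
      conj s * ((w + v) * (w + (v + s)))                        ≡⟨ solve 4 (λ s̄ s v w → s̄ :* ((w :+ v) :* (w :+ (v :+ s))) := s̄ :* (w :* (s :+ w)) :+ s̄ :* (v :* (s :+ v))) refl (conj s) s v w ⟩
      conj s * (w * (s + w)) + conj s * (v * (s + v))           ≡⟨ cong₂ _+_ (product w∈ sw∈) (product v∈ sv∈) ⟩
      s + s                                                     ≡⟨ x+x≡0 s ⟩
      0#                                                        ∎))))
    where
    product : ∀ {v} → InU v → InU (s + v) → conj s * (v * (s + v)) ≡ s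
    product {v} i j = begin
      conj s * (v * (s + v))                                     ≡⟨ solve 4 (λ s̄ s v v̄ → s̄ :* (v :* (s :+ v)) := v :* ((s :+ v) :* (s̄ :+ v̄)) :+ (s :+ v) :* (v :* v̄)) refl (conj s) s v (conj v) ⟩
      v * ((s + v) * (conj s + conj v)) + (s + v) * (v * conj v) ≡⟨ cong₂ (λ a b → v * a + (s + v) * b) (trans (cong ((s + v) *_) (sym (conj-+ s v))) j) i ⟩
      v * 1# + (s + v) * 1#                                      ≡⟨ solve 2 (λ s v → v :* con true :+ (s :+ v) :* con true := s) refl s v ⟩
      s                                                          ∎

  pair-product-≤ : ∀ {s} → s ≢ 0# → ∀ v w → pair s v *ᶻ pair s w ≤ᶻ ⟦ w ≟ v ⟧ *ᶻ pair s v +ᶻ ⟦ w ≟ v + s ⟧ *ᶻ pair s v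
  pair-product-≤ {s} s≢0 v w with inU? v | inU? (s + v) | inU? w | inU? (s + w) | w ≟ v | w ≟ v + s
  ... | no _  | _     | _     | _     | d     | e     = ℤ.≤-reflexive (sym (trans (cong₂ _+ᶻ_ (ℤ.*-zeroʳ ⟦ d ⟧) (ℤ.*-zeroʳ ⟦ e ⟧)) refl))
  ... | yes _ | no _  | _     | _     | d     | e     = ℤ.≤-reflexive (sym (trans (cong₂ _+ᶻ_ (ℤ.*-zeroʳ ⟦ d ⟧) (ℤ.*-zeroʳ ⟦ e ⟧)) refl))
  ... | yes _ | yes _ | no _  | _     | yes _ | yes _ = ℤ.+≤+ z≤n
  ... | yes _ | yes _ | no _  | _     | yes _ | no _  = ℤ.+≤+ z≤n
  ... | yes _ | yes _ | no _  | _     | no _  | yes _ = ℤ.+≤+ z≤n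
  ... | yes _ | yes _ | no _  | _     | no _  | no _  = ℤ.+≤+ z≤n
  ... | yes _ | yes _ | yes _ | no _  | yes _ | yes _ = ℤ.+≤+ z≤n
  ... | yes _ | yes _ | yes _ | no _  | yes _ | no _  = ℤ.+≤+ z≤n
  ... | yes _ | yes _ | yes _ | no _  | no _  | yes _ = ℤ.+≤+ z≤n
  ... | yes _ | yes _ | yes _ | no _  | no _  | no _  = ℤ.+≤+ z≤n
  ... | yes _ | yes _ | yes _ | yes _ | yes _ | yes _ = ℤ.+≤+ (s≤s z≤n)
  ... | yes _ | yes _ | yes _ | yes _ | yes _ | no _  = ℤ.+≤+ (s≤s z≤n)
  ... | yes _ | yes _ | yes _ | yes _ | no _  | yes _ = ℤ.+≤+ (s≤s z≤n)
  ... | yes p | yes q | yes r | yes t | no ¬d | no ¬e = ⊥-elim ([ ¬d , ¬e ]′ (pair-unique s≢0 p q r t))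

  -- The square counts pairs (v, w) of representations, and by `pair-unique` each v admits at most
  -- the partners v and v + s.
  reps²≤2reps : ∀ {s} → s ≢ 0# → reps s *ᶻ reps s ≤ᶻ + 2 *ᶻ reps s
  reps²≤2reps {s} s≢0 = subst₂ _≤ᶻ_ (sym (∑-product (pair s) (pair s))) (begin
      ∑ (λ v → ∑ (λ w → ⟦ w ≟ v ⟧ *ᶻ pair s v +ᶻ ⟦ w ≟ v + s ⟧ *ᶻ pair s v))
        ≡⟨ ∑-cong (λ v → trans (∑-+ (λ w → ⟦ w ≟ v ⟧ *ᶻ pair s v) (λ w → ⟦ w ≟ v + s ⟧ *ᶻ pair s v))
             (trans (cong₂ _+ᶻ_ (∑-δ (λ _ → pair s v) v) (∑-δ (λ _ → pair s v) (v + s))) (ring (pair s v)))) ⟩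
      ∑ (λ v → + 2 *ᶻ pair s v) ≡⟨ ∑-* (+ 2) (pair s) ⟩
      + 2 *ᶻ reps s ∎)
    (∑-mono λ v → ∑-mono λ w → pair-product-≤ s≢0 v w)
    where
    ring : ∀ a → a +ᶻ a ≡ + 2 *ᶻ a
    ring = solve-∀

  ∑reps²≤ : ∑ (λ s → reps s *ᶻ reps s) ≤ᶻ (𝐪 +ᶻ + 1) *ᶻ (+ 3 *ᶻ 𝐪 +ᶻ + 1)
  ∑reps²≤ = subst (∑ (λ s → reps s *ᶻ reps s) ≤ᶻ_) (begin
      ∑ (λ s → + 2 *ᶻ reps s +ᶻ ⟦ s ≟ 0# ⟧ *ᶻ z)            ≡⟨ ∑-+ (λ s → + 2 *ᶻ reps s) (λ s → ⟦ s ≟ 0# ⟧ *ᶻ z) ⟩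
      ∑ (λ s → + 2 *ᶻ reps s) +ᶻ ∑ (λ s → ⟦ s ≟ 0# ⟧ *ᶻ z)  ≡⟨ cong₂ _+ᶻ_ (trans (∑-* (+ 2) reps) (cong (+ 2 *ᶻ_) ∑reps)) (∑-δ (λ _ → z) 0#) ⟩
      + 2 *ᶻ ((𝐪 +ᶻ + 1) *ᶻ (𝐪 +ᶻ + 1)) +ᶻ z                ≡⟨ ring₁ 𝐪 ⟩
      (𝐪 +ᶻ + 1) *ᶻ (+ 3 *ᶻ 𝐪 +ᶻ + 1)                       ∎)
    (∑-mono λ s → pointwise s (s ≟ 0#))
    where
    z = (𝐪 +ᶻ + 1) *ᶻ (𝐪 +ᶻ + 1) -ᶻ + 2 *ᶻ (𝐪 +ᶻ + 1)
    ring₁ : ∀ q → + 2 *ᶻ ((q +ᶻ + 1) *ᶻ (q +ᶻ + 1)) +ᶻ ((q +ᶻ + 1) *ᶻ (q +ᶻ + 1) -ᶻ + 2 *ᶻ (q +ᶻ + 1)) ≡ (q +ᶻ + 1) *ᶻ (+ 3 *ᶻ q +ᶻ + 1)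
    ring₁ = solve-∀
    ring₂ : ∀ r → r *ᶻ r ≡ + 2 *ᶻ r +ᶻ + 1 *ᶻ (r *ᶻ r -ᶻ + 2 *ᶻ r)
    ring₂ = solve-∀
    pointwise : ∀ s → Dec (s ≡ 0#) → reps s *ᶻ reps s ≤ᶻ + 2 *ᶻ reps s +ᶻ ⟦ s ≟ 0# ⟧ *ᶻ z
    pointwise s (yes refl) = ℤ.≤-reflexive (trans (cong₂ _*ᶻ_ reps-0# reps-0#) (trans (ring₂ (𝐪 +ᶻ + 1))
      (cong₂ (λ r i → + 2 *ᶻ r +ᶻ i *ᶻ z) (sym reps-0#) (sym (⟦⟧-yes (0# ≟ 0#) refl)))))
    pointwise s (no s≢0) = subst (reps s *ᶻ reps s ≤ᶻ_)
      (sym (trans (cong (λ i → + 2 *ᶻ reps s +ᶻ i *ᶻ z) (⟦⟧-no (s ≟ 0#) s≢0)) (ℤ.+-identityʳ (+ 2 *ᶻ reps s)))) (reps²≤2reps s≢0)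

i*i≥0 : ∀ i → + 0 ≤ᶻ i *ᶻ i
i*i≥0 (+ k)      = subst (+ 0 ≤ᶻ_) (ℤ.pos-* k k) (ℤ.+≤+ z≤n)
i*i≥0 (-[1+ k ]) = ℤ.+≤+ z≤n

∣i∣*∣i∣≡i*i : ∀ i → + (ℤ.∣ i ∣ ℕ.* ℤ.∣ i ∣) ≡ i *ᶻ i
∣i∣*∣i∣≡i*i (+ k)      = ℤ.pos-* k k
∣i∣*∣i∣≡i*i (-[1+ k ]) = refl

-- For m < k the left side truncates to 0 while the right side is still a square. This carries
-- bounds on `D` over to natural numbers, where they can be decided.
∸-square-≤ : ∀ m k → + ((m ℕ.∸ k) ℕ.* (m ℕ.∸ k)) ≤ᶻ (+ m -ᶻ + k) *ᶻ (+ m -ᶻ + k)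
∸-square-≤ m k with ℕ.≤-total k m
... | inj₁ k≤m = ℤ.≤-reflexive (trans (ℤ.pos-* (m ℕ.∸ k) (m ℕ.∸ k)) (cong₂ _*ᶻ_ e e))
  where
  e : + (m ℕ.∸ k) ≡ + m -ᶻ + k
  e = sym (trans (ℤ.m-n≡m⊖n m k) (ℤ.⊖-≥ k≤m))
... | inj₂ m≤k = subst (λ z → + (z ℕ.* z) ≤ᶻ (+ m -ᶻ + k) *ᶻ (+ m -ᶻ + k)) (sym (ℕ.m≤n⇒m∸n≡0 m≤k)) (i*i≥0 (+ m -ᶻ + k))

-- Bounds on |σ(c)| from the moments.

module KloostermanBound (n : ℕ) (2≤n : 2 ≤ n) (K : GF2 (2 ℕ.* n)) where
  open Kloosterman n 2≤n K public
  open ≡-Reasoning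

  -- Being a square, it is nonnegative, so an upper bound for its total also bounds the total over
  -- any set of norm classes.
  D : F → ℤ
  D c = (σ c *ᶻ σ c -ᶻ 𝐪) *ᶻ (σ c *ᶻ σ c -ᶻ 𝐪)

  B : ℤ
  B = 𝐪 *ᶻ 𝐪 *ᶻ 𝐪 -ᶻ 𝐪 *ᶻ 𝐪 -ᶻ 𝐪 -ᶻ + 1

  -- The term at 0 is known exactly from σ(0) = q + 1 and equals (q² + q + 1)². It is of order q⁴,
  -- like the bound q²(2q² + 2q + 1) for the full sum, so removing it halves the leading
  -- coefficient.
  ∑D-D₀≤ : ∑ D -ᶻ D 0# ≤ᶻ (𝐪 +ᶻ + 1) *ᶻ B
  ∑D-D₀≤ = subst₂ _≤ᶻ_ (sym lhs) (ring₂ 𝐪)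
    (ℤ.+-monoˡ-≤ (-ᶻ d₀) (ℤ.+-monoˡ-≤ (-ᶻ k) (ℤ.*-monoˡ-≤-nonNeg (𝐪 *ᶻ 𝐪) {{ℤ.nonNegative (i*i≥0 𝐪)}} ∑reps²≤)))
    where
    k d₀ : ℤ
    k  = + 2 *ᶻ 𝐪 *ᶻ (𝐪 *ᶻ 𝐪 *ᶻ (𝐪 +ᶻ + 1)) -ᶻ 𝐪 *ᶻ 𝐪 *ᶻ (𝐪 *ᶻ 𝐪)
    d₀ = ((𝐪 +ᶻ + 1) *ᶻ (𝐪 +ᶻ + 1) -ᶻ 𝐪) *ᶻ ((𝐪 +ᶻ + 1) *ᶻ (𝐪 +ᶻ + 1) -ᶻ 𝐪)
    ring₁ : ∀ s q → (s -ᶻ q) *ᶻ (s -ᶻ q) ≡ s *ᶻ s -ᶻ (+ 2 *ᶻ q *ᶻ s -ᶻ q *ᶻ q *ᶻ + 1)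
    ring₁ = solve-∀
    ring₂ : ∀ q → q *ᶻ q *ᶻ ((q +ᶻ + 1) *ᶻ (+ 3 *ᶻ q +ᶻ + 1)) -ᶻ (+ 2 *ᶻ q *ᶻ (q *ᶻ q *ᶻ (q +ᶻ + 1)) -ᶻ q *ᶻ q *ᶻ (q *ᶻ q))
                  -ᶻ ((q +ᶻ + 1) *ᶻ (q +ᶻ + 1) -ᶻ q) *ᶻ ((q +ᶻ + 1) *ᶻ (q +ᶻ + 1) -ᶻ q)
                  ≡ (q +ᶻ + 1) *ᶻ (q *ᶻ q *ᶻ q -ᶻ q *ᶻ q -ᶻ q -ᶻ + 1)
    ring₂ = solve-∀
    lhs : ∑ D -ᶻ D 0# ≡ 𝐪 *ᶻ 𝐪 *ᶻ ∑ (λ s → reps s *ᶻ reps s) -ᶻ k -ᶻ d₀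
    lhs = cong₂ _-ᶻ_ (begin
      ∑ D
        ≡⟨ ∑-cong (λ c → ring₁ (σ c *ᶻ σ c) 𝐪) ⟩
      ∑ (λ c → σ c *ᶻ σ c *ᶻ (σ c *ᶻ σ c) -ᶻ (+ 2 *ᶻ 𝐪 *ᶻ (σ c *ᶻ σ c) -ᶻ 𝐪 *ᶻ 𝐪 *ᶻ + 1))
        ≡⟨ ∑-- (λ c → σ c *ᶻ σ c *ᶻ (σ c *ᶻ σ c)) (λ c → + 2 *ᶻ 𝐪 *ᶻ (σ c *ᶻ σ c) -ᶻ 𝐪 *ᶻ 𝐪 *ᶻ + 1) ⟩
      ∑ (λ c → σ c *ᶻ σ c *ᶻ (σ c *ᶻ σ c)) -ᶻ ∑ (λ c → + 2 *ᶻ 𝐪 *ᶻ (σ c *ᶻ σ c) -ᶻ 𝐪 *ᶻ 𝐪 *ᶻ + 1)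
        ≡⟨ cong₂ _-ᶻ_ ∑σ⁴ (trans (∑-- (λ c → + 2 *ᶻ 𝐪 *ᶻ (σ c *ᶻ σ c)) (λ _ → 𝐪 *ᶻ 𝐪 *ᶻ + 1))
             (cong₂ _-ᶻ_ (trans (∑-* (+ 2 *ᶻ 𝐪) (λ c → σ c *ᶻ σ c)) (cong (+ 2 *ᶻ 𝐪 *ᶻ_) ∑σ²))
                         (trans (∑-* (𝐪 *ᶻ 𝐪) (λ _ → + 1)) (cong (𝐪 *ᶻ 𝐪 *ᶻ_) (trans ∑-1 𝐪²))))) ⟩
      𝐪 *ᶻ 𝐪 *ᶻ ∑ (λ s → reps s *ᶻ reps s) -ᶻ k ∎)
      (cong (λ z → (z *ᶻ z -ᶻ 𝐪) *ᶻ (z *ᶻ z -ᶻ 𝐪)) σ-0#)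

  -- The elements with the norm of c are cv for v ∈ U: there are q + 1 of them, all with the same
  -- value of σ.
  ∑-D-orbit : ∀ {c} → c ≢ 0# → ∑ (λ x → ⟦ norm x ≟ norm c ⟧ *ᶻ D x) ≡ (𝐪 +ᶻ + 1) *ᶻ D c
  ∑-D-orbit {c} c≢0 = begin
    ∑ (λ x → ⟦ norm x ≟ norm c ⟧ *ᶻ D x)              ≡⟨ ∑-scale _ c≢0 ⟩
    ∑ (λ v → ⟦ norm (c * v) ≟ norm c ⟧ *ᶻ D (c * v))  ≡⟨ ∑-cong (λ v → cong (_*ᶻ D (c * v)) (⟦⟧-cong (norm (c * v) ≟ norm c) (inU? v)
                                                          (λ e → *-cancelˡ (norm-≢0 c≢0) (trans (sym (norm-* c v)) (trans e (sym (*-identityʳ _)))))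
                                                          (λ i → trans (norm-* c v) (trans (cong (norm c *_) i) (*-identityʳ _))))) ⟩
    ∑U (λ v → D (c * v))                              ≡⟨ ∑U-cong (λ v i → trans (cong (λ z → (z *ᶻ z -ᶻ 𝐪) *ᶻ (z *ᶻ z -ᶻ 𝐪)) (σ-U-invariant c i)) (sym (ℤ.*-identityʳ (D c)))) ⟩
    ∑U (λ v → D c *ᶻ + 1)                             ≡⟨ ∑U-* (D c) (λ _ → + 1) ⟩
    D c *ᶻ ∑U (λ _ → + 1)                             ≡⟨ trans (cong (D c *ᶻ_) card-U) (ℤ.*-comm (D c) (𝐪 +ᶻ + 1)) ⟩
    (𝐪 +ᶻ + 1) *ᶻ D c                                 ∎

  -- The hypothesis makes P nonpositive at 0 and at most 1 elsewhere. It is used with P the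
  -- indicator of one norm class or of two disjoint ones.
  ∑-weighted-D≤ : ∀ (P : F → ℤ) → (∀ x → ⟦ x ≟ 0# ⟧ +ᶻ P x ≤ᶻ + 1) → ∑ (λ x → P x *ᶻ D x) ≤ᶻ ∑ D -ᶻ D 0#
  ∑-weighted-D≤ P P≤ = subst₂ _≤ᶻ_ split refl (ℤ.+-monoˡ-≤ (-ᶻ D 0#) (∑-mono pointwise))
    where
    ring₁ : ∀ a b → (a +ᶻ b) -ᶻ a ≡ b
    ring₁ = solve-∀
    split : ∑ (λ x → (⟦ x ≟ 0# ⟧ +ᶻ P x) *ᶻ D x) -ᶻ D 0# ≡ ∑ (λ x → P x *ᶻ D x)
    split = trans (cong (_-ᶻ D 0#) (trans (∑-cong λ x → ℤ.*-distribʳ-+ (D x) ⟦ x ≟ 0# ⟧ (P x))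
      (trans (∑-+ (λ x → ⟦ x ≟ 0# ⟧ *ᶻ D x) (λ x → P x *ᶻ D x)) (cong (_+ᶻ ∑ (λ x → P x *ᶻ D x)) (∑-δ D 0#)))))
      (ring₁ (D 0#) (∑ (λ x → P x *ᶻ D x)))
    pointwise : ∀ x → (⟦ x ≟ 0# ⟧ +ᶻ P x) *ᶻ D x ≤ᶻ D x
    pointwise x = subst ((⟦ x ≟ 0# ⟧ +ᶻ P x) *ᶻ D x ≤ᶻ_) (ℤ.*-identityˡ (D x))
      (ℤ.*-monoʳ-≤-nonNeg (D x) {{ℤ.nonNegative (i*i≥0 (σ x *ᶻ σ x -ᶻ 𝐪))}} (P≤ x))

  cancel-𝐪+1 : ∀ {x y} → (𝐪 +ᶻ + 1) *ᶻ x ≤ᶻ (𝐪 +ᶻ + 1) *ᶻ y → x ≤ᶻ y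
  cancel-𝐪+1 {x} {y} = ℤ.*-cancelˡ-≤-pos x y (𝐪 +ᶻ + 1) {{ℤ.positive (ℤ.+<+ (ℕ.≤-trans (s≤s z≤n) (ℕ.m≤n+m 1 q)))}}

  norm-0# : norm 0# ≡ 0#
  norm-0# = zeroˡ _

  D≤B : ∀ {c} → c ≢ 0# → D c ≤ᶻ B
  D≤B {c} c≢0 = cancel-𝐪+1 (ℤ.≤-trans (ℤ.≤-reflexive (sym (∑-D-orbit c≢0)))
    (ℤ.≤-trans (∑-weighted-D≤ (λ x → ⟦ norm x ≟ norm c ⟧) bound) ∑D-D₀≤))
    where
    bound : ∀ x → ⟦ x ≟ 0# ⟧ +ᶻ ⟦ norm x ≟ norm c ⟧ ≤ᶻ + 1
    bound x with x ≟ 0# | norm x ≟ norm c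
    ... | yes refl | yes e = ⊥-elim (norm-≢0 c≢0 (trans (sym e) norm-0#))
    ... | yes _    | no _  = ℤ.≤-refl
    ... | no _     | yes _ = ℤ.≤-refl
    ... | no _     | no _  = ℤ.+≤+ z≤n

  D+D≤B : ∀ {c c′} → c ≢ 0# → c′ ≢ 0# → norm c ≢ norm c′ → D c +ᶻ D c′ ≤ᶻ B
  D+D≤B {c} {c′} c≢0 c′≢0 c≁c′ = cancel-𝐪+1 (ℤ.≤-trans (ℤ.≤-reflexive (begin
      (𝐪 +ᶻ + 1) *ᶻ (D c +ᶻ D c′)                                                       ≡⟨ ℤ.*-distribˡ-+ (𝐪 +ᶻ + 1) (D c) (D c′) ⟩
      (𝐪 +ᶻ + 1) *ᶻ D c +ᶻ (𝐪 +ᶻ + 1) *ᶻ D c′                                           ≡⟨ cong₂ _+ᶻ_ (∑-D-orbit c≢0) (∑-D-orbit c′≢0) ⟨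
      ∑ (λ x → ⟦ norm x ≟ norm c ⟧ *ᶻ D x) +ᶻ ∑ (λ x → ⟦ norm x ≟ norm c′ ⟧ *ᶻ D x)     ≡⟨ ∑-+ (λ x → ⟦ norm x ≟ norm c ⟧ *ᶻ D x) (λ x → ⟦ norm x ≟ norm c′ ⟧ *ᶻ D x) ⟨
      ∑ (λ x → ⟦ norm x ≟ norm c ⟧ *ᶻ D x +ᶻ ⟦ norm x ≟ norm c′ ⟧ *ᶻ D x)               ≡⟨ ∑-cong (λ x → sym (ℤ.*-distribʳ-+ (D x) ⟦ norm x ≟ norm c ⟧ ⟦ norm x ≟ norm c′ ⟧)) ⟩
      ∑ (λ x → (⟦ norm x ≟ norm c ⟧ +ᶻ ⟦ norm x ≟ norm c′ ⟧) *ᶻ D x)                    ∎))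
    (ℤ.≤-trans (∑-weighted-D≤ (λ x → ⟦ norm x ≟ norm c ⟧ +ᶻ ⟦ norm x ≟ norm c′ ⟧) bound) ∑D-D₀≤))
    where
    bound : ∀ x → ⟦ x ≟ 0# ⟧ +ᶻ (⟦ norm x ≟ norm c ⟧ +ᶻ ⟦ norm x ≟ norm c′ ⟧) ≤ᶻ + 1
    bound x with x ≟ 0# | norm x ≟ norm c | norm x ≟ norm c′
    ... | yes refl | yes e | _     = ⊥-elim (norm-≢0 c≢0 (trans (sym e) norm-0#))
    ... | yes refl | no _  | yes e = ⊥-elim (norm-≢0 c′≢0 (trans (sym e) norm-0#))
    ... | no _     | yes e | yes f = ⊥-elim (c≁c′ (trans (sym e) f))
    ... | yes _    | no _  | no _  = ℤ.≤-refl
    ... | no _     | yes _ | no _  = ℤ.≤-refl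
    ... | no _     | no _  | yes _ = ℤ.≤-refl
    ... | no _     | no _  | no _  = ℤ.+≤+ z≤n

  -- Truncated counterpart of `D` in the natural numbers.
  excess : F → ℕ
  excess c = (ℤ.∣ σ c ∣ ℕ.* ℤ.∣ σ c ∣ ℕ.∸ q) ℕ.* (ℤ.∣ σ c ∣ ℕ.* ℤ.∣ σ c ∣ ℕ.∸ q)

  excess≤D : ∀ c → + excess c ≤ᶻ D c
  excess≤D c = subst (λ z → + excess c ≤ᶻ (z -ᶻ 𝐪) *ᶻ (z -ᶻ 𝐪)) (∣i∣*∣i∣≡i*i (σ c)) (∸-square-≤ (ℤ.∣ σ c ∣ ℕ.* ℤ.∣ σ c ∣) q)

  ≤B⇒≤q³ : ∀ {k} → + k ≤ᶻ B → k ℕ.+ (q ℕ.* q ℕ.+ q ℕ.+ 1) ≤ q ℕ.* q ℕ.* q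
  ≤B⇒≤q³ {k} le = ℤ.drop‿+≤+ (subst (+ (k ℕ.+ (q ℕ.* q ℕ.+ q ℕ.+ 1)) ≤ᶻ_) rhs (ℤ.+-monoˡ-≤ (+ (q ℕ.* q ℕ.+ q ℕ.+ 1)) le))
    where
    ring : ∀ q → (q *ᶻ q *ᶻ q -ᶻ q *ᶻ q -ᶻ q -ᶻ + 1) +ᶻ (q *ᶻ q +ᶻ q +ᶻ + 1) ≡ q *ᶻ q *ᶻ q
    ring = solve-∀
    rhs : B +ᶻ + (q ℕ.* q ℕ.+ q ℕ.+ 1) ≡ + (q ℕ.* q ℕ.* q)
    rhs = trans (cong (λ z → B +ᶻ (z +ᶻ 𝐪 +ᶻ + 1)) (ℤ.pos-* q q)) (trans (ring 𝐪) (sym (trans (ℤ.pos-* (q ℕ.* q) q) (cong (_*ᶻ 𝐪) (ℤ.pos-* q q)))))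

  excess-bound : ∀ {c} → c ≢ 0# → excess c ℕ.+ (q ℕ.* q ℕ.+ q ℕ.+ 1) ≤ q ℕ.* q ℕ.* q
  excess-bound c≢0 = ≤B⇒≤q³ (ℤ.≤-trans (excess≤D _) (D≤B c≢0))

  excess-bound₂ : ∀ {c c′} → c ≢ 0# → c′ ≢ 0# → norm c ≢ norm c′ → excess c ℕ.+ excess c′ ℕ.+ (q ℕ.* q ℕ.+ q ℕ.+ 1) ≤ q ℕ.* q ℕ.* q
  excess-bound₂ c≢0 c′≢0 c≁c′ = ≤B⇒≤q³ (ℤ.≤-trans (ℤ.+-mono-≤ (excess≤D _) (excess≤D _)) (D+D≤B c≢0 c′≢0 c≁c′))

-- Writing Y = x² - q and k = c + 11: q² ≤ 9Y + 11q gives c q² ≤ 9kY, hence c² k q³ ≤ 81 k² Y² ≤ 81 k² q³.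
no-large-excess′ : ∀ k c {q x} → c ℕ.+ 11 ≡ k → (k ℕ.* 9) ℕ.* (k ℕ.* 9) ℕ.< c ℕ.* c ℕ.* k → k ≤ q → q ≤ suc (3 ℕ.* x) →
                   ¬ (x ℕ.* x ℕ.∸ q) ℕ.* (x ℕ.* x ℕ.∸ q) ≤ q ℕ.* q ℕ.* q
no-large-excess′ _ c {zero} refl _ k≤0 _ _ with () ← ℕ.≤-trans (ℕ.m≤n+m 11 c) k≤0
no-large-excess′ _ c {suc p} {x} refl lt k≤q (s≤s p≤3x) Y²≤q³ = ℕ.<⇒≱ lt (ℕ.*-cancelʳ-≤ (c ℕ.* c ℕ.* k) (e ℕ.* e) (q ℕ.* q ℕ.* q) (begin
  c ℕ.* c ℕ.* k ℕ.* (q ℕ.* q ℕ.* q)                  ≡⟨ ℕ.*-assoc (c ℕ.* c) k (q ℕ.* q ℕ.* q) ⟩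
  c ℕ.* c ℕ.* (k ℕ.* (q ℕ.* q ℕ.* q))                ≤⟨ ℕ.*-monoʳ-≤ (c ℕ.* c) (ℕ.*-monoˡ-≤ (q ℕ.* q ℕ.* q) k≤q) ⟩
  c ℕ.* c ℕ.* (q ℕ.* (q ℕ.* q ℕ.* q))                ≡⟨ ring₄ c q ⟩
  c ℕ.* (q ℕ.* q) ℕ.* (c ℕ.* (q ℕ.* q))              ≤⟨ ℕ.*-mono-≤ cq²≤eY cq²≤eY ⟩
  e ℕ.* Y ℕ.* (e ℕ.* Y)                              ≡⟨ ring₅ e Y ⟩
  e ℕ.* e ℕ.* (Y ℕ.* Y)                              ≤⟨ ℕ.*-monoʳ-≤ (e ℕ.* e) Y²≤q³ ⟩
  e ℕ.* e ℕ.* (q ℕ.* q ℕ.* q)                        ∎))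
  where
  open ℕ.≤-Reasoning
  q = suc p
  k = c ℕ.+ 11
  e = k ℕ.* 9
  Y = x ℕ.* x ℕ.∸ q
  ring₁ : ∀ p → suc p ℕ.* suc p ≡ p ℕ.* p ℕ.+ (p ℕ.+ suc p)
  ring₁ = ℕ-solve-∀
  ring₂ : ∀ x → 3 ℕ.* x ℕ.* (3 ℕ.* x) ≡ 9 ℕ.* (x ℕ.* x)
  ring₂ = ℕ-solve-∀
  ring₄ : ∀ a q → a ℕ.* a ℕ.* (q ℕ.* (q ℕ.* q ℕ.* q)) ≡ a ℕ.* (q ℕ.* q) ℕ.* (a ℕ.* (q ℕ.* q))
  ring₄ = ℕ-solve-∀
  ring₅ : ∀ a y → a ℕ.* y ℕ.* (a ℕ.* y) ≡ a ℕ.* a ℕ.* (y ℕ.* y)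
  ring₅ = ℕ-solve-∀
  ring₆ : ∀ y q → 9 ℕ.* (q ℕ.+ y) ℕ.+ (q ℕ.+ q) ≡ 9 ℕ.* y ℕ.+ 11 ℕ.* q
  ring₆ = ℕ-solve-∀
  ring₇ : ∀ a y q → a ℕ.* (9 ℕ.* y ℕ.+ 11 ℕ.* q) ≡ a ℕ.* 9 ℕ.* y ℕ.+ 11 ℕ.* (a ℕ.* q)
  ring₇ = ℕ-solve-∀
  q²≤9Y+11q : q ℕ.* q ≤ 9 ℕ.* Y ℕ.+ 11 ℕ.* q
  q²≤9Y+11q = begin
    q ℕ.* q                                          ≡⟨ ring₁ p ⟩
    p ℕ.* p ℕ.+ (p ℕ.+ q)                            ≤⟨ ℕ.+-mono-≤ (ℕ.*-mono-≤ p≤3x p≤3x) (ℕ.+-monoˡ-≤ q (ℕ.n≤1+n p)) ⟩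
    3 ℕ.* x ℕ.* (3 ℕ.* x) ℕ.+ (q ℕ.+ q)              ≡⟨ cong (ℕ._+ (q ℕ.+ q)) (ring₂ x) ⟩
    9 ℕ.* (x ℕ.* x) ℕ.+ (q ℕ.+ q)                    ≤⟨ ℕ.+-monoˡ-≤ (q ℕ.+ q) (ℕ.*-monoʳ-≤ 9 (ℕ.m≤n+m∸n (x ℕ.* x) q)) ⟩
    9 ℕ.* (q ℕ.+ Y) ℕ.+ (q ℕ.+ q)                    ≡⟨ ring₆ Y q ⟩
    9 ℕ.* Y ℕ.+ 11 ℕ.* q                             ∎
  cq²≤eY : c ℕ.* (q ℕ.* q) ≤ e ℕ.* Y
  cq²≤eY = ℕ.+-cancelʳ-≤ (11 ℕ.* (q ℕ.* q)) _ _ (begin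
    c ℕ.* (q ℕ.* q) ℕ.+ 11 ℕ.* (q ℕ.* q)             ≡⟨ ℕ.*-distribʳ-+ (q ℕ.* q) c 11 ⟨
    k ℕ.* (q ℕ.* q)                                  ≤⟨ ℕ.*-monoʳ-≤ k q²≤9Y+11q ⟩
    k ℕ.* (9 ℕ.* Y ℕ.+ 11 ℕ.* q)                     ≡⟨ ring₇ k Y q ⟩
    e ℕ.* Y ℕ.+ 11 ℕ.* (k ℕ.* q)                     ≤⟨ ℕ.+-monoʳ-≤ (e ℕ.* Y) (ℕ.*-monoʳ-≤ 11 (ℕ.*-monoˡ-≤ q k≤q)) ⟩
    e ℕ.* Y ℕ.+ 11 ℕ.* (q ℕ.* q)                     ∎)

-- With k = 128 and c = 117 the condition on the constants reads (128 · 9)² = 1327104 < 1752192 =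
-- 117² · 128. With k = 64 and c = 53 it fails, since 331776 > 179776.
no-large-excess : ∀ {q x} → 128 ≤ q → q ≤ suc (3 ℕ.* x) → ¬ (x ℕ.* x ℕ.∸ q) ℕ.* (x ℕ.* x ℕ.∸ q) ≤ q ℕ.* q ℕ.* q
no-large-excess {q} {x} = no-large-excess′ 128 117 {q} {x} refl (ℕ.<ᵇ⇒< 1327104 1752192 tt)

square∸64 : ℕ → ℕ
square∸64 x = (x ℕ.* x ℕ.∸ 64) ℕ.* (x ℕ.* x ℕ.∸ 64)

-- Here 4161 = 64² + 64 + 1 and 262144 = 64³. Already at x = 24 the first term is (576 - 64)² = 512²
-- = 64³, which leaves no room for 4161.
square∸64⇒<24 : ∀ {x} → square∸64 x ℕ.+ 4161 ≤ 262144 → x ℕ.< 24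
square∸64⇒<24 {x} le = ℕ.≰⇒> λ 24≤x → let 512≤ = ℕ.∸-monoˡ-≤ 64 (ℕ.*-mono-≤ 24≤x 24≤x) in
  ℕ.<-irrefl refl (ℕ.≤-trans (ℕ.+-monoˡ-≤ 4161 (ℕ.*-mono-≤ 512≤ 512≤)) (ℕ.≤-trans le (ℕ.m≤m+n 262144 4160)))

-- Decided over all 24 · 24 pairs. The larger sum x counts twice, because the third of the three
-- sums is only known to be at most x. The bound is sharp: x = 23 allows y = 16.
square∸64-pair : ∀ {x} → x ℕ.< 24 → ∀ {y} → y ℕ.< 24 → square∸64 x ℕ.+ square∸64 y ℕ.+ 4161 ≤ 262144 → x ℕ.+ x ℕ.+ y ≤ 62
square∸64-pair = toWitness {a? = ℕ.allUpTo? (λ x → ℕ.allUpTo? (λ y →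
  (square∸64 x ℕ.+ square∸64 y ℕ.+ 4161 ℕ.≤? 262144) →-dec (x ℕ.+ x ℕ.+ y ℕ.≤? 62)) 24) 24} tt

-- Bentness forces b ∈ U.

module OffCircle (n : ℕ) (6≤n : 6 ≤ n) (K : GF2 (2 ℕ.* n)) where
  open KloostermanBound n (ℕ.≤-trans (s≤s (s≤s z≤n)) 6≤n) K public
  open ≡-Reasoning

  sum≤3max : ∀ {x y z} → y ≤ x → z ≤ x → x ℕ.+ y ℕ.+ z ≤ 3 ℕ.* x
  sum≤3max {x} y≤x z≤x = ℕ.≤-trans (ℕ.+-mono-≤ (ℕ.+-monoʳ-≤ x y≤x) z≤x)
    (ℕ.≤-reflexive (trans (ℕ.+-assoc x x x) (cong (λ z → x ℕ.+ (x ℕ.+ z)) (sym (ℕ.+-identityʳ x)))))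

  module _ (q≡64 : q ≡ 64) where

    σ<24 : ∀ {c} → c ≢ 0# → ℤ.∣ σ c ∣ ℕ.< 24
    σ<24 {c} c≢0 = square∸64⇒<24 {ℤ.∣ σ c ∣} (subst (λ k → (ℤ.∣ σ c ∣ ℕ.* ℤ.∣ σ c ∣ ℕ.∸ k) ℕ.* (ℤ.∣ σ c ∣ ℕ.* ℤ.∣ σ c ∣ ℕ.∸ k) ℕ.+ (k ℕ.* k ℕ.+ k ℕ.+ 1) ≤ k ℕ.* k ℕ.* k) q≡64 (excess-bound c≢0))

    2σ+σ≤62 : ∀ {c c′} → c ≢ 0# → c′ ≢ 0# → norm c ≢ norm c′ → ℤ.∣ σ c ∣ ℕ.+ ℤ.∣ σ c ∣ ℕ.+ ℤ.∣ σ c′ ∣ ≤ 62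
    2σ+σ≤62 {c} {c′} c≢0 c′≢0 c≁c′ = square∸64-pair {ℤ.∣ σ c ∣} (σ<24 c≢0) {ℤ.∣ σ c′ ∣} (σ<24 c′≢0)
      (subst (λ k → (ℤ.∣ σ c ∣ ℕ.* ℤ.∣ σ c ∣ ℕ.∸ k) ℕ.* (ℤ.∣ σ c ∣ ℕ.* ℤ.∣ σ c ∣ ℕ.∸ k) ℕ.+ (ℤ.∣ σ c′ ∣ ℕ.* ℤ.∣ σ c′ ∣ ℕ.∸ k) ℕ.* (ℤ.∣ σ c′ ∣ ℕ.* ℤ.∣ σ c′ ∣ ℕ.∸ k) ℕ.+ (k ℕ.* k ℕ.+ k ℕ.+ 1) ≤ k ℕ.* k ℕ.* k) q≡64 (excess-bound₂ c≢0 c′≢0 c≁c′))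

    -- Such a v is a primitive cube root of unity, so v^64 = v since 3 ∣ 63.
    no-cube-root : ∀ {v} → norm v ≡ 1# → ¬ norm (1# + v) ≡ 1#
    no-cube-root {v} v∈U 1+v∈U = 0≢1 (trans (sym (x+x≡0 v)) (trans (cong (λ z → v + z) (sym v̄≡v)) v+v̄≡1))
      where
      v+v̄≡1 : v + conj v ≡ 1#
      v+v̄≡1 = begin
        v + conj v                                ≡⟨ solve 2 (λ v w → v :+ w := con true :+ v :+ w :+ con true) refl v (conj v) ⟩
        1# + v + conj v + 1#                      ≡⟨ cong (λ z → 1# + v + conj v + z) v∈U ⟨
        1# + v + conj v + norm v                  ≡⟨ norm-1+ v ⟨
        norm (1# + v)                             ≡⟨ 1+v∈U ⟩
        1#                                        ∎
      v³≡1 : pow v 3 ≡ 1#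
      v³≡1 = begin
        v * (v * (v * 1#))                        ≡⟨ solve 2 (λ v w → v :* (v :* (v :* con true)) := v :* v :* (v :+ w) :+ v :* (v :* w)) refl v (conj v) ⟩
        v * v * (v + conj v) + v * norm v         ≡⟨ cong₂ (λ s t → v * v * s + v * t) v+v̄≡1 v∈U ⟩
        v * v * 1# + v * 1#                       ≡⟨ solve 2 (λ v w → v :* v :* con true :+ v :* con true := v :* (v :+ w) :+ v :* w :+ v) refl v (conj v) ⟩
        v * (v + conj v) + norm v + v             ≡⟨ cong₂ (λ s t → v * s + t + v) v+v̄≡1 v∈U ⟩
        v * 1# + 1# + v                           ≡⟨ solve 1 (λ v → v :* con true :+ con true :+ v := con true) refl v ⟩
        1#                                        ∎
      v̄≡v : conj v ≡ v
      v̄≡v = begin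
        conj v                                    ≡⟨ cong (pow v) q≡64 ⟩
        pow v (1 ℕ.+ 3 ℕ.* 21)                    ≡⟨ pow-+ v 1 (3 ℕ.* 21) ⟩
        v * 1# * pow v (3 ℕ.* 21)                 ≡⟨ cong₂ _*_ (*-identityʳ v) (trans (pow-* v 3 21) (trans (cong (λ z → pow z 21) v³≡1) (pow-1# 21))) ⟩
        v * 1#                                    ≡⟨ *-identityʳ v ⟩
        v                                         ∎

  -- If all three norms agreed, v = a′/a and 1 + v would both have norm 1, contrary to
  -- `no-cube-root`.
  norms-differ : q ≡ 64 → ∀ {a a′} → a ≢ 0# → norm a ≡ norm a′ → ¬ norm a ≡ norm (a + a′)
  norms-differ q≡64 {a} {a′} a≢0 e e′ = no-cube-root q≡64 {inv a * a′}
    (*-cancelˡ (norm-≢0 a≢0) (trans (sym (norm-* a _)) (trans (cong norm (*-inverseˡ a≢0 a′)) (trans (sym e) (sym (*-identityʳ _))))))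
    (*-cancelˡ (norm-≢0 a≢0) (trans (sym (norm-* a _)) (trans (cong norm (trans (distribˡ a 1# _) (cong₂ _+_ (*-identityʳ a) (*-inverseˡ a≢0 a′))))
      (trans (sym e′) (sym (*-identityʳ _))))))

  -- Here c carries the largest of the three sums. For n ≥ 7 the total is at most 3|σ(c)|. For n = 6
  -- one of c′, c″ has a norm different from that of c, and the remaining sum is replaced by |σ(c)|.
  dominated-⊥ : ∀ {c c′ c″} → c ≢ 0# → c′ ≢ 0# → c″ ≢ 0# → (q ≡ 64 → norm c ≡ norm c′ → ¬ norm c ≡ norm c″) →
                ℤ.∣ σ c′ ∣ ≤ ℤ.∣ σ c ∣ → ℤ.∣ σ c″ ∣ ≤ ℤ.∣ σ c ∣ → ¬ q ≤ suc (ℤ.∣ σ c ∣ ℕ.+ ℤ.∣ σ c′ ∣ ℕ.+ ℤ.∣ σ c″ ∣)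
  dominated-⊥ {c} {c′} {c″} c≢0 c′≢0 c″≢0 differ c′≤c c″≤c q≤ with ℕ.m≤n⇒m<n∨m≡n 6≤n
  ... | inj₁ 7≤n = no-large-excess {q} {ℤ.∣ σ c ∣} (ℕ.^-monoʳ-≤ 2 7≤n) (ℕ.≤-trans q≤ (s≤s (sum≤3max c′≤c c″≤c)))
                     (ℕ.≤-trans (ℕ.m≤m+n _ _) (excess-bound c≢0))
  ... | inj₂ 6≡n = ℕ.<⇒≱ (s≤s (s≤s sum≤62)) (ℕ.≤-trans (ℕ.≤-reflexive (sym q≡64)) q≤)
    where
    q≡64 : q ≡ 64
    q≡64 = cong (2 ℕ.^_) (sym 6≡n)
    sum≤62 : ℤ.∣ σ c ∣ ℕ.+ ℤ.∣ σ c′ ∣ ℕ.+ ℤ.∣ σ c″ ∣ ≤ 62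
    sum≤62 with norm c ≟ norm c′ | norm c ≟ norm c″
    ... | yes e | yes e′ = ⊥-elim (differ q≡64 e e′)
    ... | yes _ | no c≁c″ = ℕ.≤-trans (ℕ.+-monoˡ-≤ ℤ.∣ σ c″ ∣ (ℕ.+-monoʳ-≤ ℤ.∣ σ c ∣ c′≤c)) (2σ+σ≤62 q≡64 c≢0 c″≢0 c≁c″)
    ... | no c≁c′ | _ = ℕ.≤-trans (ℕ.≤-trans (ℕ.+-monoʳ-≤ (ℤ.∣ σ c ∣ ℕ.+ ℤ.∣ σ c′ ∣) c″≤c)
      (ℕ.≤-reflexive (trans (ℕ.+-assoc ℤ.∣ σ c ∣ _ _) (trans (cong (ℤ.∣ σ c ∣ ℕ.+_) (ℕ.+-comm ℤ.∣ σ c′ ∣ _)) (sym (ℕ.+-assoc ℤ.∣ σ c ∣ _ _))))))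
      (2σ+σ≤62 q≡64 c≢0 c′≢0 c≁c′)

  -- That the three norms are not all equal is a symmetric condition, so the largest sum may be
  -- moved to the front.
  sum-σ-⊥ : ∀ {c c′ c″} → c ≢ 0# → c′ ≢ 0# → c″ ≢ 0# → (q ≡ 64 → norm c ≡ norm c′ → ¬ norm c ≡ norm c″) →
            ¬ q ≤ suc (ℤ.∣ σ c ∣ ℕ.+ ℤ.∣ σ c′ ∣ ℕ.+ ℤ.∣ σ c″ ∣)
  sum-σ-⊥ {c} {c′} {c″} c≢0 c′≢0 c″≢0 differ q≤ with ℕ.≤-total ℤ.∣ σ c′ ∣ ℤ.∣ σ c ∣
  ... | inj₁ c′≤c with ℕ.≤-total ℤ.∣ σ c″ ∣ ℤ.∣ σ c ∣
  ...   | inj₁ c″≤c = dominated-⊥ c≢0 c′≢0 c″≢0 differ c′≤c c″≤c q≤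
  ...   | inj₂ c≤c″ = dominated-⊥ c″≢0 c≢0 c′≢0 (λ r e e′ → differ r (trans (sym e) e′) (sym e)) c≤c″ (ℕ.≤-trans c′≤c c≤c″)
                        (subst (λ z → q ≤ suc z) (trans (ℕ.+-comm (ℤ.∣ σ c ∣ ℕ.+ ℤ.∣ σ c′ ∣) ℤ.∣ σ c″ ∣) (sym (ℕ.+-assoc ℤ.∣ σ c″ ∣ _ _))) q≤)
  sum-σ-⊥ {c} {c′} {c″} c≢0 c′≢0 c″≢0 differ q≤ | inj₂ c≤c′ with ℕ.≤-total ℤ.∣ σ c″ ∣ ℤ.∣ σ c′ ∣
  ...   | inj₁ c″≤c′ = dominated-⊥ c′≢0 c≢0 c″≢0 (λ r e e′ → differ r (sym e) (trans (sym e) e′)) c≤c′ c″≤c′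
                        (subst (λ z → q ≤ suc (z ℕ.+ ℤ.∣ σ c″ ∣)) (ℕ.+-comm ℤ.∣ σ c ∣ ℤ.∣ σ c′ ∣) q≤)
  ...   | inj₂ c′≤c″ = dominated-⊥ c″≢0 c≢0 c′≢0 (λ r e e′ → differ r (trans (sym e) e′) (sym e)) (ℕ.≤-trans c≤c′ c′≤c″) c′≤c″
                        (subst (λ z → q ≤ suc z) (trans (ℕ.+-comm (ℤ.∣ σ c ∣ ℕ.+ ℤ.∣ σ c′ ∣) ℤ.∣ σ c″ ∣) (sym (ℕ.+-assoc ℤ.∣ σ c″ ∣ _ _))) q≤)

  ∣sign∣≡1 : ∀ v → ℤ.∣ sign v ∣ ≡ 1
  ∣sign∣≡1 v = [ cong ℤ.∣_∣ , cong ℤ.∣_∣ ]′ (sign-±1 v)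

  ∣S∣-off-circle : ∀ {b} (b∉U : ¬ InU b) a → ℤ.∣ S a b ∣ ≡ ℤ.∣ σ (a * inv (N b∉U)) ∣
  ∣S∣-off-circle {b} b∉U a = begin
    ℤ.∣ S a b ∣                                                           ≡⟨ cong ℤ.∣_∣ (S-off-circle b∉U a) ⟩
    ℤ.∣ χ (a * (inv (N b∉U) * conj b)) *ᶻ σ (a * inv (N b∉U)) ∣           ≡⟨ ℤ.abs-* (χ (a * (inv (N b∉U) * conj b))) (σ (a * inv (N b∉U))) ⟩
    ℤ.∣ χ (a * (inv (N b∉U) * conj b)) ∣ ℕ.* ℤ.∣ σ (a * inv (N b∉U)) ∣    ≡⟨ cong (ℕ._* ℤ.∣ σ (a * inv (N b∉U)) ∣) (∣sign∣≡1 (Tr₁²ⁿ (a * (inv (N b∉U) * conj b)))) ⟩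
    1 ℕ.* ℤ.∣ σ (a * inv (N b∉U)) ∣                                       ≡⟨ ℕ.*-identityˡ _ ⟩
    ℤ.∣ σ (a * inv (N b∉U)) ∣                                             ∎

  off-circle-⊥ : ∀ {a₁ a₂ b} → a₁ ≢ 0# → a₂ ≢ 0# → a₁ ≢ a₂ → ¬ InU b → ∀ v →
    ∑U (λ u → sign (Tr₁²ⁿ (a₁ * inv (u + b)) * Tr₁²ⁿ (a₂ * inv (u + b)))) ≢ sign v
  off-circle-⊥ {a₁} {a₂} {b} a₁≢0 a₂≢0 a₁≢a₂ b∉U v e = sum-σ-⊥ (scaled a₁≢0) (scaled a₂≢0) (scaled λ z → a₁≢a₂ (+≡0⇒≡ z)) differ
    (subst (λ z → q ≤ suc z) (cong₂ ℕ._+_ (cong₂ ℕ._+_ (∣S∣-off-circle b∉U a₁) (∣S∣-off-circle b∉U a₂)) (∣S∣-off-circle b∉U (a₁ + a₂))) bound)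
    where
    i = inv (N b∉U)
    i≢0 : i ≢ 0#
    i≢0 = inv-≢0 (N≢0 b∉U)
    scaled : ∀ {a} → a ≢ 0# → a * i ≢ 0#
    scaled a≢0 = *-≢0 a≢0 i≢0
    unscale : ∀ a a′ → norm (a * i) ≡ norm (a′ * i) → norm a ≡ norm a′
    unscale a a′ e = *-cancelˡ (norm-≢0 i≢0) (trans (*-comm _ _) (trans (sym (norm-* a i)) (trans e (trans (norm-* a′ i) (*-comm _ _)))))
    differ : q ≡ 64 → norm (a₁ * i) ≡ norm (a₂ * i) → ¬ norm (a₁ * i) ≡ norm ((a₁ + a₂) * i)
    differ r e e′ = norms-differ r a₁≢0 (unscale a₁ a₂ e) (unscale a₁ (a₁ + a₂) e′)
    S₁ = S a₁ b
    S₂ = S a₂ b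
    S₃ = S (a₁ + a₂) b
    ring : ∀ q x y z → q +ᶻ + 1 ≡ (q +ᶻ + 1 +ᶻ x +ᶻ y -ᶻ z) -ᶻ (x +ᶻ y -ᶻ z)
    ring = solve-∀
    𝐪+1≡ : 𝐪 +ᶻ + 1 ≡ + 2 *ᶻ sign v -ᶻ (S₁ +ᶻ S₂ -ᶻ S₃)
    𝐪+1≡ = trans (ring 𝐪 S₁ S₂ S₃) (cong (_-ᶻ (S₁ +ᶻ S₂ -ᶻ S₃)) (trans (sym (product-sum a₁ a₂ b)) (cong (+ 2 *ᶻ_) e)))
    -- The circle sum being ±1 gives q + 1 ≤ 2 + |S₁| + |S₂| + |S₃|, and one unit is then cancelled
    -- on both sides.
    bound : q ≤ suc (ℤ.∣ S₁ ∣ ℕ.+ ℤ.∣ S₂ ∣ ℕ.+ ℤ.∣ S₃ ∣)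
    bound = ℕ.≤-pred (subst₂ _≤_ (trans (cong ℤ.∣_∣ (sym 𝐪+1≡)) (ℕ.+-comm q 1)) (cong (ℕ._+ (ℤ.∣ S₁ ∣ ℕ.+ ℤ.∣ S₂ ∣ ℕ.+ ℤ.∣ S₃ ∣)) (trans (ℤ.abs-* (+ 2) (sign v)) (cong (2 ℕ.*_) (∣sign∣≡1 v))))
      (ℕ.≤-trans (ℤ.∣i-j∣≤∣i∣+∣j∣ (+ 2 *ᶻ sign v) (S₁ +ᶻ S₂ -ᶻ S₃)) (ℕ.+-monoʳ-≤ ℤ.∣ + 2 *ᶻ sign v ∣
        (ℕ.≤-trans (ℤ.∣i-j∣≤∣i∣+∣j∣ (S₁ +ᶻ S₂) S₃) (ℕ.+-monoˡ-≤ ℤ.∣ S₃ ∣ (ℤ.∣i+j∣≤∣i∣+∣j∣ S₁ S₂))))))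

-- Reading off the three conditions.

module Classification (n : ℕ) (6≤n : 6 ≤ n) (K : GF2 (2 ℕ.* n)) where
  open OffCircle n 6≤n K public
  open ≡-Reasoning

  pow-q+1 : ∀ b → pow b (q ℕ.+ 1) ≡ norm b
  pow-q+1 b = cong (pow b) (ℕ.+-comm q 1)

  sign≡1⇒≡0 : ∀ {v} → sign v ≡ + 1 → v ≡ 0#
  sign≡1⇒≡0 {v} e with v ≟ 0#
  ... | yes p = p
  sign≡1⇒≡0 {v} () | no _

  fixed⇒Trₙ²ⁿ≡0 : ∀ {c} → conj c ≡ c → Trₙ²ⁿ c ≡ 0#
  fixed⇒Trₙ²ⁿ≡0 {c} e = trans (Trₙ²ⁿ-def c) (≡⇒+≡0 (sym e))

  Trₙ²ⁿ≡0⇒fixed : ∀ {c} → Trₙ²ⁿ c ≡ 0# → conj c ≡ c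
  Trₙ²ⁿ≡0⇒fixed {c} e = sym (+≡0⇒≡ (trans (sym (Trₙ²ⁿ-def c)) e))

  fixed-+ : ∀ {x y} → conj x ≡ x → conj y ≡ y → conj (x + y) ≡ x + y
  fixed-+ {x} {y} e e′ = trans (conj-+ x y) (cong₂ _+_ e e′)

  ε-fixed : ∀ {c} → conj c ≡ c → ε c ≡ sign (Tr₁ⁿ c)
  ε-fixed {c} e = trans (cong (_*ᶻ sign (Tr₁ⁿ c)) (⟦⟧-yes (conj c ≟ c) e)) (ℤ.*-identityˡ (sign (Tr₁ⁿ c)))

  ε-moved : ∀ {c} → conj c ≢ c → ε c ≡ + 0
  ε-moved {c} ne = cong (_*ᶻ sign (Tr₁ⁿ c)) (⟦⟧-no (conj c ≟ c) ne)

  -- Excludes h₂(0) = 1: the circle sum would be -1, so 2 + qE = -2, but q ≥ 64 does not divide 4.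
  𝐪*i≢-4 : ∀ i → 𝐪 *ᶻ i ≢ -[1+ 3 ]
  𝐪*i≢-4 i e = ℕ.<⇒≱ (ℕ.≤-trans (ℕ.m≤m+n 5 59) (ℕ.^-monoʳ-≤ 2 6≤n)) (∣⇒≤ (divides ℤ.∣ i ∣
    (trans (cong ℤ.∣_∣ (sym e)) (trans (ℤ.abs-* 𝐪 i) (ℕ.*-comm q ℤ.∣ i ∣)))))

  module _ (a₁ a₂ b : F) where

    g : F → F
    g u = Tr₁²ⁿ (a₁ * inv (u + b)) * Tr₁²ⁿ (a₂ * inv (u + b))

    g-Bit : ∀ u → Bit (g u)
    g-Bit u = Bit-* (Tr₁²ⁿ-Bit _) (Tr₁²ⁿ-Bit _)

    module _ (b∈U : InU b) where

      bent⇒E≡0 : IsBent (h₂ a₁ a₂ b) → E b∈U a₁ a₂ ≡ + 0 × h₂ a₁ a₂ b 0# ≡ 0#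
      bent⇒E≡0 bent = by-cases (sign-±1 (h₂ a₁ a₂ b 0#))
        where
        ring : ∀ x → x ≡ (+ 2 +ᶻ x) -ᶻ + 2
        ring = solve-∀
        𝐪E : ∀ {s} → sign (h₂ a₁ a₂ b 0#) ≡ s → 𝐪 *ᶻ E b∈U a₁ a₂ ≡ + 2 *ᶻ s -ᶻ + 2
        𝐪E refl = trans (ring (𝐪 *ᶻ E b∈U a₁ a₂)) (cong (_-ᶻ + 2) (trans (sym (product-sum-on-circle b∈U a₁ a₂))
          (cong (+ 2 *ᶻ_) (bent⇒circleSum g g-Bit bent))))
        by-cases : sign (h₂ a₁ a₂ b 0#) ≡ + 1 ⊎ sign (h₂ a₁ a₂ b 0#) ≡ -[1+ 0 ] → E b∈U a₁ a₂ ≡ + 0 × h₂ a₁ a₂ b 0# ≡ 0#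
        by-cases (inj₁ s≡1) = [ (λ 𝐪≡0 → ⊥-elim (ℤ.<-irrefl (sym 𝐪≡0) 0<𝐪)) , id ]′ (ℤ.i*j≡0⇒i≡0∨j≡0 𝐪 (𝐪E s≡1)) , sign≡1⇒≡0 s≡1
        by-cases (inj₂ s≡-1) = ⊥-elim (𝐪*i≢-4 (E b∈U a₁ a₂) (𝐪E s≡-1))

      E≡0⇒bent : E b∈U a₁ a₂ ≡ + 0 → h₂ a₁ a₂ b 0# ≡ 0# → IsBent (h₂ a₁ a₂ b)
      E≡0⇒bent E≡0 h≡0 = circleSum⇒bent g g-Bit (trans (ℤ.*-cancelˡ-≡ (+ 2) (circleSum g g-Bit) (+ 1) (begin
        + 2 *ᶻ circleSum g g-Bit    ≡⟨ product-sum-on-circle b∈U a₁ a₂ ⟩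
        + 2 +ᶻ 𝐪 *ᶻ E b∈U a₁ a₂     ≡⟨ cong (λ z → + 2 +ᶻ 𝐪 *ᶻ z) E≡0 ⟩
        + 2 +ᶻ 𝐪 *ᶻ + 0             ≡⟨ cong (+ 2 +ᶻ_) (ℤ.*-zeroʳ 𝐪) ⟩
        + 2                         ∎)) (sym (trans (cong sign h≡0) sign-0#)))

      E-from : ∀ {x y z} → ε (a₁ * conj b) ≡ x → ε (a₂ * conj b) ≡ y → ε ((a₁ + a₂) * conj b) ≡ z → E b∈U a₁ a₂ ≡ + 1 +ᶻ x +ᶻ y -ᶻ z
      E-from refl refl refl = refl

      -- With b ∈ U and c = ab̄ ∈ 𝔽q, the norm of a equals that of c, which is c², and the trace
      -- ignores squaring. This converts the trace inside `ε` into the one in the theorem.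
      Tr₁ⁿ-norm : ∀ {a} → conj (a * conj b) ≡ a * conj b → Tr₁ⁿ (norm a) ≡ Tr₁ⁿ (a * conj b)
      Tr₁ⁿ-norm {a} e = trans (cong Tr₁ⁿ (begin
        norm a                         ≡⟨ *-identityʳ _ ⟨
        norm a * 1#                    ≡⟨ cong (norm a *_) (InU-conj b∈U) ⟨
        norm a * norm (conj b)         ≡⟨ norm-* a (conj b) ⟨
        a * conj b * conj (a * conj b) ≡⟨ cong (a * conj b *_) e ⟩
        a * conj b * (a * conj b)      ∎)) (TrGen-Frobenius-invariant n e)

    module _ (a₁≢0 : a₁ ≢ 0#) (a₁-fixed : conj a₁ ≡ a₁) (b∈U : InU b) (b≢1 : b ≢ 1#) where

      -- Otherwise b = b̄, hence b² = 1, and in characteristic 2 this means b = 1.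
      c₁-moved : conj (a₁ * conj b) ≢ a₁ * conj b
      c₁-moved e = b≢1 (+≡0⇒≡ (x*x≡0⇒x≡0 (begin
        (b + 1#) * (b + 1#)   ≡⟨ solve 1 (λ b → (b :+ con true) :* (b :+ con true) := b :* b :+ con true) refl b ⟩
        b * b + 1#            ≡⟨ cong (λ z → b * z + 1#) b≡b̄ ⟩
        b * conj b + 1#       ≡⟨ ≡⇒+≡0 b∈U ⟩
        0#                    ∎)))
        where
        b≡b̄ : b ≡ conj b
        b≡b̄ = *-cancelˡ a₁≢0 (trans (sym (trans (conj-* a₁ (conj b)) (cong₂ _*_ a₁-fixed (conj-involutive b)))) e)

      -- The sum of the two products is a₁b̄, which `c₁-moved` keeps out of 𝔽q. Hence at most one of
      -- the three ε-terms is nonzero, and conditions (2) and (3) exclude each other.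
      not-both-fixed : conj (a₂ * conj b) ≡ a₂ * conj b → conj ((a₁ + a₂) * conj b) ≢ (a₁ + a₂) * conj b
      not-both-fixed e₂ e₃ = c₁-moved (subst (λ z → conj z ≡ z)
        (solve 3 (λ a₁ a₂ b̄ → (a₁ :+ a₂) :* b̄ :+ a₂ :* b̄ := a₁ :* b̄) refl a₁ a₂ (conj b)) (fixed-+ e₃ e₂))

      E₂ : conj (a₂ * conj b) ≡ a₂ * conj b → E b∈U a₁ a₂ ≡ + 1 +ᶻ sign (Tr₁ⁿ (norm a₂))
      E₂ e = trans (E-from b∈U (ε-moved c₁-moved) (trans (ε-fixed e) (cong sign (sym (Tr₁ⁿ-norm b∈U e)))) (ε-moved (not-both-fixed e)))
        (ring (sign (Tr₁ⁿ (norm a₂))))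
        where
        ring : ∀ x → + 1 +ᶻ + 0 +ᶻ x -ᶻ + 0 ≡ + 1 +ᶻ x
        ring = solve-∀

      E₃ : conj ((a₁ + a₂) * conj b) ≡ (a₁ + a₂) * conj b → E b∈U a₁ a₂ ≡ + 1 -ᶻ sign (Tr₁ⁿ (norm (a₁ + a₂)))
      E₃ e = E-from b∈U (ε-moved c₁-moved) (ε-moved λ e₂ → not-both-fixed e₂ e) (trans (ε-fixed e) (cong sign (sym (Tr₁ⁿ-norm b∈U e))))

      E₀ : conj (a₂ * conj b) ≢ a₂ * conj b → conj ((a₁ + a₂) * conj b) ≢ (a₁ + a₂) * conj b → E b∈U a₁ a₂ ≡ + 1
      E₀ ne₂ ne₃ = E-from b∈U (ε-moved c₁-moved) (ε-moved ne₂) (ε-moved ne₃)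

  1+sign≡0⇒≡1 : ∀ {v} → Bit v → + 1 +ᶻ sign v ≡ + 0 → v ≡ 1#
  1+sign≡0⇒≡1 (inj₂ p) _ = p
  1+sign≡0⇒≡1 (inj₁ refl) e with () ← trans (sym e) (cong (+ 1 +ᶻ_) sign-0#)

  1-sign≡0⇒≡0 : ∀ {v} → Bit v → + 1 -ᶻ sign v ≡ + 0 → v ≡ 0#
  1-sign≡0⇒≡0 (inj₁ p) _ = p
  1-sign≡0⇒≡0 (inj₂ refl) e with () ← trans (sym e) (cong (λ z → + 1 -ᶻ z) sign-1#)

  Tr₁ⁿ-norm-Bit : ∀ a → Bit (Tr₁ⁿ (norm a))
  Tr₁ⁿ-norm-Bit a = TrGen-0⊎1 n (conj-norm a)

  module _ (a₁ a₂ : F) (a₁-fixed : conj a₁ ≡ a₁) where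

    -- At x = 0 the first factor is Tr(a₁), and this trace vanishes on 𝔽q. It supplies the equation
    -- h₂(0) = 0 that condition (1) leaves implicit.
    h₂-at-0 : h₂ a₁ a₂ 1# 0# ≡ 0#
    h₂-at-0 = trans (cong (_* Tr₁²ⁿ (a₂ * z)) (Tr₁²ⁿ-subfield (trans (conj-* a₁ z) (cong₂ _*_ a₁-fixed (trans (cong conj z≡1) (trans conj-1# (sym z≡1))))))) (zeroˡ _)
      where
      z = inv (pow 0# (q ℕ.∸ 1) + 1#)
      z≡1 : z ≡ 1#
      z≡1 = trans (cong inv (trans (cong (_+ 1#) (pow-0# 1≤q∸1)) (+-identityˡ 1#))) (sym (inv-unique (*-identityˡ 1#)))

    ε-1 : ∀ {a x} → ε a ≡ x → ε (a * conj 1#) ≡ x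
    ε-1 {a} e = trans (cong ε (trans (cong (a *_) conj-1#) (*-identityʳ a))) e

    E-at-1-moved : conj a₂ ≢ a₂ → E InU-1# a₁ a₂ ≡ + 1 +ᶻ sign (Tr₁ⁿ a₁)
    E-at-1-moved ne = trans (E-from a₁ a₂ 1# InU-1# (ε-1 (ε-fixed a₁-fixed)) (ε-1 (ε-moved ne))
      (ε-1 (ε-moved λ e → ne (subst (λ z → conj z ≡ z) (solve 2 (λ a₁ a₂ → a₁ :+ a₂ :+ a₁ := a₂) refl a₁ a₂) (fixed-+ e a₁-fixed)))))
      (ring (sign (Tr₁ⁿ a₁)))
      where
      ring : ∀ x → + 1 +ᶻ x +ᶻ + 0 -ᶻ + 0 ≡ + 1 +ᶻ x
      ring = solve-∀

    -- With all three coefficients in 𝔽q, E = 1 + x + y - xy for signs x and y, which is always 2 or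
    -- -2.
    E-at-1-fixed : conj a₂ ≡ a₂ → E InU-1# a₁ a₂ ≢ + 0
    E-at-1-fixed e E≡0 = nonzero (sign-±1 (Tr₁ⁿ a₁)) (sign-±1 (Tr₁ⁿ a₂)) (trans (sym (E-from a₁ a₂ 1# InU-1# (ε-1 (ε-fixed a₁-fixed)) (ε-1 (ε-fixed e))
      (ε-1 (trans (ε-fixed (fixed-+ a₁-fixed e)) (trans (cong sign (TrGen-+ n a₁ a₂)) (sign-+ (TrGen-0⊎1 n a₁-fixed) (TrGen-0⊎1 n e))))))) E≡0)
      where
      nonzero : ∀ {x y} → x ≡ + 1 ⊎ x ≡ -[1+ 0 ] → y ≡ + 1 ⊎ y ≡ -[1+ 0 ] → + 1 +ᶻ x +ᶻ y -ᶻ x *ᶻ y ≢ + 0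
      nonzero (inj₁ refl) (inj₁ refl) ()
      nonzero (inj₁ refl) (inj₂ refl) ()
      nonzero (inj₂ refl) (inj₁ refl) ()
      nonzero (inj₂ refl) (inj₂ refl) ()

theorem2 : (n : ℕ) → 6 ≤ n → (K : GF2 (2 ℕ.* n)) →
    let open Bent n K in
    (a₁ a₂ b : F) →
    a₁ ≢ 0# → conj a₁ ≡ a₁ →
    a₂ ≢ 0# → b ≢ 0# → a₁ ≢ a₂ →
    IsBent (h₂ a₁ a₂ b) ⇔
    ( (b ≡ 1# × Tr₁ⁿ a₁ ≡ 1# × conj a₂ ≢ a₂)
    ⊎ (pow b (q ℕ.+ 1) ≡ 1# × b ≢ 1# × Trₙ²ⁿ (a₂ * conj b) ≡ 0#
    × Tr₁ⁿ (a₂ * conj a₂) ≡ 1# × h₂ a₁ a₂ b 0# ≡ 0#)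
    ⊎ (pow b (q ℕ.+ 1) ≡ 1# × b ≢ 1# × Trₙ²ⁿ ((a₁ + a₂) * conj b) ≡ 0#
    × Tr₁ⁿ ((a₁ + a₂) * (a₁ + conj a₂)) ≡ 0# × h₂ a₁ a₂ b 0# ≡ 0#) )
theorem2 n 6≤n K a₁ a₂ b a₁≢0 a₁-fixed a₂≢0 _ a₁≢a₂ = mk⇔ (necessary b) (sufficient b)
  where
  open Classification n 6≤n K

  Conditions : F → Set
  Conditions b =
    (b ≡ 1# × Tr₁ⁿ a₁ ≡ 1# × conj a₂ ≢ a₂)
    ⊎ (pow b (q ℕ.+ 1) ≡ 1# × b ≢ 1# × Trₙ²ⁿ (a₂ * conj b) ≡ 0#
       × Tr₁ⁿ (a₂ * conj a₂) ≡ 1# × h₂ a₁ a₂ b 0# ≡ 0#)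
    ⊎ (pow b (q ℕ.+ 1) ≡ 1# × b ≢ 1# × Trₙ²ⁿ ((a₁ + a₂) * conj b) ≡ 0#
       × Tr₁ⁿ ((a₁ + a₂) * (a₁ + conj a₂)) ≡ 0# × h₂ a₁ a₂ b 0# ≡ 0#)

  norm-sum : norm (a₁ + a₂) ≡ (a₁ + a₂) * (a₁ + conj a₂)
  norm-sum = cong ((a₁ + a₂) *_) (trans (conj-+ a₁ a₂) (cong (_+ conj a₂) a₁-fixed))

  necessary : ∀ b → IsBent (h₂ a₁ a₂ b) → Conditions b
  necessary b bent with inU? b | b ≟ 1#
  ... | no b∉U | _ = ⊥-elim (off-circle-⊥ a₁≢0 a₂≢0 a₁≢a₂ b∉U (h₂ a₁ a₂ b 0#) (bent⇒circleSum (g a₁ a₂ b) (g-Bit a₁ a₂ b) bent))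
  ... | yes _ | yes refl = inj₁ (refl , at-1 (conj a₂ ≟ a₂))
    where
    E≡0 = proj₁ (bent⇒E≡0 a₁ a₂ 1# InU-1# bent)
    at-1 : Dec (conj a₂ ≡ a₂) → Tr₁ⁿ a₁ ≡ 1# × conj a₂ ≢ a₂
    at-1 (yes e) = ⊥-elim (E-at-1-fixed a₁ a₂ a₁-fixed e E≡0)
    at-1 (no ne) = 1+sign≡0⇒≡1 (TrGen-0⊎1 n a₁-fixed) (trans (sym (E-at-1-moved a₁ a₂ a₁-fixed ne)) E≡0) , ne
  ... | yes b∈U | no b≢1 = inj₂ (off-1 (conj (a₂ * conj b) ≟ a₂ * conj b) (conj ((a₁ + a₂) * conj b) ≟ (a₁ + a₂) * conj b))
    where
    E≡0 = proj₁ (bent⇒E≡0 a₁ a₂ b b∈U bent)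
    h≡0 = proj₂ (bent⇒E≡0 a₁ a₂ b b∈U bent)
    off-1 : Dec (conj (a₂ * conj b) ≡ a₂ * conj b) → Dec (conj ((a₁ + a₂) * conj b) ≡ (a₁ + a₂) * conj b) →
      (pow b (q ℕ.+ 1) ≡ 1# × b ≢ 1# × Trₙ²ⁿ (a₂ * conj b) ≡ 0# × Tr₁ⁿ (a₂ * conj a₂) ≡ 1# × h₂ a₁ a₂ b 0# ≡ 0#)
      ⊎ (pow b (q ℕ.+ 1) ≡ 1# × b ≢ 1# × Trₙ²ⁿ ((a₁ + a₂) * conj b) ≡ 0# × Tr₁ⁿ ((a₁ + a₂) * (a₁ + conj a₂)) ≡ 0# × h₂ a₁ a₂ b 0# ≡ 0#)
    off-1 (yes e) _ = inj₁ (trans (pow-q+1 b) b∈U , b≢1 , fixed⇒Trₙ²ⁿ≡0 e ,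
      1+sign≡0⇒≡1 (Tr₁ⁿ-norm-Bit a₂) (trans (sym (E₂ a₁ a₂ b a₁≢0 a₁-fixed b∈U b≢1 e)) E≡0) , h≡0)
    off-1 (no _) (yes e) = inj₂ (trans (pow-q+1 b) b∈U , b≢1 , fixed⇒Trₙ²ⁿ≡0 e ,
      trans (cong Tr₁ⁿ (sym norm-sum)) (1-sign≡0⇒≡0 (Tr₁ⁿ-norm-Bit (a₁ + a₂)) (trans (sym (E₃ a₁ a₂ b a₁≢0 a₁-fixed b∈U b≢1 e)) E≡0)) , h≡0)
    -- With neither product in 𝔽q all three ε-terms vanish, so E = 1.
    off-1 (no ne₂) (no ne₃) with () ← trans (sym E≡0) (E₀ a₁ a₂ b a₁≢0 a₁-fixed b∈U b≢1 ne₂ ne₃)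

  sufficient : ∀ b → Conditions b → IsBent (h₂ a₁ a₂ b)
  sufficient b (inj₁ (refl , t≡1 , ne)) = E≡0⇒bent a₁ a₂ 1# InU-1#
    (trans (E-at-1-moved a₁ a₂ a₁-fixed ne) (cong (+ 1 +ᶻ_) (trans (cong sign t≡1) sign-1#))) (h₂-at-0 a₁ a₂ a₁-fixed)
  sufficient b (inj₂ (inj₁ (pow≡1 , b≢1 , tr≡0 , t≡1 , h≡0))) = E≡0⇒bent a₁ a₂ b b∈U
    (trans (E₂ a₁ a₂ b a₁≢0 a₁-fixed b∈U b≢1 (Trₙ²ⁿ≡0⇒fixed tr≡0)) (cong (+ 1 +ᶻ_) (trans (cong sign t≡1) sign-1#))) h≡0
    where b∈U = trans (sym (pow-q+1 b)) pow≡1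
  sufficient b (inj₂ (inj₂ (pow≡1 , b≢1 , tr≡0 , t≡0 , h≡0))) = E≡0⇒bent a₁ a₂ b b∈U
    (trans (E₃ a₁ a₂ b a₁≢0 a₁-fixed b∈U b≢1 (Trₙ²ⁿ≡0⇒fixed tr≡0)) (cong (λ z → + 1 -ᶻ z) (trans (cong sign (trans (cong Tr₁ⁿ norm-sum) t≡0)) sign-0#))) h≡0
    where b∈U = trans (sym (pow-q+1 b)) pow≡1
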